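{- Let $\mathbb F_q$ be the finite field with $q=p^k$ elements ($p$ prime) and let $S\subseteq \mathbb F_q$ be an $\mathbb F_p$-vector subspace of dimension $r>0$. For a positive integer $n$, let $C_S(n)$ denote the set of monic irreducible polynomials $f\in\mathbb F_q[x]$ of degree $n$ such that $f(x+s)=f(x)$ for all $s\in S$. Then: (a) if $r>1$, then $|C_S(n)|=0$ for all $n$; (b) if $r=1$ and $p\nmid n$, then $|C_S(n)|=0$; (c) if $r=1$ and $n=pm$ with $m$ a positive integer, then $$|C_S(n)|=\frac{p-1}{pm}\sum_{d\mid m,\ \gcd(d,p)=1}q^{m/d}\mu(d),$$ where $\mu$ is the Möbius function.
   Context: A polynomial $f\in\mathbb F_q[x]$ is called $S$-translation invariant if $f(x+s)=f(x)$ for all $s\in S$. -}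

module Defs where

open import Level using (0ℓ)
open import Data.Nat as ℕ using (ℕ; zero; suc; _<_)
open import Data.Nat.Divisibility using (_∣_; _∣?_)
open import Data.Nat.Primality using (Prime; prime?)
open import Data.Nat.Coprimality using (Coprime; coprime?)
open import Data.Integer as ℤ using (ℤ; +_)
open import Data.Fin using (Fin)
open import Data.Fin.Subset using (Subset; _∈_; ∣_∣)
open import Data.Vec as Vec using (Vec)
open import Data.List as List using (List; []; _∷_; upTo; filter; map; length; sum)
open import Data.List.Membership.Propositional renaming (_∈_ to _∈ˡ_)
open import Data.List.Relation.Unary.Unique.Propositional using (Unique)
open import Data.Product using (Σ; ∃; _×_; _,_)
open import Data.Sum using (_⊎_)
open import Data.Bool using (if_then_else_)
open import Relation.Nullary using (¬_; does)
open import Relation.Nullary.Decidable using (_×-dec_)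
open import Relation.Binary.PropositionalEquality using (_≡_; _≢_)
open import Algebra.Structures using (IsCommutativeRing)
open import Function.Bundles using (_⇔_)

-- A finite field with q elements, presented (up to isomorphism) on the
-- carrier Fin q with propositional equality.

record FiniteField (q : ℕ) : Set where
  field
    _+_ _*_ : Fin q → Fin q → Fin q
    -_      : Fin q → Fin q
    0# 1#   : Fin q
    isCommutativeRing : IsCommutativeRing _≡_ _+_ _*_ -_ 0# 1#
    0≢1     : 0# ≢ 1#
    inverse : ∀ x → x ≢ 0# → ∃ λ y → (x * y) ≡ 1#

-- Polynomials over the field: coefficient lists, lowest degree first.

module Poly {q : ℕ} (F : FiniteField q) where
  open FiniteField F

  Pol : Set
  Pol = List (Fin q)

  coeff : Pol → ℕ → Fin q
  coeff []      _       = 0#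
  coeff (a ∷ f) zero    = a
  coeff (a ∷ f) (suc i) = coeff f i

  -- equality of polynomials (coefficientwise; trailing zeros irrelevant)
  _≈ₚ_ : Pol → Pol → Set
  f ≈ₚ g = ∀ i → coeff f i ≡ coeff g i

  _+ₚ_ : Pol → Pol → Pol
  []      +ₚ g       = g
  (a ∷ f) +ₚ []      = a ∷ f
  (a ∷ f) +ₚ (b ∷ g) = (a + b) ∷ (f +ₚ g)

  _*ₚ_ : Pol → Pol → Pol
  []      *ₚ g = []
  (a ∷ f) *ₚ g = map (a *_) g +ₚ (0# ∷ (f *ₚ g))

  one : Pol
  one = 1# ∷ []

  -- f(x + s), computed by Horner's scheme
  translate : Fin q → Pol → Pol
  translate s []      = []
  translate s (a ∷ f) = (a ∷ []) +ₚ ((s ∷ 1# ∷ []) *ₚ translate s f)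

  IsUnit : Pol → Set
  IsUnit g = ∃ λ u → (g *ₚ u) ≈ₚ one

  Irreducible : Pol → Set
  Irreducible f = ¬ (f ≈ₚ []) × ¬ IsUnit f
                × (∀ g h → (g *ₚ h) ≈ₚ f → IsUnit g ⊎ IsUnit h)

  monic : ∀ {n} → Vec (Fin q) n → Pol
  monic v = Vec.toList v List.++ (1# ∷ [])

  TranslationInvariant : Subset q → Pol → Set
  TranslationInvariant S f = ∀ s → s ∈ S → translate s f ≈ₚ f

  -- C_S(n), as a predicate on the lower coefficients of a monic degree-n f
  C : Subset q → (n : ℕ) → Vec (Fin q) n → Set
  C S n v = Irreducible (monic v) × TranslationInvariant S (monic v)

  -- S is an F_p-vector subspace (additive subgroup) of F_q
  IsSubspace : Subset q → Set
  IsSubspace S = (0# ∈ S) × (∀ x y → x ∈ S → y ∈ S → (x + y) ∈ S)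
               × (∀ x → x ∈ S → (- x) ∈ S)

HasSize : {A : Set} → (A → Set) → ℕ → Set
HasSize {A} P N = Σ (List A) λ L → Unique L × (∀ x → (x ∈ˡ L) ⇔ P x) × length L ≡ N

primeDivisors : ℕ → List ℕ
primeDivisors n = filter (λ d → prime? d ×-dec (d ∣? n)) (upTo (suc n))

squarePrimeDivisors : ℕ → List ℕ
squarePrimeDivisors n = filter (λ d → prime? d ×-dec ((d ℕ.* d) ∣? n)) (upTo (suc n))

μ : ℕ → ℤ
μ n with squarePrimeDivisors n
... | []    = (ℤ.- (+ 1)) ℤ.^ length (primeDivisors n)
... | _ ∷ _ = + 0

divisorSum : (p q m : ℕ) → ℤ
divisorSum p q m =
  List.foldr ℤ._+_ (+ 0)
    (map (λ k → (+ (q ℕ.^ (m ℕ./ suc k))) ℤ.* μ (suc k))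
         (filter (λ k → (suc k ∣? m) ×-dec coprime? (suc k) p) (upTo m)))

{-# OPTIONS --safe #-}
module Submission where

-- Let a ≠ 0 lie in S. A polynomial is invariant under x ↦ x + a iff it is g(L(x)) with
-- L = x^p − a^(p−1) x; in particular its degree is divisible by p, which gives (b). For an
-- irreducible g of degree m, g(L(x)) is either irreducible or the product of the p distinct
-- conjugates h(x + i a) of an irreducible h of degree m. Hence p I(m) = p D(pm) + I(m) − D(m),
-- where I(m) is the number of irreducibles of degree m and D(m) that of the invariant ones.
-- Unique factorization gives ∑_{d ∣ m} d I(d) = q^m, and (c) follows by Möbius inversion.
-- The recursion also shows that D does not depend on a. If b ∈ S is not a multiple of a,
-- the same count restricted to those g that are invariant under L(b) yields D₂(pm) = D₂(m)
-- for the number D₂ of irreducibles invariant under both a and b; since D₂(m) = 0 for p ∤ m,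
-- it vanishes identically, which is (a).

open import Defs
open import Algebra.Bundles using (CommutativeMonoid; CommutativeRing)
import Algebra.Properties.AbelianGroup as AbelianGroupProperties
import Algebra.Properties.CommutativeMonoid.Sum as CommutativeMonoidSum
import Algebra.Properties.CommutativeSemigroup as CommutativeSemigroupProperties
import Algebra.Properties.Ring as RingProperties
import Algebra.Properties.Semiring.Mult as SemiringMult
open import Algebra.Structures using (IsCommutativeMonoid; IsCommutativeRing)
open import Data.Bool using (if_then_else_; true; false)
open import Data.Empty using (⊥; ⊥-elim)
open import Data.Fin using (Fin; zero; suc)
open import Data.Fin.Permutation using (permutation)
import Data.Fin.Properties as FinP
open import Data.Fin.Subset using (Subset) renaming (_∈_ to _∈ₛ_)
open import Data.Integer as ℤ using (ℤ; 0ℤ; 1ℤ)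
import Data.Integer.Properties as ℤP
open import Data.Integer.Tactic.RingSolver using (solve-∀)
open import Data.List using (List; []; _∷_; _∷ʳ_; _++_; length; map; filter; foldr; replicate; upTo; applyUpTo; cartesianProductWith; allFin)
open import Data.List.Membership.Propositional using (_∈_; _∉_; find; lose)
open import Data.List.Membership.Propositional.Properties using (∈-map⁺; ∈-map⁻; ∈-filter⁺; ∈-filter⁻; ∈-upTo⁺; ∈-upTo⁻; ∈-applyUpTo⁺; ∈-applyUpTo⁻; ∈-allFin; ∈-cartesianProductWith⁺)
import Data.List.Properties as ListP
open import Data.List.Relation.Unary.All as All using ([]; _∷_)
open import Data.List.Relation.Unary.AllPairs using ([]; _∷_)
open import Data.List.Relation.Unary.Any using (Any; here; there; any?; satisfied)
open import Data.List.Relation.Unary.Unique.Propositional using (Unique)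
open import Data.List.Relation.Unary.Unique.Propositional.Properties using (Unique[x∷xs]⇒x∉xs; map⁺; filter⁺; upTo⁺; applyUpTo⁺₁; allFin⁺; cartesianProductWith⁺)
open import Data.Nat as ℕ using (ℕ; zero; suc; _≤_; _<_; z≤n; s≤s; _⊔_; _∸_; _^_)
open import Data.Nat.Coprimality using (Coprime; coprime?; prime⇒coprime; coprime-Bézout)
open import Data.Nat.GCD using (module Bézout)
open import Data.Nat.Induction using (<-rec)
open import Data.Nat.Primality using (Prime; prime?; ¬prime[1]; prime⇒nonZero; prime⇒nonTrivial; prime⇒irreducible; euclidsLemma)
open import Data.Nat.Primality.Factorisation using (factorise)
import Data.Nat.Properties as ℕP
open import Data.Product using (∃; ∃₂; _×_; _,_; proj₁; proj₂)
open import Data.Sum using (_⊎_; inj₁; inj₂)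
open import Data.Unit using (tt)
open import Data.Vec as Vec using (Vec; []; _∷_; toList; here; there)
import Data.Vec.Properties as VecP
open import Function using (_∘_)
open import Function.Bundles using (mk⇔)
open import Level using (0ℓ)
open import Relation.Binary using (DecidableEquality; IsEquivalence; Setoid; tri<; tri≈; tri>)
open import Relation.Binary.PropositionalEquality
import Relation.Binary.Reasoning.Setoid as SetoidReasoning
open import Relation.Nullary using (¬_; Dec; yes; no; ¬?; does)
open import Relation.Nullary.Decidable using (_×-dec_; map′)
open import Relation.Unary using (Decidable)

-- No extension field is used: everything is counted in the monoid of monic polynomials. The factor
-- p in the first recursion is a weight: each irreducible g counts p times, matched by p copies of
-- g(L) or by the p conjugates dividing g(L). Every irreducible h moved by the translation divides
-- exactly one such g(L), the product of its conjugates.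
--
-- For (a), translation by b only permutes the conjugates above a g invariant under L(b): h(x + b) =
-- h(x + i a) for some i, so h is invariant under b - i a. As L(b) and all b - i a are nonzero and D
-- does not depend on the translation, p D(m) occurs on both sides and cancels.
--
-- For (c), the recursion times m says that U(m) = pm D(pm) has the formal Dirichlet series (p - 1)
-- B / (1 - p^(-s)), where B belongs to m I(m) and is the series of q^m divided by ζ(s). Removing
-- the Euler factor at p from 1 / ζ(s) leaves the series of μ on arguments prime to p, whence the
-- condition gcd(d, p) = 1.

open AbelianGroupProperties ℤP.+-0-abelianGroup using () renaming (∙-cancelˡ to +-cancelˡ; ∙-cancelʳ to +-cancelʳ)

-- Finite sums and counting

module FiniteSums where
  open import Data.Integer using (+_; _+_; _*_)

  private variable
    A B : Set
    P Q : Set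

  ∑ : List A → (A → ℤ) → ℤ
  ∑ []       f = 0ℤ
  ∑ (x ∷ xs) f = f x + ∑ xs f

  -- Cardinalities are integer sums of indicators, so that counting identities can be added, swapped
  -- and cancelled as identities in a ring.
  𝟙 : Dec P → ℤ
  𝟙 P? = if does P? then 1ℤ else 0ℤ

  𝟙-yes : (P? : Dec P) → P → 𝟙 P? ≡ 1ℤ
  𝟙-yes (yes _) _ = refl
  𝟙-yes (no ¬p) p = ⊥-elim (¬p p)

  𝟙-no : (P? : Dec P) → ¬ P → 𝟙 P? ≡ 0ℤ
  𝟙-no (yes p) ¬p = ⊥-elim (¬p p)
  𝟙-no (no _)  _  = refl

  𝟙-cong : (P? : Dec P) (Q? : Dec Q) → (P → Q) → (Q → P) → 𝟙 P? ≡ 𝟙 Q?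
  𝟙-cong (yes p) Q? f g = sym (𝟙-yes Q? (f p))
  𝟙-cong (no ¬p) Q? f g = sym (𝟙-no Q? (¬p ∘ g))

  𝟙-× : (P? : Dec P) (Q? : Dec Q) → 𝟙 (P? ×-dec Q?) ≡ 𝟙 P? * 𝟙 Q?
  𝟙-× (yes _) (yes _) = refl
  𝟙-× (yes _) (no _)  = refl
  𝟙-× (no _)  (yes _) = refl
  𝟙-× (no _)  (no _)  = refl

  𝟙-*-cong : (P? : Dec P) {a b : ℤ} → (P → a ≡ b) → 𝟙 P? * a ≡ 𝟙 P? * b
  𝟙-*-cong (yes p) f = cong (1ℤ *_) (f p)
  𝟙-*-cong (no _)  f = refl

  ∑-cong-∈ : (xs : List A) {f g : A → ℤ} → (∀ x → x ∈ xs → f x ≡ g x) → ∑ xs f ≡ ∑ xs g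
  ∑-cong-∈ []       eq = refl
  ∑-cong-∈ (x ∷ xs) eq = cong₂ _+_ (eq x (here refl)) (∑-cong-∈ xs (λ y y∈ → eq y (there y∈)))

  ∑-cong : (xs : List A) {f g : A → ℤ} → (∀ x → f x ≡ g x) → ∑ xs f ≡ ∑ xs g
  ∑-cong xs eq = ∑-cong-∈ xs (λ x _ → eq x)

  ∑-0 : (xs : List A) → ∑ xs (λ _ → 0ℤ) ≡ 0ℤ
  ∑-0 []       = refl
  ∑-0 (x ∷ xs) = trans (ℤP.+-identityˡ _) (∑-0 xs)

  ∑-vanish : (xs : List A) {f : A → ℤ} → (∀ x → x ∈ xs → f x ≡ 0ℤ) → ∑ xs f ≡ 0ℤ
  ∑-vanish xs eq = trans (∑-cong-∈ xs eq) (∑-0 xs)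

  +-congʳ : (a : ℤ) {b c : ℤ} → b ≡ c → a + b ≡ a + c
  +-congʳ a refl = refl

  interchange : (a b c d : ℤ) → (a + b) + (c + d) ≡ (a + c) + (b + d)
  interchange = solve-∀

  ∑-+ : (xs : List A) (f g : A → ℤ) → ∑ xs (λ x → f x + g x) ≡ ∑ xs f + ∑ xs g
  ∑-+ []       f g = refl
  ∑-+ (x ∷ xs) f g = trans (+-congʳ (f x + g x) (∑-+ xs f g)) (interchange (f x) (g x) (∑ xs f) (∑ xs g))

  ∑-*ˡ : (xs : List A) (c : ℤ) (f : A → ℤ) → ∑ xs (λ x → c * f x) ≡ c * ∑ xs f
  ∑-*ˡ []       c f = sym (ℤP.*-zeroʳ c)
  ∑-*ˡ (x ∷ xs) c f = trans (+-congʳ (c * f x) (∑-*ˡ xs c f)) (sym (ℤP.*-distribˡ-+ c (f x) (∑ xs f)))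

  ∑-*ʳ : (xs : List A) (c : ℤ) (f : A → ℤ) → ∑ xs (λ x → f x * c) ≡ ∑ xs f * c
  ∑-*ʳ xs c f = trans (∑-cong xs (λ x → ℤP.*-comm (f x) c)) (trans (∑-*ˡ xs c f) (ℤP.*-comm c (∑ xs f)))

  ∑-swap : (xs : List A) (ys : List B) (f : A → B → ℤ) →
           ∑ xs (λ x → ∑ ys (f x)) ≡ ∑ ys (λ y → ∑ xs (λ x → f x y))
  ∑-swap []       ys f = sym (∑-0 ys)
  ∑-swap (x ∷ xs) ys f = trans (+-congʳ (∑ ys (f x)) (∑-swap xs ys f)) (sym (∑-+ ys (f x) _))

  ∑-const : (xs : List A) (c : ℤ) → ∑ xs (λ _ → c) ≡ + length xs * c
  ∑-const []       c = refl
  ∑-const (x ∷ xs) c = begin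
    c + ∑ xs (λ _ → c)  ≡⟨ +-congʳ c (∑-const xs c) ⟩
    c + + length xs * c  ≡⟨ ℤP.suc-* (+ length xs) c ⟨
    ℤ.suc (+ length xs) * c  ∎
    where open ≡-Reasoning

  ∑-1 : (xs : List A) → ∑ xs (λ _ → 1ℤ) ≡ + length xs
  ∑-1 xs = trans (∑-const xs 1ℤ) (ℤP.*-identityʳ _)

  ∑-++ : (xs ys : List A) (f : A → ℤ) → ∑ (xs ++ ys) f ≡ ∑ xs f + ∑ ys f
  ∑-++ []       ys f = sym (ℤP.+-identityˡ _)
  ∑-++ (x ∷ xs) ys f = trans (+-congʳ (f x) (∑-++ xs ys f)) (sym (ℤP.+-assoc (f x) (∑ xs f) (∑ ys f)))

  ∑-map : (xs : List A) (φ : A → B) (f : B → ℤ) → ∑ (map φ xs) f ≡ ∑ xs (f ∘ φ)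
  ∑-map []       φ f = refl
  ∑-map (x ∷ xs) φ f = +-congʳ (f (φ x)) (∑-map xs φ f)

  ∑-filter : {R : A → Set} (R? : Decidable R) (xs : List A) (f : A → ℤ) →
             ∑ (filter R? xs) f ≡ ∑ xs (λ x → 𝟙 (R? x) * f x)
  ∑-filter R? []       f = refl
  ∑-filter R? (x ∷ xs) f with R? x
  ... | yes _ = cong₂ _+_ (sym (ℤP.*-identityˡ (f x))) (∑-filter R? xs f)
  ... | no _  = trans (∑-filter R? xs f) (sym (ℤP.+-identityˡ _))

  length-filter-∑ : {R : A → Set} (R? : Decidable R) (xs : List A) →
                    + length (filter R? xs) ≡ ∑ xs (λ x → 𝟙 (R? x))
  length-filter-∑ R? xs = begin
    + length (filter R? xs)  ≡⟨ ∑-1 (filter R? xs) ⟨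
    ∑ (filter R? xs) (λ _ → 1ℤ)  ≡⟨ ∑-filter R? xs _ ⟩
    ∑ xs (λ x → 𝟙 (R? x) * 1ℤ)  ≡⟨ ∑-cong xs (λ x → ℤP.*-identityʳ _) ⟩
    ∑ xs (λ x → 𝟙 (R? x))  ∎
    where open ≡-Reasoning

  module _ (_≟_ : DecidableEquality A) where

    ∑-δ-∉ : (xs : List A) (c : A) (f : A → ℤ) → c ∉ xs → ∑ xs (λ x → 𝟙 (x ≟ c) * f x) ≡ 0ℤ
    ∑-δ-∉ xs c f c∉ = ∑-vanish xs
      (λ x x∈ → cong (_* f x) (𝟙-no (x ≟ c) (λ x≡c → c∉ (subst (_∈ xs) x≡c x∈))))

    ∑-δ : {xs : List A} (c : A) (f : A → ℤ) → Unique xs → c ∈ xs →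
          ∑ xs (λ x → 𝟙 (x ≟ c) * f x) ≡ f c
    ∑-δ {x ∷ xs} c f u (here refl) = begin
      𝟙 (c ≟ c) * f c + ∑ xs (λ x → 𝟙 (x ≟ c) * f x)
        ≡⟨ cong₂ _+_ (cong (_* f c) (𝟙-yes (c ≟ c) refl)) (∑-δ-∉ xs c f (Unique[x∷xs]⇒x∉xs u)) ⟩
      1ℤ * f c + 0ℤ ≡⟨ ℤP.+-identityʳ _ ⟩
      1ℤ * f c  ≡⟨ ℤP.*-identityˡ _ ⟩
      f c  ∎
      where open ≡-Reasoning
    ∑-δ {x ∷ xs} c f (x∉ ∷ u) (there c∈) = begin
      𝟙 (x ≟ c) * f x + ∑ xs (λ x → 𝟙 (x ≟ c) * f x)
        ≡⟨ cong₂ _+_ (cong (_* f x) (𝟙-no (x ≟ c) λ { refl → Unique[x∷xs]⇒x∉xs (x∉ ∷ u) c∈ })) (∑-δ c f u c∈) ⟩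
      0ℤ + f c  ≡⟨ ℤP.+-identityˡ _ ⟩
      f c  ∎
      where open ≡-Reasoning

    ∑-𝟙-single : {xs : List A} {R : A → Set} (R? : Decidable R) (c : A) → Unique xs → c ∈ xs →
                 R c → (∀ x → x ∈ xs → R x → x ≡ c) → ∑ xs (λ x → 𝟙 (R? x)) ≡ 1ℤ
    ∑-𝟙-single {xs} R? c u c∈ Rc only = trans
      (∑-cong-∈ xs (λ x x∈ → trans (𝟙-cong (R? x) (x ≟ c) (only x x∈) (λ { refl → Rc })) (sym (ℤP.*-identityʳ _))))
      (∑-δ c (λ _ → 1ℤ) u c∈)

    -- Double count of the pairs `x ≡ y` with x in `xs` and y in `ys`: each x with `R` has one
    -- partner, the other x have none, and each y has one.
    ∑-𝟙-enumerate : {xs ys : List A} {R : A → Set} (R? : Decidable R) → Unique xs → Unique ys →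
                    (∀ x → x ∈ xs → R x → x ∈ ys) → (∀ y → y ∈ ys → y ∈ xs × R y) →
                    ∑ xs (λ x → 𝟙 (R? x)) ≡ + length ys
    ∑-𝟙-enumerate {xs} {ys} {R} R? uxs uys to from = begin
      ∑ xs (λ x → 𝟙 (R? x))  ≡⟨ ∑-cong-∈ xs inner ⟨
      ∑ xs (λ x → ∑ ys (λ y → 𝟙 (x ≟ y)))  ≡⟨ ∑-swap xs ys _ ⟩
      ∑ ys (λ y → ∑ xs (λ x → 𝟙 (x ≟ y)))
        ≡⟨ ∑-cong-∈ ys (λ y y∈ → ∑-𝟙-single (_≟ y) y uxs (proj₁ (from y y∈)) refl (λ _ _ e → e)) ⟩
      ∑ ys (λ _ → 1ℤ)  ≡⟨ ∑-1 ys ⟩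
      + length ys  ∎
      where
      open ≡-Reasoning
      inner : ∀ x → x ∈ xs → ∑ ys (λ y → 𝟙 (x ≟ y)) ≡ 𝟙 (R? x)
      inner x x∈ with R? x
      ... | yes Rx = ∑-𝟙-single (x ≟_) x uys (to x x∈ Rx) refl (λ _ _ e → sym e)
      ... | no ¬Rx = ∑-vanish ys (λ y y∈ → 𝟙-no (x ≟ y) λ { refl → ¬Rx (proj₂ (from y y∈)) })

    -- Only the x with `R` need a preimage, and `φ` may miss the rest of `xs`. This suits `ι`, whose
    -- image consists of the invariant elements only.
    ∑-𝟙-reindex : {xs : List A} {ys : List B} {R : A → Set} (R? : Decidable R) (φ : B → A) →
                  (∀ {y z} → φ y ≡ φ z → y ≡ z) → Unique xs → Unique ys → (∀ y → y ∈ ys → φ y ∈ xs) →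
                  (∀ x → x ∈ xs → R x → ∃ λ y → y ∈ ys × φ y ≡ x) →
                  ∑ xs (λ x → 𝟙 (R? x)) ≡ ∑ ys (λ y → 𝟙 (R? (φ y)))
    ∑-𝟙-reindex {xs = xs} {ys} {R} R? φ φ-inj uxs uys into onto = begin
      ∑ xs (λ x → 𝟙 (R? x))  ≡⟨ ∑-𝟙-enumerate R? uxs (map⁺ φ-inj (filter⁺ (R? ∘ φ) uys)) to from ⟩
      + length (map φ (filter (R? ∘ φ) ys))  ≡⟨ cong +_ (ListP.length-map φ (filter (R? ∘ φ) ys)) ⟩
      + length (filter (R? ∘ φ) ys)  ≡⟨ length-filter-∑ (R? ∘ φ) ys ⟩
      ∑ ys (λ y → 𝟙 (R? (φ y)))  ∎
      where
      open ≡-Reasoning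
      to : ∀ x → x ∈ xs → R x → x ∈ map φ (filter (R? ∘ φ) ys)
      to x x∈ Rx with onto x x∈ Rx
      ... | y , y∈ , refl = ∈-map⁺ φ (∈-filter⁺ (R? ∘ φ) y∈ Rx)
      from : ∀ x → x ∈ map φ (filter (R? ∘ φ) ys) → x ∈ xs × R x
      from x x∈ with ∈-map⁻ φ x∈
      ... | y , y∈ , refl with ∈-filter⁻ (R? ∘ φ) y∈
      ...   | y∈ys , Ry = into y y∈ys , Ry

-- Dirichlet convolution and the Möbius function

module DirichletConvolution where
  open import Data.Integer using (+_; _+_; _*_; -_)
  open import Data.Nat using (_≟_)
  open import Data.Nat.Divisibility using (_∣_; _∣?_; divides; ∣-refl; ∣-trans; ∣⇒≤; m∣m*n; n∣m*n; *-monoʳ-∣; *-cancelˡ-∣; n/m≡quotient)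
  open FiniteSums

  range : ℕ → List ℕ
  range zero    = []
  range (suc n) = suc n ∷ range n

  ∈-range⁺ : ∀ {n i} → 0 < i → i ≤ n → i ∈ range n
  ∈-range⁺ {zero}  (s≤s z≤n) ()
  ∈-range⁺ {suc n} {i} 0<i i≤1+n with i ≟ suc n
  ... | yes refl = here refl
  ... | no i≢    = there (∈-range⁺ 0<i (ℕP.≤-pred (ℕP.≤∧≢⇒< i≤1+n i≢)))

  ∈-range⁻ : ∀ {n i} → i ∈ range n → 0 < i × i ≤ n
  ∈-range⁻ {suc n} (here refl) = s≤s z≤n , ℕP.≤-refl
  ∈-range⁻ {suc n} (there i∈)  = proj₁ (∈-range⁻ i∈) , ℕP.m≤n⇒m≤1+n (proj₂ (∈-range⁻ i∈))

  range-unique : ∀ n → Unique (range n)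
  range-unique zero    = []
  range-unique (suc n) = All.tabulate (λ i∈ eq → ℕP.<⇒≢ (s≤s (proj₂ (∈-range⁻ i∈))) (sym eq)) ∷ range-unique n

  ∑-range-extend : ∀ {m n} (f : ℕ → ℤ) → m ≤ n → (∀ i → m < i → f i ≡ 0ℤ) → ∑ (range n) f ≡ ∑ (range m) f
  ∑-range-extend {m} {n} f m≤n f≡0 with ℕP.≤⇒≤′ m≤n
  ... | ℕ.≤′-reflexive refl = refl
  ... | ℕ.≤′-step {n} m≤′n = begin
    f (suc n) + ∑ (range n) f ≡⟨ cong₂ _+_ (f≡0 (suc n) (s≤s (ℕP.≤′⇒≤ m≤′n))) (∑-range-extend f (ℕP.≤′⇒≤ m≤′n) f≡0) ⟩
    0ℤ + ∑ (range m) f  ≡⟨ ℤP.+-identityˡ _ ⟩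
    ∑ (range m) f  ∎
    where open ≡-Reasoning

  ∑-upTo-suc : ∀ n (f : ℕ → ℤ) → ∑ (upTo n) (f ∘ suc) ≡ ∑ (range n) f
  ∑-upTo-suc zero    f = refl
  ∑-upTo-suc (suc n) f = begin
    ∑ (upTo (suc n)) (f ∘ suc)  ≡⟨ cong (λ xs → ∑ xs (f ∘ suc)) (ListP.upTo-∷ʳ n) ⟨
    ∑ (upTo n ∷ʳ n) (f ∘ suc)  ≡⟨ ∑-++ (upTo n) (n ∷ []) (f ∘ suc) ⟩
    ∑ (upTo n) (f ∘ suc) + (f (suc n) + 0ℤ)  ≡⟨ cong₂ _+_ (∑-upTo-suc n f) (ℤP.+-identityʳ (f (suc n))) ⟩
    ∑ (range n) f + f (suc n)  ≡⟨ ℤP.+-comm (∑ (range n) f) (f (suc n)) ⟩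
    f (suc n) + ∑ (range n) f  ∎
    where open ≡-Reasoning

  ArithmeticFunction : Set
  ArithmeticFunction = ℕ → ℤ

  infixl 7 _⋆_
  infixl 6 _⊕_

  -- Encoded over the full square of pairs with an indicator, not over divisors with a quotient:
  -- commutativity becomes an exchange of two sums and no division occurs.
  _⋆_ : ArithmeticFunction → ArithmeticFunction → ArithmeticFunction
  (f ⋆ g) m = ∑ (range m) λ d → ∑ (range m) λ e → 𝟙 (d ℕ.* e ≟ m) * (f d * g e)

  _⊕_ : ArithmeticFunction → ArithmeticFunction → ArithmeticFunction
  (f ⊕ g) m = f m + g m

  infix 4 _≐_

  -- The argument 0 is left out because `(f ⋆ g) 0` is an empty sum, so that even the unit law would
  -- fail there.
  _≐_ : ArithmeticFunction → ArithmeticFunction → Set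
  f ≐ g = ∀ m → 0 < m → f m ≡ g m

  -- The function with Dirichlet series n^(-s). Convolving with it moves the value at e to n e, and
  -- `point 1` is the unit of `⋆`.
  point : ℕ → ArithmeticFunction
  point n m = 𝟙 (m ≟ n)

  𝟏 : ArithmeticFunction
  𝟏 _ = 1ℤ

  ⋆-cong-at : ∀ f g f′ g′ m → (∀ d e → 0 < d → 0 < e → d ℕ.* e ≡ m → f d * g e ≡ f′ d * g′ e) →
              (f ⋆ g) m ≡ (f′ ⋆ g′) m
  ⋆-cong-at f g f′ g′ m eq = ∑-cong-∈ (range m) λ d d∈ → ∑-cong-∈ (range m) λ e e∈ →
    𝟙-*-cong (d ℕ.* e ≟ m) (eq d e (proj₁ (∈-range⁻ d∈)) (proj₁ (∈-range⁻ e∈)))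

  ⋆-cong : ∀ f g f′ g′ → f ≐ f′ → g ≐ g′ → f ⋆ g ≐ f′ ⋆ g′
  ⋆-cong f g f′ g′ p q m _ = ⋆-cong-at f g f′ g′ m λ d e 0<d 0<e _ → cong₂ _*_ (p d 0<d) (q e 0<e)

  ⋆-comm : ∀ f g → f ⋆ g ≐ g ⋆ f
  ⋆-comm f g m _ = trans (∑-swap (range m) (range m) _)
    (∑-cong (range m) λ e → ∑-cong (range m) λ d →
      cong₂ _*_ (𝟙-cong (d ℕ.* e ≟ m) (e ℕ.* d ≟ m) (trans (ℕP.*-comm e d)) (trans (ℕP.*-comm d e)))
                (ℤP.*-comm (f d) (g e)))

  distribʳ-term : (t a b c : ℤ) → t * ((a + b) * c) ≡ t * (a * c) + t * (b * c)
  distribʳ-term = solve-∀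

  ⋆-distribʳ-⊕ : ∀ f g h → (f ⊕ g) ⋆ h ≐ f ⋆ h ⊕ g ⋆ h
  ⋆-distribʳ-⊕ f g h m _ = trans
    (∑-cong (range m) λ d → trans
      (∑-cong (range m) λ e → distribʳ-term (𝟙 (d ℕ.* e ≟ m)) (f d) (g d) (h e))
      (∑-+ (range m) _ _))
    (∑-+ (range m) _ _)

  ⋆-distribˡ-⊕ : ∀ f g h → f ⋆ (g ⊕ h) ≐ f ⋆ g ⊕ f ⋆ h
  ⋆-distribˡ-⊕ f g h m 0<m = trans (⋆-comm f (g ⊕ h) m 0<m) (trans (⋆-distribʳ-⊕ g h f m 0<m)
    (cong₂ _+_ (⋆-comm g f m 0<m) (⋆-comm h f m 0<m)))

  scaleʳ-term : (t c a b : ℤ) → t * (c * a * b) ≡ c * (t * (a * b))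
  scaleʳ-term = solve-∀

  ⋆-scale : ∀ c f g → (λ m → c * f m) ⋆ g ≐ (λ m → c * (f ⋆ g) m)
  ⋆-scale c f g m _ = trans
    (∑-cong (range m) λ d → trans
      (∑-cong (range m) λ e → scaleʳ-term (𝟙 (d ℕ.* e ≟ m)) c (f d) (g e))
      (∑-*ˡ (range m) c _))
    (∑-*ˡ (range m) c _)

  -- Factors of m do not exceed m, so larger summation bounds add nothing. It lets an inner
  -- convolution at x ≤ m be written over the outer range.
  ⋆-extend : ∀ f g {m n} → 0 < m → m ≤ n →
             ∑ (range n) (λ d → ∑ (range n) λ e → 𝟙 (d ℕ.* e ≟ m) * (f d * g e)) ≡ (f ⋆ g) m
  ⋆-extend f g {m} {n} 0<m m≤n = trans
    (∑-cong-∈ (range n) λ d d∈ → ∑-range-extend _ m≤n λ e m<e →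
      cong (_* (f d * g e)) (𝟙-no (d ℕ.* e ≟ m) λ de≡m →
        ℕP.<⇒≱ m<e (ℕP.≤-trans (ℕP.m≤n*m e d {{ℕ.>-nonZero (proj₁ (∈-range⁻ d∈))}}) (ℕP.≤-reflexive de≡m))))
    (∑-range-extend _ m≤n λ d m<d → ∑-vanish (range m) λ e e∈ →
      cong (_* (f d * g e)) (𝟙-no (d ℕ.* e ≟ m) λ de≡m →
        ℕP.<⇒≱ m<d (ℕP.≤-trans (ℕP.m≤m*n d e {{ℕ.>-nonZero (proj₁ (∈-range⁻ e∈))}}) (ℕP.≤-reflexive de≡m))))

  -- A form of the threefold convolution that is visibly invariant under rotation, whence associativity.

  triple : ArithmeticFunction → ArithmeticFunction → ArithmeticFunction → ArithmeticFunction
  triple f g h m = ∑ (range m) λ a → ∑ (range m) λ b → ∑ (range m) λ c →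
    𝟙 (a ℕ.* b ℕ.* c ≟ m) * (f a * g b * h c)

  triple-term : (s t a b c : ℤ) → s * (t * (a * b) * c) ≡ t * (s * (a * b * c))
  triple-term = solve-∀

  -- The inner convolution is expanded over the common range; the sum over the intermediate product
  -- x = a b then collapses as a delta sum.
  ⋆-triple : ∀ f g h → (f ⋆ g) ⋆ h ≐ triple f g h
  ⋆-triple f g h m 0<m = begin
    ∑ R (λ x → ∑ R λ c → 𝟙 (x ℕ.* c ≟ m) * ((f ⋆ g) x * h c))
      ≡⟨ ∑-cong-∈ R (λ x x∈ → ∑-cong R λ c → expand x c (∈-range⁻ x∈)) ⟩
    ∑ R (λ x → ∑ R λ c → ∑ R λ a → ∑ R λ b → T x c a b)
      ≡⟨ ∑-swap R R _ ⟩
    ∑ R (λ c → ∑ R λ x → ∑ R λ a → ∑ R λ b → T x c a b)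
      ≡⟨ ∑-cong R (λ c → trans (∑-swap R R _) (∑-cong R λ a → ∑-swap R R _)) ⟩
    ∑ R (λ c → ∑ R λ a → ∑ R λ b → ∑ R λ x → T x c a b)
      ≡⟨ trans (∑-swap R R _) (∑-cong R λ a → ∑-swap R R _) ⟩
    ∑ R (λ a → ∑ R λ b → ∑ R λ c → ∑ R λ x → T x c a b)
      ≡⟨ ∑-cong-∈ R (λ a a∈ → ∑-cong-∈ R λ b b∈ → ∑-cong-∈ R λ c c∈ →
           collapse a b c (proj₁ (∈-range⁻ a∈)) (proj₁ (∈-range⁻ b∈)) (proj₁ (∈-range⁻ c∈))) ⟩
    triple f g h m ∎
    where
    open ≡-Reasoning
    R = range m
    T : ℕ → ℕ → ℕ → ℕ → ℤ
    T x c a b = 𝟙 (x ≟ a ℕ.* b) * (𝟙 (x ℕ.* c ≟ m) * (f a * g b * h c))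
    expand : ∀ x c → 0 < x × x ≤ m →
      𝟙 (x ℕ.* c ≟ m) * ((f ⋆ g) x * h c) ≡ ∑ R (λ a → ∑ R λ b → T x c a b)
    expand x c (0<x , x≤m) = begin
      s * ((f ⋆ g) x * h c)
        ≡⟨ cong (λ z → s * (z * h c)) (⋆-extend f g 0<x x≤m) ⟨
      s * (∑ R (λ a → ∑ R λ b → 𝟙 (a ℕ.* b ≟ x) * (f a * g b)) * h c)
        ≡⟨ cong (s *_) (trans (sym (∑-*ʳ R (h c) _)) (∑-cong R λ a → sym (∑-*ʳ R (h c) _))) ⟩
      s * ∑ R (λ a → ∑ R λ b → 𝟙 (a ℕ.* b ≟ x) * (f a * g b) * h c)
        ≡⟨ trans (sym (∑-*ˡ R s _)) (∑-cong R λ a → sym (∑-*ˡ R s _)) ⟩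
      ∑ R (λ a → ∑ R λ b → s * (𝟙 (a ℕ.* b ≟ x) * (f a * g b) * h c))
        ≡⟨ ∑-cong R (λ a → ∑-cong R λ b → trans
             (triple-term s (𝟙 (a ℕ.* b ≟ x)) (f a) (g b) (h c))
             (cong (_* (s * (f a * g b * h c))) (𝟙-cong (a ℕ.* b ≟ x) (x ≟ a ℕ.* b) sym sym))) ⟩
      ∑ R (λ a → ∑ R λ b → T x c a b) ∎
      where s = 𝟙 (x ℕ.* c ≟ m)
    collapse : ∀ a b c → 0 < a → 0 < b → 0 < c →
      ∑ R (λ x → T x c a b) ≡ 𝟙 (a ℕ.* b ℕ.* c ≟ m) * (f a * g b * h c)
    collapse a b c 0<a 0<b 0<c with a ℕ.* b ℕ.≤? m
    ... | yes ab≤m = ∑-δ _≟_ (a ℕ.* b) (λ x → 𝟙 (x ℕ.* c ≟ m) * (f a * g b * h c))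
                       (range-unique m) (∈-range⁺ (ℕP.*-mono-≤ 0<a 0<b) ab≤m)
    -- No x in the range equals a b, but then a b c cannot equal m either, so both sides vanish.
    ... | no ab≰m = trans
      (∑-δ-∉ _≟_ R (a ℕ.* b) (λ x → 𝟙 (x ℕ.* c ≟ m) * (f a * g b * h c)) (λ ab∈ → ab≰m (proj₂ (∈-range⁻ ab∈))))
      (sym (cong (_* (f a * g b * h c)) (𝟙-no (a ℕ.* b ℕ.* c ≟ m) λ abc≡m →
        ab≰m (ℕP.≤-trans (ℕP.m≤m*n (a ℕ.* b) c {{ℕ.>-nonZero 0<c}}) (ℕP.≤-reflexive abc≡m)))))

  rotate-term : (a b c : ℤ) → b * c * a ≡ a * b * c
  rotate-term = solve-∀

  triple-rotate : ∀ f g h m → triple g h f m ≡ triple f g h m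
  triple-rotate f g h m = begin
    ∑ R (λ b → ∑ R λ c → ∑ R λ a → 𝟙 (b ℕ.* c ℕ.* a ≟ m) * (g b * h c * f a))
      ≡⟨ ∑-cong R (λ b → ∑-swap R R _) ⟩
    ∑ R (λ b → ∑ R λ a → ∑ R λ c → 𝟙 (b ℕ.* c ℕ.* a ≟ m) * (g b * h c * f a))
      ≡⟨ ∑-swap R R _ ⟩
    ∑ R (λ a → ∑ R λ b → ∑ R λ c → 𝟙 (b ℕ.* c ℕ.* a ≟ m) * (g b * h c * f a))
      ≡⟨ ∑-cong R (λ a → ∑-cong R λ b → ∑-cong R λ c →
           cong₂ _*_ (𝟙-cong (b ℕ.* c ℕ.* a ≟ m) (a ℕ.* b ℕ.* c ≟ m) (trans (rot a b c)) (trans (sym (rot a b c))))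
                     (rotate-term (f a) (g b) (h c))) ⟩
    triple f g h m ∎
    where
    open ≡-Reasoning
    R = range m
    rot : ∀ a b c → a ℕ.* b ℕ.* c ≡ b ℕ.* c ℕ.* a
    rot a b c = trans (ℕP.*-assoc a b c) (ℕP.*-comm a (b ℕ.* c))

  ⋆-assoc : ∀ f g h → (f ⋆ g) ⋆ h ≐ f ⋆ (g ⋆ h)
  ⋆-assoc f g h m 0<m = begin
    ((f ⋆ g) ⋆ h) m  ≡⟨ ⋆-triple f g h m 0<m ⟩
    triple f g h m  ≡⟨ triple-rotate f g h m ⟨
    triple g h f m  ≡⟨ ⋆-triple g h f m 0<m ⟨
    ((g ⋆ h) ⋆ f) m  ≡⟨ ⋆-comm (g ⋆ h) f m 0<m ⟩
    (f ⋆ (g ⋆ h)) m  ∎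
    where open ≡-Reasoning

  point-⋆-multiple : ∀ n e f → 0 < n → 0 < e → (point n ⋆ f) (n ℕ.* e) ≡ f e
  point-⋆-multiple n e f 0<n 0<e = begin
    ∑ R (λ d → ∑ R λ x → 𝟙 (d ℕ.* x ≟ ne) * (𝟙 (d ≟ n) * f x))
      ≡⟨ ∑-cong R (λ d → trans (∑-cong R λ x → swap-term (𝟙 (d ℕ.* x ≟ ne)) (𝟙 (d ≟ n)) (f x)) (∑-*ˡ R (𝟙 (d ≟ n)) _)) ⟩
    ∑ R (λ d → 𝟙 (d ≟ n) * ∑ R λ x → 𝟙 (d ℕ.* x ≟ ne) * f x)
      ≡⟨ ∑-δ _≟_ n _ (range-unique ne) (∈-range⁺ 0<n (ℕP.m≤m*n n e {{ℕ.>-nonZero 0<e}})) ⟩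
    ∑ R (λ x → 𝟙 (n ℕ.* x ≟ ne) * f x)
      ≡⟨ ∑-cong R (λ x → cong (_* f x) (𝟙-cong (n ℕ.* x ≟ ne) (x ≟ e) (ℕP.*-cancelˡ-≡ x e n {{ℕ.>-nonZero 0<n}}) (cong (n ℕ.*_)))) ⟩
    ∑ R (λ x → 𝟙 (x ≟ e) * f x)
      ≡⟨ ∑-δ _≟_ e f (range-unique ne) (∈-range⁺ 0<e (ℕP.m≤n*m e n {{ℕ.>-nonZero 0<n}})) ⟩
    f e ∎
    where
    open ≡-Reasoning
    ne = n ℕ.* e
    R = range ne
    swap-term : (a b c : ℤ) → a * (b * c) ≡ b * (a * c)
    swap-term = solve-∀

  point-⋆-∤ : ∀ n m f → ¬ (n ∣ m) → (point n ⋆ f) m ≡ 0ℤ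
  point-⋆-∤ n m f n∤m = trans
    (⋆-cong-at (point n) f (λ _ → 0ℤ) f m λ d e _ _ de≡m →
      cong (_* f e) (𝟙-no (d ≟ n) λ { refl → n∤m (divides e (trans (sym de≡m) (ℕP.*-comm n e))) }))
    (∑-vanish (range m) λ d _ → ∑-vanish (range m) λ e _ → ℤP.*-zeroʳ (𝟙 (d ℕ.* e ≟ m)))

  point1-⋆ : ∀ f → point 1 ⋆ f ≐ f
  point1-⋆ f m 0<m = trans (cong (point 1 ⋆ f) (sym (ℕP.*-identityˡ m))) (point-⋆-multiple 1 m f (s≤s z≤n) 0<m)

  -- The Möbius function

  ∈-squarePrimeDivisors : ∀ {n d} → 0 < n → Prime d → d ℕ.* d ∣ n → d ∈ squarePrimeDivisors n
  ∈-squarePrimeDivisors {n} {d} 0<n dp dd∣n = ∈-filter⁺ (λ d → prime? d ×-dec ((d ℕ.* d) ∣? n)) (∈-upTo⁺ (s≤s d≤n)) (dp , dd∣n)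
    where
    d≤n : d ≤ n
    d≤n = ℕP.≤-trans (ℕP.m≤m*n d d {{prime⇒nonZero dp}}) (∣⇒≤ {{ℕ.>-nonZero 0<n}} dd∣n)

  μ-square : ∀ {n d} → 0 < n → Prime d → d ℕ.* d ∣ n → μ n ≡ 0ℤ
  μ-square {n} 0<n dp dd∣n with squarePrimeDivisors n | ∈-squarePrimeDivisors 0<n dp dd∣n
  ... | _ ∷ _ | _ = refl

  SquareFree : ℕ → Set
  SquareFree n = ∀ d → Prime d → ¬ (d ℕ.* d ∣ n)

  μ-squareFree : ∀ {n} → SquareFree n → μ n ≡ (- 1ℤ) ℤ.^ length (primeDivisors n)
  μ-squareFree {n} sf with squarePrimeDivisors n in eq
  ... | []    = refl
  ... | d ∷ _ = ⊥-elim (sf d (proj₁ d-square) (proj₂ d-square))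
    where
    d-square : Prime d × (d ℕ.* d ∣ n)
    d-square = proj₂ (∈-filter⁻ (λ d → prime? d ×-dec ((d ℕ.* d) ∣? n)) {xs = upTo (suc n)}
      (subst (d ∈_) (sym eq) (here refl)))

  squareFree? : ∀ n → 0 < n → SquareFree n ⊎ (∃ λ d → Prime d × (d ℕ.* d ∣ n))
  squareFree? n 0<n with squarePrimeDivisors n in eq
  ... | []    = inj₁ λ d dp dd∣n → ∉[] (subst (d ∈_) eq (∈-squarePrimeDivisors 0<n dp dd∣n))
    where
    ∉[] : ∀ {d : ℕ} → d ∉ []
    ∉[] ()
  ... | d ∷ _ = inj₂ (d , proj₂ (∈-filter⁻ (λ d → prime? d ×-dec ((d ℕ.* d) ∣? n)) {xs = upTo (suc n)}
    (subst (d ∈_) (sym eq) (here refl))))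

  prime-∣-prime : ∀ {d l} → Prime d → Prime l → d ∣ l → d ≡ l
  prime-∣-prime dp lp d∣l with prime⇒irreducible lp d∣l
  ... | inj₁ refl = ⊥-elim (¬prime[1] dp)
  ... | inj₂ d≡l  = d≡l

  module _ {l : ℕ} (lp : Prime l) {e : ℕ} (0<e : 0 < e) (l∤e : ¬ (l ∣ e)) where

    private
      0<l : 0 < l
      0<l = ℕ.>-nonZero⁻¹ l {{prime⇒nonZero lp}}
      0<le : 0 < l ℕ.* e
      0<le = ℕP.*-mono-≤ 0<l 0<e

    -- Let d² divide l e. If d divides l, it is l, and cancelling one l gives l ∣ e. Otherwise e = k
    -- d, so d divides l k, and the same dichotomy ends in l ∣ e or in d² ∣ e.
    squareFree-l* : SquareFree e → SquareFree (l ℕ.* e)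
    squareFree-l* sf d dp dd∣le with euclidsLemma l e dp (∣-trans (m∣m*n d) dd∣le)
    ... | inj₁ d∣l = l∤e (*-cancelˡ-∣ l {{prime⇒nonZero lp}}
                       (subst (λ x → x ℕ.* x ∣ l ℕ.* e) (prime-∣-prime dp lp d∣l) dd∣le))
    ... | inj₂ (divides k e≡kd) with euclidsLemma l k dp d∣lk
      where
      d∣lk : d ∣ l ℕ.* k
      d∣lk = *-cancelˡ-∣ d {{prime⇒nonZero dp}} (subst (d ℕ.* d ∣_) lemma dd∣le)
        where
        lemma : l ℕ.* e ≡ d ℕ.* (l ℕ.* k)
        lemma = trans (cong (l ℕ.*_) e≡kd) (trans (sym (ℕP.*-assoc l k d)) (ℕP.*-comm (l ℕ.* k) d))
    ...   | inj₁ d∣l = l∤e (subst (_∣ e) (prime-∣-prime dp lp d∣l) (divides k e≡kd))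
    ...   | inj₂ d∣k = sf d dp (subst (d ℕ.* d ∣_) (trans (ℕP.*-comm d k) (sym e≡kd)) (*-monoʳ-∣ d d∣k))

    length-primeDivisors-l* : length (primeDivisors (l ℕ.* e)) ≡ suc (length (primeDivisors e))
    length-primeDivisors-l* = ℤP.+-injective (trans
      (length-filter-∑ (λ d → prime? d ×-dec (d ∣? (l ℕ.* e))) (upTo (suc (l ℕ.* e))))
      (∑-𝟙-enumerate _≟_ {ys = l ∷ primeDivisors e} (λ d → prime? d ×-dec (d ∣? (l ℕ.* e)))
        (upTo⁺ (suc (l ℕ.* e)))
        (All.tabulate (λ d∈ → λ { refl → l∤e (proj₂ (divisor d∈)) })
          ∷ filter⁺ (λ d → prime? d ×-dec (d ∣? e)) (upTo⁺ (suc e)))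
        to from))
      where
      divisor : ∀ {d} → d ∈ primeDivisors e → Prime d × d ∣ e
      divisor d∈ = proj₂ (∈-filter⁻ (λ d → prime? d ×-dec (d ∣? e)) {xs = upTo (suc e)} d∈)
      to : ∀ d → d ∈ upTo (suc (l ℕ.* e)) → Prime d × d ∣ l ℕ.* e → d ∈ l ∷ primeDivisors e
      to d _ (dp , d∣le) with euclidsLemma l e dp d∣le
      ... | inj₁ d∣l = here (prime-∣-prime dp lp d∣l)
      ... | inj₂ d∣e = there (∈-filter⁺ (λ d → prime? d ×-dec (d ∣? e)) (∈-upTo⁺ (s≤s (∣⇒≤ {{ℕ.>-nonZero 0<e}} d∣e))) (dp , d∣e))
      ≤le : ∀ {d} → d ∣ l ℕ.* e → d ∈ upTo (suc (l ℕ.* e))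
      ≤le d∣le = ∈-upTo⁺ (s≤s (∣⇒≤ {{ℕ.>-nonZero 0<le}} d∣le))
      from : ∀ d → d ∈ l ∷ primeDivisors e → d ∈ upTo (suc (l ℕ.* e)) × (Prime d × d ∣ l ℕ.* e)
      from d (here refl) = ≤le (m∣m*n e) , lp , m∣m*n e
      from d (there d∈)  = ≤le d∣le , proj₁ (divisor d∈) , d∣le
        where
        d∣le : d ∣ l ℕ.* e
        d∣le = ∣-trans (proj₂ (divisor d∈)) (n∣m*n l)

    -- For squarefree e the product l e is squarefree with exactly one more prime divisor; a square
    -- in e remains in l e and makes both values 0.
    μ-l* : μ (l ℕ.* e) ≡ - μ e
    μ-l* with squareFree? e 0<e
    ... | inj₁ sf = begin
      μ (l ℕ.* e)  ≡⟨ μ-squareFree (squareFree-l* sf) ⟩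
      (- 1ℤ) ℤ.^ length (primeDivisors (l ℕ.* e))  ≡⟨ cong ((- 1ℤ) ℤ.^_) length-primeDivisors-l* ⟩
      (- 1ℤ) * (- 1ℤ) ℤ.^ length (primeDivisors e)  ≡⟨ ℤP.-1*i≡-i ((- 1ℤ) ℤ.^ length (primeDivisors e)) ⟩
      - ((- 1ℤ) ℤ.^ length (primeDivisors e))  ≡⟨ cong -_ (μ-squareFree sf) ⟨
      - μ e  ∎
      where open ≡-Reasoning
    ... | inj₂ (d , dp , dd∣e) = trans (μ-square 0<le dp (∣-trans dd∣e (n∣m*n l))) (sym (cong -_ (μ-square 0<e dp dd∣e)))

  -- The Möbius function without its Euler factor at l. For l = p this is the weight in the theorem,
  -- because p ∤ d means gcd(d, p) = 1.
  ν : ℕ → ArithmeticFunction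
  ν l e = 𝟙 (¬? (l ∣? e)) * μ e

  -- The identity 1 / ζ(s) = (1 - l^(-s)) · ν with the subtraction moved to the other side. At m = l
  -- e it reads μ(l e) = -ν(e): both are 0 if l ∣ e, and `μ-l*` applies otherwise.
  μ-decompose : ∀ {l} → Prime l → μ ⊕ point l ⋆ ν l ≐ ν l
  μ-decompose {l} lp m 0<m with l ∣? m
  ... | no l∤m = begin
    μ m + (point l ⋆ ν l) m  ≡⟨ +-congʳ (μ m) (point-⋆-∤ l m (ν l) l∤m) ⟩
    μ m + 0ℤ  ≡⟨ ℤP.+-identityʳ (μ m) ⟩
    μ m  ≡⟨ ℤP.*-identityˡ (μ m) ⟨
    1ℤ * μ m  ∎
    where open ≡-Reasoning
  ... | yes (divides e refl) rewrite ℕP.*-comm e l = begin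
    μ (l ℕ.* e) + (point l ⋆ ν l) (l ℕ.* e) ≡⟨ +-congʳ (μ (l ℕ.* e)) (point-⋆-multiple l e (ν l) 0<l 0<e) ⟩
    μ (l ℕ.* e) + ν l e  ≡⟨ cancel ⟩
    0ℤ  ≡⟨⟩
    0ℤ * μ (l ℕ.* e)  ∎
    where
    open ≡-Reasoning
    0<l : 0 < l
    0<l = ℕ.>-nonZero⁻¹ l {{prime⇒nonZero lp}}
    0<e : 0 < e
    0<e = ℕP.n≢0⇒n>0 λ { refl → ℕP.<⇒≢ 0<m (sym (ℕP.*-zeroʳ l)) }
    cancel : μ (l ℕ.* e) + ν l e ≡ 0ℤ
    cancel with l ∣? e
    ... | yes l∣e = cong (_+ 0ℤ * μ e) (μ-square 0<m lp (*-monoʳ-∣ l l∣e))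
    ... | no l∤e  = trans (cong₂ _+_ (μ-l* lp 0<e l∤e) (ℤP.*-identityˡ (μ e))) (ℤP.+-inverseˡ (μ e))

  prime-divisor : ∀ n → 1 < n → ∃ λ l → Prime l × l ∣ n
  prime-divisor n 1<n with factorise n {{ℕ.>-nonZero (ℕP.<-trans (s≤s z≤n) 1<n)}}
  ... | record { factors = [] ; isFactorisation = n≡1 } = ⊥-elim (ℕP.<⇒≢ 1<n (sym n≡1))
  ... | record { factors = l ∷ ls ; isFactorisation = n≡ ; factorsPrime = lp ∷ _ } =
    l , lp , subst (l ∣_) (sym n≡) (m∣m*n _)

  -- For m ≠ 1 choose a prime l ∣ m and decompose μ at l. Then `ν l ⋆ 𝟏` and `ν l ⋆ (point l ⋆ 𝟏)`
  -- agree at m, so their difference `μ ⋆ 𝟏` vanishes there.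
  μ-⋆-𝟏 : μ ⋆ 𝟏 ≐ point 1
  μ-⋆-𝟏 m 0<m with m ≟ 1
  ... | yes refl = refl
  ... | no m≢1 with prime-divisor m (ℕP.≤∧≢⇒< 0<m (m≢1 ∘ sym))
  ...   | l , lp , l∣m = trans (+-cancelʳ ((ν l ⋆ (point l ⋆ 𝟏)) m) ((μ ⋆ 𝟏) m) 0ℤ (begin
    (μ ⋆ 𝟏) m + (ν l ⋆ (point l ⋆ 𝟏)) m  ≡⟨ +-congʳ ((μ ⋆ 𝟏) m) (⋆-assoc (ν l) (point l) 𝟏 m 0<m) ⟨
    (μ ⋆ 𝟏 ⊕ (ν l ⋆ point l) ⋆ 𝟏) m  ≡⟨ +-congʳ ((μ ⋆ 𝟏) m) (⋆-cong (ν l ⋆ point l) 𝟏 (point l ⋆ ν l) 𝟏 (⋆-comm (ν l) (point l)) (λ _ _ → refl) m 0<m) ⟩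
    (μ ⋆ 𝟏 ⊕ (point l ⋆ ν l) ⋆ 𝟏) m  ≡⟨ ⋆-distribʳ-⊕ μ (point l ⋆ ν l) 𝟏 m 0<m ⟨
    ((μ ⊕ point l ⋆ ν l) ⋆ 𝟏) m  ≡⟨ ⋆-cong (μ ⊕ point l ⋆ ν l) 𝟏 (ν l) 𝟏 (μ-decompose lp) (λ _ _ → refl) m 0<m ⟩
    (ν l ⋆ 𝟏) m  ≡⟨ ⋆-cong-at (ν l) 𝟏 (ν l) (point l ⋆ 𝟏) m term ⟩
    (ν l ⋆ (point l ⋆ 𝟏)) m  ≡⟨ ℤP.+-identityˡ ((ν l ⋆ (point l ⋆ 𝟏)) m) ⟨
    0ℤ + (ν l ⋆ (point l ⋆ 𝟏)) m  ∎)) (sym (𝟙-no (m ≟ 1) m≢1))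
    where
    open ≡-Reasoning
    term : ∀ d e → 0 < d → 0 < e → d ℕ.* e ≡ m → ν l d * 𝟏 e ≡ ν l d * (point l ⋆ 𝟏) e
    term d e 0<d 0<e refl with l ∣? d
    ... | yes _  = refl
    -- A nonzero weight `ν l d` needs l ∤ d; then l divides the cofactor e, where `point l ⋆ 𝟏`
    -- takes the value 1.
    ... | no l∤d with euclidsLemma d e lp l∣m
    ...   | inj₁ l∣d = ⊥-elim (l∤d l∣d)
    ...   | inj₂ (divides k refl) = cong ((1ℤ * μ d) *_) (sym (trans (cong (point l ⋆ 𝟏) (ℕP.*-comm k l))
            (point-⋆-multiple l k 𝟏 (ℕ.>-nonZero⁻¹ l {{prime⇒nonZero lp}}) (ℕP.n≢0⇒n>0 λ { refl → ℕP.<⇒≢ 0<e refl }))))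

  -- Inversion of the recursion

  module _ {p : ℕ} (pp : Prime p) (c : ℤ) (B Q U : ArithmeticFunction)
           (B-𝟏 : B ⋆ 𝟏 ≐ Q) (U-B : U ≐ (λ m → c * B m) ⊕ U ⋆ point p) where

    -- Formally U (1 - p^(-s)) = c B and B ζ = Q, hence U = c Q ν. Instead of inverting 1 - p^(-s),
    -- the function `Y`, which is U ζ p^(-s) ν, is added to both sides and cancelled.
    möbius-inversion : U ≐ λ m → c * (Q ⋆ ν p) m
    möbius-inversion m 0<m = +-cancelʳ (Y m) (U m) (c * (Q ⋆ ν p) m) (begin
      U m + Y m  ≡⟨ cong (_+ Y m) (point1-⋆ U m 0<m) ⟨
      (point 1 ⋆ U) m + Y m  ≡⟨ cong (_+ Y m) (⋆-comm (point 1) U m 0<m) ⟩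
      (U ⋆ point 1) m + Y m  ≡⟨ cong (_+ Y m) (⋆-cong U (point 1) U (𝟏 ⋆ μ) (λ _ _ → refl) (λ n 0<n → sym (trans (⋆-comm 𝟏 μ n 0<n) (μ-⋆-𝟏 n 0<n))) m 0<m) ⟩
      (U ⋆ (𝟏 ⋆ μ)) m + Y m  ≡⟨ cong (_+ Y m) (⋆-assoc U 𝟏 μ m 0<m) ⟨
      (U ⋆ 𝟏 ⋆ μ) m + Y m  ≡⟨ +-congʳ ((U ⋆ 𝟏 ⋆ μ) m) Y-shift ⟩
      (U ⋆ 𝟏 ⋆ μ ⊕ U ⋆ 𝟏 ⋆ (point p ⋆ ν p)) m ≡⟨ ⋆-distribˡ-⊕ (U ⋆ 𝟏) μ (point p ⋆ ν p) m 0<m ⟨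
      (U ⋆ 𝟏 ⋆ (μ ⊕ point p ⋆ ν p)) m  ≡⟨ ⋆-cong (U ⋆ 𝟏) _ (U ⋆ 𝟏) (ν p) (λ _ _ → refl) (μ-decompose pp) m 0<m ⟩
      (U ⋆ 𝟏 ⋆ ν p) m  ≡⟨ ⋆-cong (U ⋆ 𝟏) (ν p) ((λ m → c * Q m) ⊕ V) (ν p) U⋆𝟏 (λ _ _ → refl) m 0<m ⟩
      (((λ m → c * Q m) ⊕ V) ⋆ ν p) m  ≡⟨ ⋆-distribʳ-⊕ (λ m → c * Q m) V (ν p) m 0<m ⟩
      ((λ m → c * Q m) ⋆ ν p) m + Y m  ≡⟨ cong (_+ Y m) (⋆-scale c Q (ν p) m 0<m) ⟩
      c * (Q ⋆ ν p) m + Y m  ∎)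
      where
      open ≡-Reasoning
      V Y : ArithmeticFunction
      V = U ⋆ point p ⋆ 𝟏
      Y = V ⋆ ν p
      U⋆𝟏 : U ⋆ 𝟏 ≐ (λ m → c * Q m) ⊕ V
      U⋆𝟏 n 0<n = begin
        (U ⋆ 𝟏) n  ≡⟨ ⋆-cong U 𝟏 _ 𝟏 U-B (λ _ _ → refl) n 0<n ⟩
        (((λ m → c * B m) ⊕ U ⋆ point p) ⋆ 𝟏) n  ≡⟨ ⋆-distribʳ-⊕ (λ m → c * B m) (U ⋆ point p) 𝟏 n 0<n ⟩
        ((λ m → c * B m) ⋆ 𝟏) n + V n  ≡⟨ cong (_+ V n) (⋆-scale c B 𝟏 n 0<n) ⟩
        c * (B ⋆ 𝟏) n + V n  ≡⟨ cong (λ z → c * z + V n) (B-𝟏 n 0<n) ⟩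
        c * Q n + V n  ∎
      V-swap : V ≐ U ⋆ 𝟏 ⋆ point p
      V-swap n 0<n = begin
        (U ⋆ point p ⋆ 𝟏) n  ≡⟨ ⋆-assoc U (point p) 𝟏 n 0<n ⟩
        (U ⋆ (point p ⋆ 𝟏)) n  ≡⟨ ⋆-cong U (point p ⋆ 𝟏) U (𝟏 ⋆ point p) (λ _ _ → refl) (⋆-comm (point p) 𝟏) n 0<n ⟩
        (U ⋆ (𝟏 ⋆ point p)) n  ≡⟨ ⋆-assoc U 𝟏 (point p) n 0<n ⟨
        (U ⋆ 𝟏 ⋆ point p) n  ∎
      Y-shift : Y m ≡ (U ⋆ 𝟏 ⋆ (point p ⋆ ν p)) m
      Y-shift = trans (⋆-cong V (ν p) (U ⋆ 𝟏 ⋆ point p) (ν p) V-swap (λ _ _ → refl) m 0<m) (⋆-assoc (U ⋆ 𝟏) (point p) (ν p) m 0<m)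

  -- The divisor sum of the theorem as a convolution

  foldr-map-∑ : {A : Set} (xs : List A) (f : A → ℤ) → foldr _+_ (+ 0) (map f xs) ≡ ∑ xs f
  foldr-map-∑ []       f = refl
  foldr-map-∑ (x ∷ xs) f = +-congʳ (f x) (foldr-map-∑ xs f)

  prime-coprime⇒∤ : ∀ {p n} → Prime p → Coprime n p → ¬ (p ∣ n)
  prime-coprime⇒∤ pp cop p∣n = ¬prime[1] (subst Prime (cop (p∣n , ∣-refl)) pp)

  prime-∤⇒coprime : ∀ {p n} → Prime p → ¬ (p ∣ n) → Coprime n p
  prime-∤⇒coprime pp p∤n (d∣n , d∣p) with prime⇒irreducible pp d∣p
  ... | inj₁ d≡1 = d≡1
  ... | inj₂ refl = ⊥-elim (p∤n d∣n)

  divisorSum-⋆ : ∀ {p} → Prime p → ∀ q m → 0 < m → divisorSum p q m ≡ ((λ n → + (q ℕ.^ n)) ⋆ ν p) m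
  divisorSum-⋆ {p} pp q m 0<m = begin
    divisorSum p q m
      ≡⟨ foldr-map-∑ (filter (λ k → (suc k ∣? m) ×-dec coprime? (suc k) p) (upTo m)) _ ⟩
    ∑ (filter (λ k → (suc k ∣? m) ×-dec coprime? (suc k) p) (upTo m)) (λ k → + (q ℕ.^ (m ℕ./ suc k)) * μ (suc k))
      ≡⟨ ∑-filter (λ k → (suc k ∣? m) ×-dec coprime? (suc k) p) (upTo m) _ ⟩
    ∑ (upTo m) (λ k → 𝟙 ((suc k ∣? m) ×-dec coprime? (suc k) p) * (+ (q ℕ.^ (m ℕ./ suc k)) * μ (suc k)))
      ≡⟨ ∑-cong (upTo m) term ⟩
    ∑ (upTo m) (λ k → ∑ (range m) λ d → 𝟙 (d ℕ.* suc k ≟ m) * (+ (q ℕ.^ d) * ν p (suc k)))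
      ≡⟨ ∑-upTo-suc m (λ e → ∑ (range m) λ d → 𝟙 (d ℕ.* e ≟ m) * (+ (q ℕ.^ d) * ν p e)) ⟩
    ∑ (range m) (λ e → ∑ (range m) λ d → 𝟙 (d ℕ.* e ≟ m) * (+ (q ℕ.^ d) * ν p e))
      ≡⟨ ∑-swap (range m) (range m) _ ⟩
    ((λ n → + (q ℕ.^ n)) ⋆ ν p) m ∎
    where
    open ≡-Reasoning
    rearrange : (a b c : ℤ) → 1ℤ * b * (a * c) ≡ a * (b * c)
    rearrange = solve-∀
    term : ∀ k → 𝟙 ((suc k ∣? m) ×-dec coprime? (suc k) p) * (+ (q ℕ.^ (m ℕ./ suc k)) * μ (suc k))
               ≡ ∑ (range m) λ d → 𝟙 (d ℕ.* suc k ≟ m) * (+ (q ℕ.^ d) * ν p (suc k))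
    term k = trans (cong (_* (+ (q ℕ.^ (m ℕ./ suc k)) * μ (suc k))) (𝟙-× (suc k ∣? m) (coprime? (suc k) p)))
                   (term′ (suc k ∣? m))
      where
      term′ : (k∣?m : Dec (suc k ∣ m)) →
        𝟙 k∣?m * 𝟙 (coprime? (suc k) p) * (+ (q ℕ.^ (m ℕ./ suc k)) * μ (suc k))
          ≡ ∑ (range m) λ d → 𝟙 (d ℕ.* suc k ≟ m) * (+ (q ℕ.^ d) * ν p (suc k))
      term′ (no k∤m) = sym (∑-vanish (range m) λ d _ →
            cong (_* (+ (q ℕ.^ d) * ν p (suc k))) (𝟙-no (d ℕ.* suc k ≟ m) λ eq → k∤m (divides d (sym eq))))
      term′ (yes k∣m@(divides d m≡)) = begin
        1ℤ * 𝟙 (coprime? (suc k) p) * (a * μ (suc k))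
          ≡⟨ cong (λ z → 1ℤ * z * (a * μ (suc k))) (𝟙-cong (coprime? (suc k) p) (¬? (p ∣? suc k)) (prime-coprime⇒∤ pp) (prime-∤⇒coprime pp)) ⟩
        1ℤ * 𝟙 (¬? (p ∣? suc k)) * (a * μ (suc k))
          ≡⟨ rearrange a (𝟙 (¬? (p ∣? suc k))) (μ (suc k)) ⟩
        a * ν p (suc k)
          ≡⟨ cong (λ x → + (q ℕ.^ x) * ν p (suc k)) (n/m≡quotient k∣m) ⟩
        + (q ℕ.^ d) * ν p (suc k)
          ≡⟨ ∑-δ _≟_ d (λ d → + (q ℕ.^ d) * ν p (suc k)) (range-unique m) (∈-range⁺ 0<d d≤m) ⟨
        ∑ (range m) (λ x → 𝟙 (x ≟ d) * (+ (q ℕ.^ x) * ν p (suc k)))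
          ≡⟨ ∑-cong (range m) (λ x → cong (_* (+ (q ℕ.^ x) * ν p (suc k))) (𝟙-cong (x ≟ d) (x ℕ.* suc k ≟ m)
               (λ { refl → sym m≡ }) (λ eq → ℕP.*-cancelʳ-≡ x d (suc k) (trans eq m≡)))) ⟩
        ∑ (range m) (λ x → 𝟙 (x ℕ.* suc k ≟ m) * (+ (q ℕ.^ x) * ν p (suc k))) ∎
        where
        a = + (q ℕ.^ (m ℕ./ suc k))
        0<d : 0 < d
        0<d = ℕP.n≢0⇒n>0 λ { refl → ℕP.<⇒≢ 0<m (sym m≡) }
        d≤m : d ≤ m
        d≤m = ℕP.≤-trans (ℕP.m≤m*n d (suc k)) (ℕP.≤-reflexive (sym m≡))

-- Factorial monoids with q ^ n elements of degree n

module FactorialMonoids where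
  open import Data.Integer using (+_; _+_; _*_)
  open FiniteSums
  open DirichletConvolution

  -- What the counting uses of monic polynomials, free of coefficients. Only `ε` has degree 0, so
  -- there are no other units: associates are equal, and the finite lists `elements` make
  -- divisibility and irreducibility decidable.
  record FactorialMonoid (q : ℕ) : Set₁ where
    infixl 7 _·_
    infix 4 _≟_ _∣_
    field
      M     : Set
      _·_   : M → M → M
      ε     : M
      deg   : M → ℕ
      _≟_   : DecidableEquality M
      isCommutativeMonoid : IsCommutativeMonoid _≡_ _·_ ε
      ·-cancelˡ : ∀ x {y z} → x · y ≡ x · z → y ≡ z
      deg-· : ∀ x y → deg (x · y) ≡ deg x ℕ.+ deg y
      deg≡0 : ∀ {x} → deg x ≡ 0 → x ≡ ε
      elements        : ℕ → List M
      elements-unique : ∀ n → Unique (elements n)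
      ∈-elements⁺     : ∀ x → x ∈ elements (deg x)
      ∈-elements⁻     : ∀ {n x} → x ∈ elements n → deg x ≡ n
      length-elements : ∀ n → length (elements n) ≡ q ^ n

    _∣_ : M → M → Set
    x ∣ y = ∃ λ k → x · k ≡ y

    Irr : M → Set
    Irr x = deg x ≢ 0 × (∀ y z → y · z ≡ x → deg y ≡ 0 ⊎ deg z ≡ 0)

    field
      euclid : ∀ {x} y z → Irr x → x ∣ y · z → x ∣ y ⊎ x ∣ z

    open IsCommutativeMonoid isCommutativeMonoid public using (assoc; comm; identityˡ; identityʳ)

    deg-ε : deg ε ≡ 0
    deg-ε = ℕP.+-cancelˡ-≡ (deg ε) (deg ε) 0
      (trans (sym (deg-· ε ε)) (trans (cong deg (identityˡ ε)) (sym (ℕP.+-identityʳ _))))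

    ∣-refl : ∀ {x} → x ∣ x
    ∣-refl = ε , identityʳ _

    ∣-·ʳ : ∀ {x y} z → x ∣ y → x ∣ y · z
    ∣-·ʳ z (k , refl) = k · z , sym (assoc _ k z)

    ∣-·ˡ : ∀ {x z} y → x ∣ z → x ∣ y · z
    ∣-·ˡ {x} {z} y x∣z = subst (x ∣_) (comm z y) (∣-·ʳ y x∣z)

    ∣⇒deg≤ : ∀ {x y} → x ∣ y → deg x ≤ deg y
    ∣⇒deg≤ {x} (k , refl) = subst (deg x ≤_) (sym (deg-· x k)) (ℕP.m≤m+n (deg x) (deg k))

    _∣?_ : ∀ x y → Dec (x ∣ y)
    x ∣? y = map′ satisfied complete (any? (λ k → x · k ≟ y) (elements (deg y ∸ deg x)))
      where
      complete : x ∣ y → Any (λ k → x · k ≡ y) (elements (deg y ∸ deg x))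
      complete (k , refl) = lose (subst (λ n → k ∈ elements n) eq (∈-elements⁺ k)) refl
        where
        eq : deg k ≡ deg (x · k) ∸ deg x
        eq = sym (trans (cong (_∸ deg x) (deg-· x k)) (ℕP.m+n∸m≡n (deg x) (deg k)))

    ProperDivisor : M → M → Set
    ProperDivisor x y = y ∣ x × deg y ≢ 0 × deg y ≢ deg x

    properDivisor? : ∀ x → Dec (∃ (ProperDivisor x))
    properDivisor? x = map′ sound complete (any? (λ n → any? proper? (elements n)) (upTo (suc (deg x))))
      where
      proper? : ∀ y → Dec (ProperDivisor x y)
      proper? y = (y ∣? x) ×-dec ¬? (deg y ℕP.≟ 0) ×-dec ¬? (deg y ℕP.≟ deg x)
      sound : Any (λ n → Any (ProperDivisor x) (elements n)) (upTo (suc (deg x))) → ∃ (ProperDivisor x)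
      sound a = satisfied (proj₂ (satisfied a))
      complete : ∃ (ProperDivisor x) → Any (λ n → Any (ProperDivisor x) (elements n)) (upTo (suc (deg x)))
      complete (y , pd@(y∣x , _)) = lose (∈-upTo⁺ (s≤s (∣⇒deg≤ y∣x))) (lose (∈-elements⁺ y) pd)

    ¬properDivisor⇒Irr : ∀ {x} → deg x ≢ 0 → ¬ ∃ (ProperDivisor x) → Irr x
    ¬properDivisor⇒Irr {x} x≢0 none = x≢0 , split
      where
      split : ∀ y z → y · z ≡ x → deg y ≡ 0 ⊎ deg z ≡ 0
      split y z refl with deg y ℕP.≟ 0 | deg y ℕP.≟ deg (y · z)
      ... | yes y≡0 | _      = inj₁ y≡0
      ... | no _    | yes eq = inj₂ (ℕP.+-cancelˡ-≡ (deg y) (deg z) 0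
                                 (trans (sym (deg-· y z)) (trans (sym eq) (sym (ℕP.+-identityʳ _)))))
      ... | no y≢0  | no y≢x = ⊥-elim (none (y , (z , refl) , y≢0 , y≢x))

    Irr⇒¬properDivisor : ∀ {x} → Irr x → ¬ ∃ (ProperDivisor x)
    Irr⇒¬properDivisor (_ , split) (y , (z , refl) , y≢0 , y≢x) with split y z refl
    ... | inj₁ y≡0 = y≢0 y≡0
    ... | inj₂ z≡0 = y≢x (sym (trans (deg-· y z) (trans (cong (deg y ℕ.+_) z≡0) (ℕP.+-identityʳ _))))

    Irr? : Decidable Irr
    Irr? x with deg x ℕP.≟ 0 | properDivisor? x
    ... | yes x≡0 | _       = no λ x-irr → proj₁ x-irr x≡0
    ... | no x≢0  | yes pd  = no λ x-irr → Irr⇒¬properDivisor x-irr pd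
    ... | no x≢0  | no none = yes (¬properDivisor⇒Irr x≢0 none)

    irr-factor : ∀ x → deg x ≢ 0 → ∃ λ P → Irr P × P ∣ x
    irr-factor x = go (deg x) x ℕP.≤-refl
      where
      go : ∀ n x → deg x ≤ n → deg x ≢ 0 → ∃ λ P → Irr P × P ∣ x
      go zero    x x≤0 x≢0 = ⊥-elim (x≢0 (ℕP.n≤0⇒n≡0 x≤0))
      go (suc n) x x≤n x≢0 with properDivisor? x
      ... | no none = x , ¬properDivisor⇒Irr x≢0 none , ∣-refl
      ... | yes (y , y∣x@(z , refl) , y≢0 , y≢x)
        with go n y (ℕP.≤-pred (ℕP.≤-trans (ℕP.≤∧≢⇒< (∣⇒deg≤ y∣x) y≢x) x≤n)) y≢0
      ...   | P , P-irr , P∣y = P , P-irr , ∣-·ʳ z P∣y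

    Irr-∣⇒≡ : ∀ {x y} → deg x ≢ 0 → Irr y → x ∣ y → x ≡ y
    Irr-∣⇒≡ {x} x≢0 (_ , split) (k , refl) with split x k refl
    ... | inj₁ x≡0 = ⊥-elim (x≢0 x≡0)
    ... | inj₂ k≡0 = sym (trans (cong (x ·_) (deg≡0 k≡0)) (identityʳ x))

    Irr∤ε : ∀ {x} → Irr x → ¬ (x ∣ ε)
    Irr∤ε {x} (x≢0 , _) x∣ε = x≢0 (ℕP.n≤0⇒n≡0 (subst (deg x ≤_) deg-ε (∣⇒deg≤ x∣ε)))

    ∏ : ℕ → (ℕ → M) → M
    ∏ zero    f = ε
    ∏ (suc n) f = f n · ∏ n f

    ∏-cong : ∀ n {f g : ℕ → M} → (∀ i → f i ≡ g i) → ∏ n f ≡ ∏ n g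
    ∏-cong zero    eq = refl
    ∏-cong (suc n) eq = cong₂ _·_ (eq n) (∏-cong n eq)

    -- Peels the product at the low end. When `f n ≡ f 0` it says that a cyclic shift of the factors
    -- preserves the product, which is the source of `norm-invariant` and of the invariance of L.
    ∏-suc : ∀ n f → f 0 · ∏ n (f ∘ suc) ≡ ∏ (suc n) f
    ∏-suc zero    f = refl
    ∏-suc (suc n) f = begin
      f 0 · (f (suc n) · ∏ n (f ∘ suc)) ≡⟨ assoc _ _ _ ⟨
      f 0 · f (suc n) · ∏ n (f ∘ suc)  ≡⟨ cong (_· ∏ n (f ∘ suc)) (comm _ _) ⟩
      f (suc n) · f 0 · ∏ n (f ∘ suc)  ≡⟨ assoc _ _ _ ⟩
      f (suc n) · (f 0 · ∏ n (f ∘ suc)) ≡⟨ cong (f (suc n) ·_) (∏-suc n f) ⟩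
      ∏ (suc (suc n)) f  ∎
      where open ≡-Reasoning

    deg-∏ : ∀ n f d → (∀ i → deg (f i) ≡ d) → deg (∏ n f) ≡ n ℕ.* d
    deg-∏ zero    f d eq = deg-ε
    deg-∏ (suc n) f d eq = trans (deg-· (f n) (∏ n f)) (cong₂ ℕ._+_ (eq n) (deg-∏ n f d eq))

    ∣-∏ : ∀ {n i} f → i < n → f i ∣ ∏ n f
    ∣-∏ {suc n} {i} f i<1+n with i ℕP.≟ n
    ... | yes refl = ∣-·ʳ (∏ n f) ∣-refl
    ... | no i≢n   = ∣-·ˡ (f n) (∣-∏ f (ℕP.≤∧≢⇒< (ℕP.≤-pred i<1+n) i≢n))

    Irr-∣-∏ : ∀ {x} n f → Irr x → x ∣ ∏ n f → ∃ λ i → i < n × x ∣ f i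
    Irr-∣-∏ zero    f x-irr x∣ = ⊥-elim (Irr∤ε x-irr x∣)
    Irr-∣-∏ (suc n) f x-irr x∣ with euclid (f n) (∏ n f) x-irr x∣
    ... | inj₁ x∣f = n , ℕP.≤-refl , x∣f
    ... | inj₂ x∣∏ with Irr-∣-∏ n f x-irr x∣∏
    ...   | i , i<n , x∣f = i , ℕP.m≤n⇒m≤1+n i<n , x∣f

    -- Induction on n: the last factor divides `∏ n f · k`. It cannot divide the product, whose
    -- factors are irreducibles different from it, so it divides k.
    ∏-∣ : ∀ n f z → (∀ i → i < n → Irr (f i)) → (∀ {i j} → i < j → j < n → f i ≢ f j) →
          (∀ i → i < n → f i ∣ z) → ∏ n f ∣ z
    ∏-∣ zero    f z f-irr distinct f∣z = z , identityˡ z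
    ∏-∣ (suc n) f z f-irr distinct f∣z
      with ∏-∣ n f z (λ i i<n → f-irr i (ℕP.m≤n⇒m≤1+n i<n)) (λ i<j j<n → distinct i<j (ℕP.m≤n⇒m≤1+n j<n))
                (λ i i<n → f∣z i (ℕP.m≤n⇒m≤1+n i<n))
    ... | k , refl with euclid (∏ n f) k (f-irr n ℕP.≤-refl) (f∣z n ℕP.≤-refl)
    ...   | inj₁ fn∣∏ with Irr-∣-∏ n f (f-irr n ℕP.≤-refl) fn∣∏
    ...     | i , i<n , fn∣fi = ⊥-elim (distinct i<n ℕP.≤-refl
                (sym (Irr-∣⇒≡ (proj₁ (f-irr n ℕP.≤-refl)) (f-irr i (ℕP.m≤n⇒m≤1+n i<n)) fn∣fi)))
    ∏-∣ (suc n) f z f-irr distinct f∣z | k , refl | inj₂ (l , refl) =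
      l , trans (cong (_· l) (comm (f n) (∏ n f))) (assoc (∏ n f) (f n) l)

    -- Valuations and the degree formula

    pow : M → ℕ → M
    pow x n = ∏ n (λ _ → x)

    deg-pow : ∀ x n → deg (pow x n) ≡ n ℕ.* deg x
    deg-pow x n = deg-∏ n (λ _ → x) (deg x) (λ _ → refl)

    -- In P^e · k = Q · y the irreducible Q divides P^e or k; the former would give Q = P, and in
    -- the latter case Q cancels.
    pow-∣-cancel : ∀ {P Q} → Irr P → Irr Q → P ≢ Q → ∀ e y → pow P e ∣ Q · y → pow P e ∣ y
    pow-∣-cancel {P} {Q} P-irr Q-irr P≢Q e y (k , eq) with euclid (pow P e) k Q-irr (y , sym eq)
    ... | inj₁ Q∣P^e = ⊥-elim (P≢Q (sym (Irr-∣⇒≡ (proj₁ Q-irr) P-irr (proj₂ (proj₂ (Irr-∣-∏ e _ Q-irr Q∣P^e))))))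
    ... | inj₂ (l , refl) = l , ·-cancelˡ Q (begin
      Q · (pow P e · l)  ≡⟨ assoc Q (pow P e) l ⟨
      Q · pow P e · l  ≡⟨ cong (_· l) (comm Q (pow P e)) ⟩
      pow P e · Q · l  ≡⟨ assoc (pow P e) Q l ⟩
      pow P e · (Q · l)  ≡⟨ eq ⟩
      Q · y  ∎)
      where open ≡-Reasoning

    -- The exponent of an irreducible P in x, provided that deg x ≤ N. The bound N is common to all
    -- P and x so that the sums over them can be exchanged.
    valuation : ℕ → M → M → ℤ
    valuation N P x = ∑ (range N) λ e → 𝟙 (pow P e ∣? x)

    ∑-range-shift : ∀ n (f : ℕ → ℤ) → ∑ (range n) (f ∘ ℕ.pred) + f n ≡ f 0 + ∑ (range n) f
    ∑-range-shift zero    f = trans (ℤP.+-identityˡ (f 0)) (sym (ℤP.+-identityʳ (f 0)))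
    ∑-range-shift (suc n) f = begin
      f n + ∑ (range n) (f ∘ ℕ.pred) + f (suc n)  ≡⟨ cong (_+ f (suc n)) (ℤP.+-comm (f n) _) ⟩
      ∑ (range n) (f ∘ ℕ.pred) + f n + f (suc n)  ≡⟨ cong (_+ f (suc n)) (∑-range-shift n f) ⟩
      f 0 + ∑ (range n) f + f (suc n)  ≡⟨ ℤP.+-assoc (f 0) _ _ ⟩
      f 0 + (∑ (range n) f + f (suc n))  ≡⟨ +-congʳ (f 0) (ℤP.+-comm _ (f (suc n))) ⟩
      f 0 + (f (suc n) + ∑ (range n) f)  ∎
      where open ≡-Reasoning

    -- For P = Q, P^e divides P y exactly if P^(e-1) divides y, so the summation index moves down by
    -- one: the new term e = 0 contributes 1, and the lost term e = N is 0.
    valuation-· : ∀ N {P Q} y → Irr P → Irr Q → deg (Q · y) ≤ N →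
                  valuation N P (Q · y) ≡ 𝟙 (P ≟ Q) + valuation N P y
    valuation-· N {P} {Q} y P-irr Q-irr Qy≤N with P ≟ Q
    ... | no P≢Q = trans
      (∑-cong (range N) λ e → 𝟙-cong (pow P e ∣? (Q · y)) (pow P e ∣? y)
        (pow-∣-cancel P-irr Q-irr P≢Q e y) (∣-·ˡ Q))
      (sym (ℤP.+-identityˡ _))
    ... | yes refl = begin
      ∑ (range N) (λ e → 𝟙 (pow P e ∣? (P · y)))  ≡⟨ ∑-cong-∈ (range N) shift ⟩
      ∑ (range N) (v ∘ ℕ.pred)  ≡⟨ ℤP.+-identityʳ _ ⟨
      ∑ (range N) (v ∘ ℕ.pred) + 0ℤ  ≡⟨ +-congʳ (∑ (range N) (v ∘ ℕ.pred)) (𝟙-no (pow P N ∣? y) P^N∤y) ⟨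
      ∑ (range N) (v ∘ ℕ.pred) + v N  ≡⟨ ∑-range-shift N v ⟩
      v 0 + ∑ (range N) v  ≡⟨ cong (_+ ∑ (range N) v) (𝟙-yes (pow P 0 ∣? y) (y , identityˡ y)) ⟩
      1ℤ + ∑ (range N) v  ∎
      where
      open ≡-Reasoning
      v : ℕ → ℤ
      v e = 𝟙 (pow P e ∣? y)
      shift : ∀ e → e ∈ range N → 𝟙 (pow P e ∣? (P · y)) ≡ v (ℕ.pred e)
      shift zero    e∈ = ⊥-elim (ℕP.<⇒≢ (proj₁ (∈-range⁻ e∈)) refl)
      shift (suc e) e∈ = 𝟙-cong (pow P (suc e) ∣? (P · y)) (pow P e ∣? y)
        (λ { (k , eq) → k , ·-cancelˡ P (trans (sym (assoc P (pow P e) k)) eq) })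
        (λ { (k , refl) → k , assoc P (pow P e) k })
      -- P has positive degree, so deg (P · y) ≤ N forces deg y < N ≤ deg P^N.
      P^N∤y : ¬ (pow P N ∣ y)
      P^N∤y P^N∣y = ℕP.<⇒≱ y<N (ℕP.≤-trans (ℕP.m≤m*n N (deg P) {{ℕ.≢-nonZero (proj₁ P-irr)}})
        (ℕP.≤-trans (ℕP.≤-reflexive (sym (deg-pow P N))) (∣⇒deg≤ P^N∣y)))
        where
        y<N : deg y < N
        y<N = ℕP.<-≤-trans (ℕP.m<n+m (deg y) (ℕP.n≢0⇒n>0 (proj₁ P-irr))) (subst (_≤ N) (deg-· P y) Qy≤N)

    private
      -- The sum of deg P · v_P(x) over the irreducibles P of degree at most N.
      weight : ℕ → M → ℤ
      weight N x = ∑ (range N) λ d → ∑ (elements d) λ P → 𝟙 (Irr? P) * (+ d * valuation N P x)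

    ∑-∑-δ : ∀ N Q (f : M → ℤ) → 0 < deg Q → deg Q ≤ N →
            ∑ (range N) (λ d → ∑ (elements d) λ P → 𝟙 (P ≟ Q) * f P) ≡ f Q
    ∑-∑-δ N Q f 0<Q Q≤N = trans (∑-cong (range N) inner) (∑-δ ℕP._≟_ (deg Q) (λ _ → f Q) (range-unique N) (∈-range⁺ 0<Q Q≤N))
      where
      inner : ∀ d → ∑ (elements d) (λ P → 𝟙 (P ≟ Q) * f P) ≡ 𝟙 (d ℕP.≟ deg Q) * f Q
      inner d with d ℕP.≟ deg Q in eq
      ... | yes refl = trans (∑-δ _≟_ Q f (elements-unique d) (∈-elements⁺ Q)) (trans (sym (ℤP.*-identityˡ (f Q))) (cong (_* f Q) (sym (𝟙-yes (d ℕP.≟ deg Q) refl))))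
      ... | no d≢    = trans (∑-δ-∉ _≟_ (elements d) Q f (λ Q∈ → d≢ (sym (∈-elements⁻ Q∈)))) (cong (_* f Q) (sym (𝟙-no (d ℕP.≟ deg Q) d≢)))

    -- Both sides grow by deg Q when an irreducible factor Q is split off. This additivity is the
    -- form in which unique factorization enters the count.
    weight-deg : ∀ N x → deg x ≤ N → weight N x ≡ + deg x
    weight-deg N x x≤N = go (deg x) x ℕP.≤-refl x≤N
      where
      open ≡-Reasoning
      go : ∀ n x → deg x ≤ n → deg x ≤ N → weight N x ≡ + deg x
      go n x x≤n x≤N with deg x ℕP.≟ 0
      ... | yes x≡0 with deg≡0 x≡0
      ...   | refl = trans (∑-vanish (range N) λ d _ → ∑-vanish (elements d) λ P _ → trans
              (𝟙-*-cong (Irr? P) λ P-irr → trans (cong (+ d *_) (none P-irr)) (ℤP.*-zeroʳ (+ d)))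
              (ℤP.*-zeroʳ (𝟙 (Irr? P)))) (cong +_ (sym deg-ε))
        where
        none : ∀ {P} → Irr P → valuation N P ε ≡ 0ℤ
        none {P} P-irr = ∑-vanish (range N) λ
          { zero e∈ → ⊥-elim (ℕP.<⇒≢ (proj₁ (∈-range⁻ e∈)) refl)
          ; (suc e) _ → 𝟙-no (pow P (suc e) ∣? ε) λ { (k , eq) → Irr∤ε P-irr (pow P e · k , trans (sym (assoc P (pow P e) k)) eq) } }
      go zero    x x≤0 x≤N | no x≢0 = ⊥-elim (x≢0 (ℕP.n≤0⇒n≡0 x≤0))
      go (suc n) x x≤n x≤N | no x≢0 with irr-factor x x≢0
      ...   | Q , Q-irr , y , refl = begin
        weight N (Q · y)
          ≡⟨ ∑-cong (range N) (λ d → ∑-cong (elements d) λ P → 𝟙-*-cong (Irr? P) λ P-irr →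
               cong (+ d *_) (valuation-· N y P-irr Q-irr x≤N)) ⟩
        ∑ (range N) (λ d → ∑ (elements d) λ P → 𝟙 (Irr? P) * (+ d * (𝟙 (P ≟ Q) + valuation N P y)))
          ≡⟨ ∑-cong (range N) (λ d → ∑-cong-∈ (elements d) λ P P∈ → trans
               (split-term (𝟙 (Irr? P)) (+ d) (𝟙 (P ≟ Q)) (valuation N P y))
               (cong (λ d′ → 𝟙 (P ≟ Q) * (𝟙 (Irr? P) * + d′) + 𝟙 (Irr? P) * (+ d * valuation N P y)) (sym (∈-elements⁻ P∈)))) ⟩
        ∑ (range N) (λ d → ∑ (elements d) λ P → 𝟙 (P ≟ Q) * (𝟙 (Irr? P) * + deg P) + 𝟙 (Irr? P) * (+ d * valuation N P y))
          ≡⟨ trans (∑-cong (range N) (λ d → ∑-+ (elements d) _ _)) (∑-+ (range N) _ _) ⟩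
        ∑ (range N) (λ d → ∑ (elements d) λ P → 𝟙 (P ≟ Q) * (𝟙 (Irr? P) * + deg P)) + weight N y
          ≡⟨ cong₂ _+_ (∑-∑-δ N Q (λ P → 𝟙 (Irr? P) * + deg P) 0<Q Q≤N) (go n y y≤n (ℕP.≤-trans y≤Qy x≤N)) ⟩
        𝟙 (Irr? Q) * + deg Q + + deg y
          ≡⟨ cong (λ z → z * + deg Q + + deg y) (𝟙-yes (Irr? Q) Q-irr) ⟩
        1ℤ * + deg Q + + deg y
          ≡⟨ cong (_+ + deg y) (ℤP.*-identityˡ (+ deg Q)) ⟩
        + deg Q + + deg y
          ≡⟨ cong +_ (deg-· Q y) ⟨
        + deg (Q · y) ∎
        where
        split-term : (i d a v : ℤ) → i * (d * (a + v)) ≡ a * (i * d) + i * (d * v)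
        split-term = solve-∀
        0<Q : 0 < deg Q
        0<Q = ℕP.n≢0⇒n>0 (proj₁ Q-irr)
        Q≤N : deg Q ≤ N
        Q≤N = ℕP.≤-trans (∣⇒deg≤ (y , refl)) x≤N
        y≤Qy : deg y ≤ deg (Q · y)
        y≤Qy = ∣⇒deg≤ (Q , comm y Q)
        y≤n : deg y ≤ n
        y≤n = ℕP.≤-pred (ℕP.≤-trans (ℕP.m<n+m (deg y) 0<Q) (subst (_≤ suc n) (deg-· Q y) x≤n))

    -- The number of elements of degree n divisible by a given element of degree j, see
    -- `count-multiples`. The indicator is essential, since the truncated n ∸ j would yield 1 for j
    -- > n.
    multiples : ℕ → ℕ → ℤ
    multiples n j = 𝟙 (j ℕP.≤? n) * + (q ^ (n ∸ j))

    count-multiples : ∀ n z → ∑ (elements n) (λ x → 𝟙 (z ∣? x)) ≡ multiples n (deg z)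
    count-multiples n z with deg z ℕP.≤? n
    ... | no z-large = trans (∑-vanish (elements n) λ x x∈ → 𝟙-no (z ∣? x) λ z∣x →
                     z-large (subst (deg z ≤_) (∈-elements⁻ x∈) (∣⇒deg≤ z∣x)))
                     (sym (cong (_* + (q ^ (n ∸ deg z))) (𝟙-no (deg z ℕP.≤? n) z-large)))
    ... | yes z-small = begin
      ∑ (elements n) (λ x → 𝟙 (z ∣? x))
        ≡⟨ ∑-𝟙-enumerate _≟_ (z ∣?_) (elements-unique n) (map⁺ (·-cancelˡ z) (elements-unique (n ∸ deg z))) to from ⟩
      + length (map (z ·_) (elements (n ∸ deg z)))
        ≡⟨ cong +_ (trans (ListP.length-map (z ·_) (elements (n ∸ deg z))) (length-elements (n ∸ deg z))) ⟩
      + (q ^ (n ∸ deg z))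
        ≡⟨ ℤP.*-identityˡ _ ⟨
      1ℤ * + (q ^ (n ∸ deg z))
        ≡⟨ cong (_* + (q ^ (n ∸ deg z))) (𝟙-yes (deg z ℕP.≤? n) z-small) ⟨
      multiples n (deg z) ∎
      where
      open ≡-Reasoning
      to : ∀ x → x ∈ elements n → z ∣ x → x ∈ map (z ·_) (elements (n ∸ deg z))
      to x x∈ (k , refl) = ∈-map⁺ (z ·_) (subst (λ d → k ∈ elements d) eq (∈-elements⁺ k))
        where
        eq : deg k ≡ n ∸ deg z
        eq = trans (sym (ℕP.m+n∸m≡n (deg z) (deg k))) (cong (_∸ deg z) (trans (sym (deg-· z k)) (∈-elements⁻ x∈)))
      from : ∀ x → x ∈ map (z ·_) (elements (n ∸ deg z)) → x ∈ elements n × z ∣ x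
      from x x∈ with ∈-map⁻ (z ·_) x∈
      ... | k , k∈ , refl = subst (λ d → z · k ∈ elements d) eq (∈-elements⁺ (z · k)) , k , refl
        where
        eq : deg (z · k) ≡ n
        eq = trans (deg-· z k) (trans (cong (deg z ℕ.+_) (∈-elements⁻ k∈)) (ℕP.m+[n∸m]≡n z-small))

    -- The number of irreducibles of each degree

    I : ℕ → ℤ
    I n = ∑ (elements n) λ P → 𝟙 (Irr? P)

    private
      B : ArithmeticFunction
      B d = + d * I d

      H : ℕ → ℕ → ℤ
      H N n = ∑ (range N) λ d → ∑ (range N) λ e → B d * multiples n (d ℕ.* e)

    -- The degrees of all q^n elements of degree n are added up in two ways: directly, and by prime
    -- powers P^e, each contributing deg P for every multiple of P^e.
    total-degree : ∀ n → + n * + (q ^ n) ≡ H n n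
    total-degree n = begin
      + n * + (q ^ n)
        ≡⟨ ℤP.*-comm (+ n) (+ (q ^ n)) ⟩
      + (q ^ n) * + n
        ≡⟨ cong (λ l → + l * + n) (length-elements n) ⟨
      + length (elements n) * + n
        ≡⟨ ∑-const (elements n) (+ n) ⟨
      ∑ (elements n) (λ _ → + n)
        ≡⟨ ∑-cong-∈ (elements n) (λ x x∈ → trans (weight-deg n x (ℕP.≤-reflexive (∈-elements⁻ x∈))) (cong +_ (∈-elements⁻ x∈))) ⟨
      ∑ (elements n) (weight n)
        ≡⟨ trans (∑-swap (elements n) (range n) _) (∑-cong (range n) λ d → ∑-swap (elements n) (elements d) _) ⟩
      ∑ (range n) (λ d → ∑ (elements d) λ P → ∑ (elements n) λ x → 𝟙 (Irr? P) * (+ d * valuation n P x))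
        ≡⟨ ∑-cong (range n) (λ d → ∑-cong-∈ (elements d) λ P P∈ → inner d P (∈-elements⁻ P∈)) ⟩
      ∑ (range n) (λ d → ∑ (elements d) λ P → 𝟙 (Irr? P) * (+ d * ∑ (range n) λ e → multiples n (d ℕ.* e)))
        ≡⟨ ∑-cong (range n) (λ d → trans (∑-*ʳ (elements d) _ _) (trans (regroup (I d) (+ d) _) (sym (∑-*ˡ (range n) (B d) _)))) ⟩
      H n n ∎
      where
      open ≡-Reasoning
      regroup : (i d s : ℤ) → i * (d * s) ≡ d * i * s
      regroup = solve-∀
      inner : ∀ d P → deg P ≡ d → ∑ (elements n) (λ x → 𝟙 (Irr? P) * (+ d * valuation n P x))
                                ≡ 𝟙 (Irr? P) * (+ d * ∑ (range n) λ e → multiples n (d ℕ.* e))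
      inner d P refl = begin
        ∑ (elements n) (λ x → 𝟙 (Irr? P) * (+ d * valuation n P x))  ≡⟨ ∑-*ˡ (elements n) (𝟙 (Irr? P)) _ ⟩
        𝟙 (Irr? P) * ∑ (elements n) (λ x → + d * valuation n P x)  ≡⟨ cong (𝟙 (Irr? P) *_) (∑-*ˡ (elements n) (+ d) _) ⟩
        𝟙 (Irr? P) * (+ d * ∑ (elements n) (λ x → valuation n P x))  ≡⟨ cong (λ z → 𝟙 (Irr? P) * (+ d * z)) (∑-swap (elements n) (range n) _) ⟩
        𝟙 (Irr? P) * (+ d * ∑ (range n) λ e → ∑ (elements n) λ x → 𝟙 (pow P e ∣? x))
          ≡⟨ cong (λ z → 𝟙 (Irr? P) * (+ d * z)) (∑-cong (range n) λ e → trans (count-multiples n (pow P e))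
               (cong (multiples n) (trans (deg-pow P e) (ℕP.*-comm e (deg P))))) ⟩
        𝟙 (Irr? P) * (+ d * ∑ (range n) λ e → multiples n (d ℕ.* e)) ∎

    -- The count is multiplied by q while j ≤ n, and begins with the value 1 at j = n + 1. The last
    -- summand is that beginning.
    multiples-suc : ∀ n j → multiples (suc n) j ≡ + q * multiples n j + 𝟙 (j ℕP.≟ suc n)
    multiples-suc n j with j ℕP.≤? n
    ... | yes j≤n = begin
      𝟙 (j ℕP.≤? suc n) * + (q ^ (suc n ∸ j))  ≡⟨ cong₂ _*_ (𝟙-yes (j ℕP.≤? suc n) (ℕP.m≤n⇒m≤1+n j≤n)) (cong (λ k → + (q ^ k)) (ℕP.+-∸-assoc 1 j≤n)) ⟩
      1ℤ * + (q ℕ.* q ^ (n ∸ j))  ≡⟨ cong (1ℤ *_) (ℤP.pos-* q (q ^ (n ∸ j))) ⟩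
      1ℤ * (+ q * + (q ^ (n ∸ j)))  ≡⟨ regroup (+ q) (+ (q ^ (n ∸ j))) ⟩
      + q * (1ℤ * + (q ^ (n ∸ j))) + 0ℤ  ≡⟨ cong₂ (λ a b → + q * (a * + (q ^ (n ∸ j))) + b) (𝟙-yes (j ℕP.≤? n) j≤n) (𝟙-no (j ℕP.≟ suc n) (ℕP.<⇒≢ (s≤s j≤n))) ⟨
      + q * multiples n j + 𝟙 (j ℕP.≟ suc n)  ∎
      where
      open ≡-Reasoning
      regroup : (a b : ℤ) → 1ℤ * (a * b) ≡ a * (1ℤ * b) + 0ℤ
      regroup = solve-∀
    ... | no j≰n with j ℕP.≟ suc n
    ...   | yes refl = begin
      𝟙 (j ℕP.≤? j) * + (q ^ (j ∸ j))  ≡⟨ cong₂ _*_ (𝟙-yes (j ℕP.≤? j) ℕP.≤-refl) (cong (λ k → + (q ^ k)) (ℕP.n∸n≡0 j)) ⟩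
      1ℤ  ≡⟨ regroup (+ q) (+ (q ^ (n ∸ j))) ⟩
      + q * (0ℤ * + (q ^ (n ∸ j))) + 1ℤ  ≡⟨ cong₂ (λ a b → + q * (a * + (q ^ (n ∸ j))) + b) (𝟙-no (j ℕP.≤? n) j≰n) (𝟙-yes (j ℕP.≟ j) refl) ⟨
      + q * multiples n j + 𝟙 (j ℕP.≟ j)  ∎
      where
      open ≡-Reasoning
      regroup : (a b : ℤ) → 1ℤ ≡ a * (0ℤ * b) + 1ℤ
      regroup = solve-∀
    ...   | no j≢ = begin
      𝟙 (j ℕP.≤? suc n) * + (q ^ (suc n ∸ j))  ≡⟨ cong (_* + (q ^ (suc n ∸ j))) (𝟙-no (j ℕP.≤? suc n) λ j≤ → j≰n (ℕP.≤-pred (ℕP.≤∧≢⇒< j≤ j≢))) ⟩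
      0ℤ * + (q ^ (suc n ∸ j))  ≡⟨ regroup (+ (q ^ (suc n ∸ j))) (+ q) (+ (q ^ (n ∸ j))) ⟩
      + q * (0ℤ * + (q ^ (n ∸ j))) + 0ℤ  ≡⟨ cong₂ (λ a b → + q * (a * + (q ^ (n ∸ j))) + b) (𝟙-no (j ℕP.≤? n) j≰n) (𝟙-no (j ℕP.≟ suc n) j≢) ⟨
      + q * multiples n j + 𝟙 (j ℕP.≟ suc n)  ∎
      where
      open ≡-Reasoning
      regroup : (a b c : ℤ) → 0ℤ * a ≡ b * (0ℤ * c) + 0ℤ
      regroup = solve-∀

    H-extend : ∀ n → H (suc n) n ≡ H n n
    H-extend n = trans
      (∑-cong-∈ (range (suc n)) λ d d∈ → ∑-range-extend _ (ℕP.n≤1+n n) λ e n<e →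
        vanish d (d ℕ.* e) (ℕP.<-≤-trans n<e (ℕP.m≤n*m e d {{ℕ.>-nonZero (proj₁ (∈-range⁻ d∈))}})))
      (∑-range-extend _ (ℕP.n≤1+n n) λ d n<d → ∑-vanish (range n) λ e e∈ →
        vanish d (d ℕ.* e) (ℕP.<-≤-trans n<d (ℕP.m≤m*n d e {{ℕ.>-nonZero (proj₁ (∈-range⁻ e∈))}})))
      where
      vanish : ∀ d j → n < j → B d * multiples n j ≡ 0ℤ
      vanish d j n<j = trans (cong (λ z → B d * (z * + (q ^ (n ∸ j)))) (𝟙-no (j ℕP.≤? n) (ℕP.<⇒≱ n<j))) (ℤP.*-zeroʳ (B d))

    -- Comparing total-degree at n and at n + 1 isolates the terms with d e = n + 1.

    I-⋆-𝟏 : (λ d → + d * I d) ⋆ 𝟏 ≐ λ m → + (q ^ m)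
    I-⋆-𝟏 (suc n) _ = +-cancelˡ (+ q * H n n) ((B ⋆ 𝟏) (suc n)) (+ (q ^ suc n)) (begin
      + q * H n n + (B ⋆ 𝟏) (suc n)  ≡⟨ cong (λ z → + q * z + (B ⋆ 𝟏) (suc n)) (H-extend n) ⟨
      + q * H (suc n) n + (B ⋆ 𝟏) (suc n)  ≡⟨ H-recursion (suc n) ⟨
      H (suc n) (suc n)  ≡⟨ total-degree (suc n) ⟨
      (1ℤ + + n) * + (q ℕ.* q ^ n)  ≡⟨ cong ((1ℤ + + n) *_) (ℤP.pos-* q (q ^ n)) ⟩
      (1ℤ + + n) * (+ q * + (q ^ n))  ≡⟨ regroup (+ n) (+ q) (+ (q ^ n)) ⟩
      + q * (+ n * + (q ^ n)) + + q * + (q ^ n)  ≡⟨ cong₂ (λ a b → + q * a + b) (total-degree n) (sym (ℤP.pos-* q (q ^ n))) ⟩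
      + q * H n n + + (q ^ suc n)  ∎)
      where
      open ≡-Reasoning
      regroup : (n a b : ℤ) → (1ℤ + n) * (a * b) ≡ a * (n * b) + a * b
      regroup = solve-∀
      expand : (b a k t : ℤ) → b * (a * k + t) ≡ a * (b * k) + t * (b * 1ℤ)
      expand = solve-∀
      H-recursion : ∀ N → H N (suc n) ≡ + q * H N n + ∑ (range N) (λ d → ∑ (range N) λ e → 𝟙 (d ℕ.* e ℕP.≟ suc n) * (B d * 𝟏 e))
      H-recursion N = begin
        ∑ R (λ d → ∑ R λ e → B d * multiples (suc n) (d ℕ.* e))
          ≡⟨ ∑-cong R (λ d → ∑-cong R λ e → trans (cong (B d *_) (multiples-suc n (d ℕ.* e)))
               (expand (B d) (+ q) (multiples n (d ℕ.* e)) (𝟙 (d ℕ.* e ℕP.≟ suc n)))) ⟩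
        ∑ R (λ d → ∑ R λ e → + q * (B d * multiples n (d ℕ.* e)) + 𝟙 (d ℕ.* e ℕP.≟ suc n) * (B d * 𝟏 e))
          ≡⟨ trans (∑-cong R λ d → ∑-+ R _ _) (∑-+ R _ _) ⟩
        ∑ R (λ d → ∑ R λ e → + q * (B d * multiples n (d ℕ.* e))) + T
          ≡⟨ cong (_+ T) (trans (∑-cong R λ d → ∑-*ˡ R (+ q) _) (∑-*ˡ R (+ q) _)) ⟩
        + q * H N n + T ∎
        where
        R = range N
        T = ∑ R λ d → ∑ R λ e → 𝟙 (d ℕ.* e ℕP.≟ suc n) * (B d * 𝟏 e)

-- Automorphisms of prime order

module PrimeOrderAutomorphisms where
  open import Data.Integer using (+_; _+_; _*_)
  open FiniteSums
  open FactorialMonoids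

  module _ {q : ℕ} (𝓜 : FactorialMonoid q) where
    open FactorialMonoid 𝓜

    record Automorphism : Set where
      field
        fun     : M → M
        inv     : M → M
        fun-·   : ∀ x y → fun (x · y) ≡ fun x · fun y
        fun-deg : ∀ x → deg (fun x) ≡ deg x
        inv-·   : ∀ x y → inv (x · y) ≡ inv x · inv y
        inv-deg : ∀ x → deg (inv x) ≡ deg x
        inv-fun : ∀ x → inv (fun x) ≡ x

      fun-injective : ∀ {x y} → fun x ≡ fun y → x ≡ y
      fun-injective {x} {y} eq = trans (sym (inv-fun x)) (trans (cong inv eq) (inv-fun y))

      fun-ε : fun ε ≡ ε
      fun-ε = deg≡0 (trans (fun-deg ε) deg-ε)

      fun-∣ : ∀ {x y} → x ∣ y → fun x ∣ fun y
      fun-∣ {x} (k , refl) = fun k , sym (fun-· x k)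

      fun-Irr : ∀ {x} → Irr x → Irr (fun x)
      fun-Irr {x} (x≢0 , split) = (λ eq → x≢0 (trans (sym (fun-deg x)) eq)) , split′
        where
        split′ : ∀ y z → y · z ≡ fun x → deg y ≡ 0 ⊎ deg z ≡ 0
        split′ y z eq with split (inv y) (inv z) (trans (sym (inv-· y z)) (trans (cong inv eq) (inv-fun x)))
        ... | inj₁ y≡0 = inj₁ (trans (sym (inv-deg y)) y≡0)
        ... | inj₂ z≡0 = inj₂ (trans (sym (inv-deg z)) z≡0)

      fun-∏ : ∀ n f → fun (∏ n f) ≡ ∏ n (fun ∘ f)
      fun-∏ zero    f = fun-ε
      fun-∏ (suc n) f = trans (fun-· (f n) (∏ n f)) (cong (fun (f n) ·_) (fun-∏ n f))

    open Automorphism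

    iterate : (M → M) → ℕ → M → M
    iterate f zero    x = x
    iterate f (suc i) x = f (iterate f i x)

    -- `fixed` is the D of the overview and `fixed₂` the D₂.
    fixed : (M → M) → ℕ → ℤ
    fixed τ n = ∑ (elements n) λ h → 𝟙 (Irr? h ×-dec (τ h ≟ h))

    fixed₂ : (M → M) → (M → M) → ℕ → ℤ
    fixed₂ τ σ n = ∑ (elements n) λ h → 𝟙 (Irr? h ×-dec (τ h ≟ h) ×-dec (σ h ≟ h))

    -- In the application τ is f(x) ↦ f(x + a) and ι is g(x) ↦ g(x^p − a^(p−1) x).

    record PrimeOrder (p : ℕ) : Set where
      field
        τ      : Automorphism
        prime  : Prime p
        period : ∀ x → iterate (fun τ) p x ≡ x
        ι      : M → M
        ι-·    : ∀ x y → ι (x · y) ≡ ι x · ι y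
        ι-injective : ∀ {x y} → ι x ≡ ι y → x ≡ y
        deg-ι  : ∀ x → deg (ι x) ≡ p ℕ.* deg x
        τ-ι    : ∀ x → fun τ (ι x) ≡ ι x
        descend : ∀ x → fun τ x ≡ x → ∃ λ y → ι y ≡ x

      iter : ℕ → M → M
      iter = iterate (fun τ)

      private
        instance
          p-nonZero : ℕ.NonZero p
          p-nonZero = prime⇒nonZero prime

        0<p : 0 < p
        0<p = ℕ.>-nonZero⁻¹ p

        1<p : 1 < p
        1<p = ℕ.nonTrivial⇒n>1 p {{prime⇒nonTrivial prime}}

      iter-+ : ∀ m n x → iter (m ℕ.+ n) x ≡ iter m (iter n x)
      iter-+ zero    n x = refl
      iter-+ (suc m) n x = cong (fun τ) (iter-+ m n x)

      iter-* : ∀ k n {x} → iter n x ≡ x → iter (k ℕ.* n) x ≡ x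
      iter-* zero    n eq = refl
      iter-* (suc k) n {x} eq = trans (iter-+ n (k ℕ.* n) x) (trans (cong (iter n) (iter-* k n eq)) eq)

      iter-fixed : ∀ i {x} → fun τ x ≡ x → iter i x ≡ x
      iter-fixed zero    eq = refl
      iter-fixed (suc i) eq = trans (cong (fun τ) (iter-fixed i eq)) eq

      iter-injective : ∀ i {x y} → iter i x ≡ iter i y → x ≡ y
      iter-injective zero    eq = eq
      iter-injective (suc i) eq = iter-injective i (fun-injective τ eq)

      iter-Irr : ∀ i {x} → Irr x → Irr (iter i x)
      iter-Irr zero    x-irr = x-irr
      iter-Irr (suc i) x-irr = fun-Irr τ (iter-Irr i x-irr)

      iter-deg : ∀ i x → deg (iter i x) ≡ deg x
      iter-deg zero    x = refl
      iter-deg (suc i) x = trans (fun-deg τ (iter i x)) (iter-deg i x)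

      iter-∣ : ∀ i {x y} → x ∣ y → iter i x ∣ iter i y
      iter-∣ zero    x∣y = x∣y
      iter-∣ (suc i) x∣y = fun-∣ τ (iter-∣ i x∣y)

      -- By Bézout some multiples of k and of p differ by 1, and both of these iterates fix x; hence
      -- one more application of τ fixes it too.
      iter-coprime-fixed : ∀ {k x} → 0 < k → k < p → iter k x ≡ x → fun τ x ≡ x
      iter-coprime-fixed {k} {x} 0<k k<p eq
        with coprime-Bézout (prime⇒coprime prime {{ℕ.>-nonZero 0<k}} k<p)
      ... | Bézout.+- a b 1+bk≡ap = trans (cong (fun τ) (sym (iter-* b k eq)))
                                     (trans (cong (λ n → iter n x) 1+bk≡ap) (iter-* a p (period x)))
      ... | Bézout.-+ a b 1+ap≡bk = trans (cong (fun τ) (sym (iter-* a p (period x))))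
                                     (trans (cong (λ n → iter n x) 1+ap≡bk) (iter-* b k eq))

      iter-distinct : ∀ {x i j} → fun τ x ≢ x → i < j → j < p → iter i x ≢ iter j x
      iter-distinct {x} {i} {j} moved i<j j<p eq = moved
        (iter-coprime-fixed (ℕP.m<n⇒0<n∸m i<j) (ℕP.≤-<-trans (ℕP.m∸n≤m j i) j<p)
          (sym (iter-injective i (trans eq (trans (cong (λ n → iter n x) (sym (ℕP.m+[n∸m]≡n (ℕP.<⇒≤ i<j)))) (iter-+ i (j ∸ i) x))))))

      -- In the application this is the norm from F_q(x) to F_q(L), the subfield fixed by the
      -- translation.
      norm : M → M
      norm h = ∏ p (λ i → iter i h)

      norm-invariant : ∀ h → fun τ (norm h) ≡ norm h
      norm-invariant h = ·-cancelˡ h (begin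
        h · fun τ (norm h)  ≡⟨ cong (h ·_) (fun-∏ τ p _) ⟩
        h · ∏ p (λ i → iter (suc i) h)  ≡⟨ ∏-suc p (λ i → iter i h) ⟩
        iter p h · norm h  ≡⟨ cong (_· norm h) (period h) ⟩
        h · norm h  ∎)
        where open ≡-Reasoning

      deg-norm : ∀ h → deg (norm h) ≡ p ℕ.* deg h
      deg-norm h = deg-∏ p _ (deg h) (λ i → iter-deg i h)

      ∣-norm : ∀ h → h ∣ norm h
      ∣-norm h = ∣-∏ (λ i → iter i h) 0<p

      norm-τ : ∀ h → norm (fun τ h) ≡ norm h
      norm-τ h = begin
        ∏ p (λ i → iter i (fun τ h))  ≡⟨ ∏-cong p (λ i → trans (sym (iter-+ i 1 h)) (cong (λ n → iter n h) (ℕP.+-comm i 1))) ⟩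
        ∏ p (λ i → fun τ (iter i h))  ≡⟨ fun-∏ τ p _ ⟨
        fun τ (norm h)  ≡⟨ norm-invariant h ⟩
        norm h  ∎
        where open ≡-Reasoning

      norm-iter : ∀ i h → norm (iter i h) ≡ norm h
      norm-iter zero    h = refl
      norm-iter (suc i) h = trans (norm-τ (iter i h)) (norm-iter i h)

      norm-∣ : ∀ {h z} → Irr h → fun τ h ≢ h → fun τ z ≡ z → h ∣ z → norm h ∣ z
      norm-∣ {h} {z} h-irr moved z-fixed h∣z = ∏-∣ p _ z (λ i _ → iter-Irr i h-irr) (iter-distinct moved)
        (λ i _ → subst (iter i h ∣_) (iter-fixed i z-fixed) (iter-∣ i h∣z))

      norm≡⇒conjugate : ∀ {h h′} → Irr h → Irr h′ → norm h′ ≡ norm h → ∃ λ i → i < p × h′ ≡ iter i h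
      norm≡⇒conjugate {h} {h′} h-irr h′-irr eq
        with Irr-∣-∏ p _ h′-irr (subst (h′ ∣_) eq (∣-norm h′))
      ... | i , i<p , h′∣ = i , i<p , Irr-∣⇒≡ (proj₁ h′-irr) (iter-Irr i h-irr) h′∣

      -- The cofactor k of `ι x` in `ι y` is itself invariant, by cancelling `ι x` in the translated
      -- equation, and therefore descends.
      ι-∣⁻ : ∀ {x y} → ι x ∣ ι y → x ∣ y
      ι-∣⁻ {x} {y} (k , eq) with descend k (·-cancelˡ (ι x) (begin
        ι x · fun τ k  ≡⟨ cong (_· fun τ k) (τ-ι x) ⟨
        fun τ (ι x) · fun τ k  ≡⟨ fun-· τ (ι x) k ⟨
        fun τ (ι x · k)  ≡⟨ cong (fun τ) eq ⟩
        fun τ (ι y)  ≡⟨ τ-ι y ⟩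
        ι y  ≡⟨ eq ⟨
        ι x · k  ∎))
        where open ≡-Reasoning
      ... | l , refl = l , ι-injective (trans (ι-· x l) eq)

      deg-ι≡0 : ∀ {x} → deg (ι x) ≡ 0 → deg x ≡ 0
      deg-ι≡0 {x} eq = ℕP.*-cancelˡ-≡ (deg x) 0 p (trans (sym (deg-ι x)) (trans eq (sym (ℕP.*-zeroʳ p))))

      ι-Irr⁻ : ∀ {g} → Irr (ι g) → Irr g
      ι-Irr⁻ {g} (≢0 , split) = (λ eq → ≢0 (trans (deg-ι g) (trans (cong (p ℕ.*_) eq) (ℕP.*-zeroʳ p)))) , split′
        where
        split′ : ∀ y z → y · z ≡ g → deg y ≡ 0 ⊎ deg z ≡ 0
        split′ y z refl with split (ι y) (ι z) (sym (ι-· y z))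
        ... | inj₁ y≡0 = inj₁ (deg-ι≡0 y≡0)
        ... | inj₂ z≡0 = inj₂ (deg-ι≡0 z≡0)

      invariant-factor : ∀ {g h} → Irr g → Irr h → h ∣ ι g → fun τ h ≡ h → h ≡ ι g
      invariant-factor {g} {h} g-irr h-irr h∣ιg inv with descend h inv
      ... | g′ , refl = cong ι (Irr-∣⇒≡ (proj₁ (ι-Irr⁻ h-irr)) g-irr (ι-∣⁻ h∣ιg))

      norm-descends : ∀ h → ∃ λ g → ι g ≡ norm h × deg g ≡ deg h
      norm-descends h with descend (norm h) (norm-invariant h)
      ... | g , eq = g , eq , ℕP.*-cancelˡ-≡ (deg g) (deg h) p (trans (sym (deg-ι g)) (trans (cong deg eq) (deg-norm h)))

      -- The norm of h divides `ι g`, because the p distinct conjugates of h do, and it is `ι g′`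
      -- for some g′. So g′ divides the irreducible g, and the two coincide.
      moved-factor : ∀ {g h} → Irr g → Irr h → h ∣ ι g → fun τ h ≢ h → norm h ≡ ι g
      moved-factor {g} {h} g-irr h-irr h∣ιg moved with norm-descends h
      ... | g′ , eq , deg-eq = trans (sym eq) (cong ι (Irr-∣⇒≡ (λ ≡0 → proj₁ h-irr (trans (sym deg-eq) ≡0)) g-irr
              (ι-∣⁻ (subst (_∣ ι g) (sym eq) (norm-∣ h-irr moved (τ-ι g) h∣ιg)))))

      -- If g = y z, then h divides `ι y`, say. The whole norm, which is `ι y · ι z`, then divides
      -- `ι y`, and comparing degrees makes z trivial.
      norm⇒Irr : ∀ {g h} → Irr h → fun τ h ≢ h → norm h ≡ ι g → Irr g
      norm⇒Irr {g} {h} h-irr moved eq = (λ ≡0 → proj₁ h-irr (ℕP.*-cancelˡ-≡ (deg h) 0 p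
          (trans (sym (deg-norm h)) (trans (cong deg eq) (trans (deg-ι g) (cong (p ℕ.*_) ≡0)))))) , split
        where
        unit : ∀ y z → y · z ≡ g → h ∣ ι y → deg z ≡ 0
        unit y z refl h∣ιy = deg-ι≡0 (ℕP.n≤0⇒n≡0 (ℕP.+-cancelˡ-≤ (deg (ι y)) (deg (ι z)) 0 (begin
          deg (ι y) ℕ.+ deg (ι z)  ≡⟨ deg-· (ι y) (ι z) ⟨
          deg (ι y · ι z)  ≡⟨ cong deg (trans (sym (ι-· y z)) (sym eq)) ⟩
          deg (norm h)  ≤⟨ ∣⇒deg≤ (norm-∣ h-irr moved (τ-ι y) h∣ιy) ⟩
          deg (ι y)  ≡⟨ ℕP.+-identityʳ _ ⟨
          deg (ι y) ℕ.+ 0  ∎)))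
          where open ℕP.≤-Reasoning
        split : ∀ y z → y · z ≡ g → deg y ≡ 0 ⊎ deg z ≡ 0
        split y z yz≡g with euclid (ι y) (ι z) h-irr (subst (h ∣_) (trans eq (trans (cong ι (sym yz≡g)) (ι-· y z))) (∣-norm h))
        ... | inj₁ h∣ιy = inj₂ (unit y z yz≡g h∣ιy)
        ... | inj₂ h∣ιz = inj₁ (unit z y (trans (comm z y) yz≡g) h∣ιz)

      -- An irreducible `ι g` divisible by h equals h, although its degree would have to be p · deg
      -- h with p > 1.
      norm-reducible : ∀ {g h} → Irr (ι g) → Irr h → norm h ≢ ι g
      norm-reducible {g} {h} ιg-irr h-irr eq = ℕP.<⇒≢ 1<p (sym (ℕP.*-cancelʳ-≡ p 1 (deg h) {{ℕ.≢-nonZero (proj₁ h-irr)}} (begin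
        p ℕ.* deg h  ≡⟨ deg-norm h ⟨
        deg (norm h)  ≡⟨ cong deg eq ⟩
        deg (ι g)  ≡⟨ cong deg (Irr-∣⇒≡ (proj₁ h-irr) ιg-irr (subst (h ∣_) eq (∣-norm h))) ⟨
        deg h  ≡⟨ ℕP.*-identityˡ (deg h) ⟨
        1 ℕ.* deg h  ∎)))
        where open ≡-Reasoning

      Over : M → M → Set
      Over g h = Irr h × fun τ h ≢ h × norm h ≡ ι g

      over? : ∀ g h → Dec (Over g h)
      over? g h = Irr? h ×-dec ¬? (fun τ h ≟ h) ×-dec (norm h ≟ ι g)

      -- Above an irreducible g lies either one invariant irreducible, ι g, or an orbit of p conjugates.

      fibre : ∀ m g → g ∈ elements m →
              + p * 𝟙 (Irr? g) ≡ + p * 𝟙 (Irr? (ι g)) + ∑ (elements m) (λ h → 𝟙 (over? g h))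
      fibre m g g∈ with Irr? g
      ... | no ¬g-irr = sym (begin
        + p * 𝟙 (Irr? (ι g)) + ∑ (elements m) (λ h → 𝟙 (over? g h))
          ≡⟨ cong₂ (λ a b → + p * a + b) (𝟙-no (Irr? (ι g)) (¬g-irr ∘ ι-Irr⁻))
               (∑-vanish (elements m) λ h _ → 𝟙-no (over? g h) λ { (h-irr , moved , eq) → ¬g-irr (norm⇒Irr h-irr moved eq) }) ⟩
        + p * 0ℤ + 0ℤ ≡⟨ ℤP.+-identityʳ (+ p * 0ℤ) ⟩
        + p * 0ℤ ∎)
        where open ≡-Reasoning
      ... | yes g-irr with Irr? (ι g)
      ...   | yes ιg-irr = sym (trans
                (+-congʳ (+ p * 1ℤ) (∑-vanish (elements m) λ h _ → 𝟙-no (over? g h) λ { (h-irr , _ , eq) → norm-reducible ιg-irr h-irr eq }))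
                (ℤP.+-identityʳ (+ p * 1ℤ)))
      ...   | no ¬ιg-irr with irr-factor (ι g) (proj₁ g-irr ∘ deg-ι≡0)
      ...     | h , h-irr , h∣ιg with fun τ h ≟ h
      -- An invariant irreducible factor of `ι g` is `ι g` itself, which is reducible in this
      -- branch.
      ...       | yes inv = ⊥-elim (¬ιg-irr (subst Irr (invariant-factor g-irr h-irr h∣ιg inv) h-irr))
      ...       | no moved = sym (begin
        + p * 0ℤ + ∑ (elements m) (λ h → 𝟙 (over? g h))
          ≡⟨ +-congʳ (+ p * 0ℤ) (∑-𝟙-enumerate _≟_ (over? g) (elements-unique m) (applyUpTo⁺₁ (λ i → iter i h) p (iter-distinct moved)) to from) ⟩
        + p * 0ℤ + + length (applyUpTo (λ i → iter i h) p)
          ≡⟨ cong (λ n → + p * 0ℤ + + n) (ListP.length-applyUpTo (λ i → iter i h) p) ⟩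
        + p * 0ℤ + + p
          ≡⟨ regroup (+ p) ⟩
        + p * 1ℤ ∎)
        where
        open ≡-Reasoning
        regroup : (a : ℤ) → a * 0ℤ + a ≡ a * 1ℤ
        regroup = solve-∀
        norm≡ : norm h ≡ ι g
        norm≡ = moved-factor g-irr h-irr h∣ιg moved
        h-deg : deg h ≡ m
        h-deg = trans (ℕP.*-cancelˡ-≡ (deg h) (deg g) p (trans (sym (deg-norm h)) (trans (cong deg norm≡) (deg-ι g)))) (∈-elements⁻ g∈)
        to : ∀ x → x ∈ elements m → Over g x → x ∈ applyUpTo (λ i → iter i h) p
        to x _ (x-irr , _ , eq) with norm≡⇒conjugate h-irr x-irr (trans eq (sym norm≡))
        ... | i , i<p , refl = ∈-applyUpTo⁺ (λ i → iter i h) i<p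
        from : ∀ x → x ∈ applyUpTo (λ i → iter i h) p → x ∈ elements m × Over g x
        from x x∈ with ∈-applyUpTo⁻ (λ i → iter i h) x∈
        ... | i , i<p , refl = subst (λ n → iter i h ∈ elements n) (trans (iter-deg i h) h-deg) (∈-elements⁺ (iter i h))
            , iter-Irr i h-irr
            , (λ eq → moved (iter-injective i (trans (sym (iter-+ i 1 h)) (trans (cong (λ n → iter n h) (ℕP.+-comm i 1)) eq))))
            , trans (norm-iter i h) norm≡

      -- The three predicates are one condition read on g, on `ι g` and on the h above g. It is
      -- trivial in `fixed-recursion`; in `fixed₂-recursion` it is invariance of g under the induced
      -- `σ′`.
      module _ {Q Q′ Q″ : M → Set} (Q? : Decidable Q) (Q′? : Decidable Q′) (Q″? : Decidable Q″)
               (Q⇒Q′ : ∀ g → Q g → Q′ (ι g)) (Q′⇒Q : ∀ g → Q′ (ι g) → Q g)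
               (Q⇒Q″ : ∀ g h → Over g h → Q g → Q″ h) (Q″⇒Q : ∀ g h → Over g h → Q″ h → Q g) where

        private
          invariant-count : ∀ m →
            ∑ (elements (p ℕ.* m)) (λ h → 𝟙 (Irr? h ×-dec (fun τ h ≟ h) ×-dec Q′? h))
              ≡ ∑ (elements m) (λ g → 𝟙 (Q? g) * 𝟙 (Irr? (ι g)))
          invariant-count m = begin
            ∑ (elements (p ℕ.* m)) (λ h → 𝟙 (R? h))
              ≡⟨ ∑-𝟙-reindex _≟_ R? ι ι-injective (elements-unique (p ℕ.* m)) (elements-unique m) into onto ⟩
            ∑ (elements m) (λ g → 𝟙 (R? (ι g)))
              ≡⟨ ∑-cong (elements m) (λ g → trans
                   (𝟙-cong (R? (ι g)) (Q? g ×-dec Irr? (ι g))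
                     (λ { (i , _ , q′) → Q′⇒Q g q′ , i }) (λ { (q , i) → i , τ-ι g , Q⇒Q′ g q }))
                   (𝟙-× (Q? g) (Irr? (ι g)))) ⟩
            ∑ (elements m) (λ g → 𝟙 (Q? g) * 𝟙 (Irr? (ι g))) ∎
            where
            open ≡-Reasoning
            R? : Decidable (λ h → Irr h × fun τ h ≡ h × Q′ h)
            R? h = Irr? h ×-dec (fun τ h ≟ h) ×-dec Q′? h
            into : ∀ g → g ∈ elements m → ι g ∈ elements (p ℕ.* m)
            into g g∈ = subst (λ n → ι g ∈ elements n) (trans (deg-ι g) (cong (p ℕ.*_) (∈-elements⁻ g∈))) (∈-elements⁺ (ι g))
            onto : ∀ h → h ∈ elements (p ℕ.* m) → Irr h × fun τ h ≡ h × Q′ h → ∃ λ g → g ∈ elements m × ι g ≡ h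
            onto h h∈ (_ , inv , _) with descend h inv
            ... | g , refl = g , subst (λ n → g ∈ elements n)
                  (ℕP.*-cancelˡ-≡ (deg g) m p (trans (sym (deg-ι g)) (∈-elements⁻ h∈))) (∈-elements⁺ g) , refl

          -- Every moved irreducible h lies above exactly one g: its norm is invariant, hence
          -- descends, and the resulting g has the degree of h.
          moved-count : ∀ m →
            ∑ (elements m) (λ h → 𝟙 (Irr? h ×-dec ¬? (fun τ h ≟ h) ×-dec Q″? h))
              ≡ ∑ (elements m) (λ g → 𝟙 (Q? g) * ∑ (elements m) λ h → 𝟙 (over? g h))
          moved-count m = sym (begin
            ∑ (elements m) (λ g → 𝟙 (Q? g) * ∑ (elements m) λ h → 𝟙 (over? g h))
              ≡⟨ ∑-cong (elements m) (λ g → trans (sym (∑-*ˡ (elements m) (𝟙 (Q? g)) _))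
                   (∑-cong (elements m) λ h → sym (𝟙-× (Q? g) (over? g h)))) ⟩
            ∑ (elements m) (λ g → ∑ (elements m) λ h → 𝟙 (Q? g ×-dec over? g h))
              ≡⟨ ∑-swap (elements m) (elements m) _ ⟩
            ∑ (elements m) (λ h → ∑ (elements m) λ g → 𝟙 (Q? g ×-dec over? g h))
              ≡⟨ ∑-cong-∈ (elements m) inner ⟩
            ∑ (elements m) (λ h → 𝟙 (R? h)) ∎)
            where
            open ≡-Reasoning
            R? : Decidable (λ h → Irr h × fun τ h ≢ h × Q″ h)
            R? h = Irr? h ×-dec ¬? (fun τ h ≟ h) ×-dec Q″? h
            inner : ∀ h → h ∈ elements m → ∑ (elements m) (λ g → 𝟙 (Q? g ×-dec over? g h)) ≡ 𝟙 (R? h)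
            inner h h∈ = helper (R? h)
              where
              helper : (R?h : Dec (Irr h × fun τ h ≢ h × Q″ h)) →
                       ∑ (elements m) (λ g → 𝟙 (Q? g ×-dec over? g h)) ≡ 𝟙 R?h
              helper (no ¬R) = ∑-vanish (elements m) λ g _ → 𝟙-no (Q? g ×-dec over? g h)
                λ { (q , o@(i , mv , _)) → ¬R (i , mv , Q⇒Q″ g h o q) }
              helper (yes (i , mv , q″)) with norm-descends h
              ... | g , eq , deg-eq = ∑-𝟙-single _≟_ (λ g → Q? g ×-dec over? g h) g (elements-unique m)
                (subst (λ n → g ∈ elements n) (trans deg-eq (∈-elements⁻ h∈)) (∈-elements⁺ g))
                (Q″⇒Q g h (i , mv , sym eq) q″ , i , mv , sym eq)
                (λ { g′ _ (_ , _ , _ , eq′) → ι-injective (trans (sym eq′) (sym eq)) })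

        fibre-count : ∀ m →
          + p * ∑ (elements m) (λ g → 𝟙 (Q? g) * 𝟙 (Irr? g))
            ≡ + p * ∑ (elements (p ℕ.* m)) (λ h → 𝟙 (Irr? h ×-dec (fun τ h ≟ h) ×-dec Q′? h))
              + ∑ (elements m) (λ h → 𝟙 (Irr? h ×-dec ¬? (fun τ h ≟ h) ×-dec Q″? h))
        fibre-count m = begin
          + p * ∑ E (λ g → 𝟙 (Q? g) * 𝟙 (Irr? g))
            ≡⟨ ∑-*ˡ E (+ p) _ ⟨
          ∑ E (λ g → + p * (𝟙 (Q? g) * 𝟙 (Irr? g)))
            ≡⟨ ∑-cong-∈ E (λ g g∈ → trans (swap (+ p) (𝟙 (Q? g)) (𝟙 (Irr? g))) (trans (cong (𝟙 (Q? g) *_) (fibre m g g∈))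
                 (distribute (𝟙 (Q? g)) (+ p) (𝟙 (Irr? (ι g))) _))) ⟩
          ∑ E (λ g → + p * (𝟙 (Q? g) * 𝟙 (Irr? (ι g))) + 𝟙 (Q? g) * ∑ E (λ h → 𝟙 (over? g h)))
            ≡⟨ ∑-+ E _ _ ⟩
          ∑ E (λ g → + p * (𝟙 (Q? g) * 𝟙 (Irr? (ι g)))) + ∑ E (λ g → 𝟙 (Q? g) * ∑ E (λ h → 𝟙 (over? g h)))
            ≡⟨ cong₂ _+_ (trans (∑-*ˡ E (+ p) _) (cong (+ p *_) (sym (invariant-count m)))) (sym (moved-count m)) ⟩
          _ ∎
          where
          open ≡-Reasoning
          E = elements m
          swap : (a b c : ℤ) → a * (b * c) ≡ b * (a * c)
          swap = solve-∀
          distribute : (a b c d : ℤ) → a * (b * c + d) ≡ b * (a * c) + a * d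
          distribute = solve-∀

      -- The h above all g of degree m together are the irreducibles of degree m moved by τ. Adding
      -- the fixed ones to both sides completes them to all irreducibles.
      fixed-recursion : ∀ m → + p * I m + fixed (fun τ) m ≡ + p * fixed (fun τ) (p ℕ.* m) + I m
      fixed-recursion m = begin
        + p * I m + D
          ≡⟨ cong (λ z → + p * z + D) (∑-cong E λ g → sym (ℤP.*-identityˡ (𝟙 (Irr? g)))) ⟩
        + p * ∑ E (λ g → 𝟙 (yes tt) * 𝟙 (Irr? g)) + D
          ≡⟨ cong (_+ D) (fibre-count (λ _ → yes tt) (λ _ → yes tt) (λ _ → yes tt) (λ _ _ → tt) (λ _ _ → tt) (λ _ _ _ _ → tt) (λ _ _ _ _ → tt) m) ⟩
        + p * ∑ E′ (λ h → 𝟙 (Irr? h ×-dec (fun τ h ≟ h) ×-dec yes tt)) + X + D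
          ≡⟨ cong (λ z → + p * z + X + D) (∑-cong E′ λ h → 𝟙-cong (Irr? h ×-dec (fun τ h ≟ h) ×-dec yes tt) (Irr? h ×-dec (fun τ h ≟ h))
               (λ { (a , b , _) → a , b }) (λ { (a , b) → a , b , tt })) ⟩
        + p * D′ + X + D
          ≡⟨ ℤP.+-assoc (+ p * D′) X D ⟩
        + p * D′ + (X + D)
          ≡⟨ +-congʳ (+ p * D′) (trans (sym (∑-+ E _ _)) (∑-cong E split)) ⟩
        + p * D′ + I m ∎
        where
        open ≡-Reasoning
        E = elements m
        E′ = elements (p ℕ.* m)
        D = fixed (fun τ) m
        D′ = fixed (fun τ) (p ℕ.* m)
        X = ∑ E (λ h → 𝟙 (Irr? h ×-dec ¬? (fun τ h ≟ h) ×-dec yes tt))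
        split : ∀ h → 𝟙 (Irr? h ×-dec ¬? (fun τ h ≟ h) ×-dec yes tt) + 𝟙 (Irr? h ×-dec (fun τ h ≟ h)) ≡ 𝟙 (Irr? h)
        split h with Irr? h | fun τ h ≟ h
        ... | yes _ | yes _ = refl
        ... | yes _ | no _  = refl
        ... | no _  | yes _ = refl
        ... | no _  | no _  = refl

      -- A second automorphism commuting with the first

      module _ (σ : Automorphism) (στ : ∀ x → fun σ (fun τ x) ≡ fun τ (fun σ x))
               (σ′ : M → M) (σι : ∀ x → fun σ (ι x) ≡ ι (σ′ x)) where

        private
          σ-iter : ∀ i x → fun σ (iter i x) ≡ iter i (fun σ x)
          σ-iter zero    x = refl
          σ-iter (suc i) x = trans (στ (iter i x)) (cong (fun τ) (σ-iter i x))

          σ-norm : ∀ h → fun σ (norm h) ≡ norm (fun σ h)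
          σ-norm h = trans (fun-∏ σ p _) (∏-cong p λ i → σ-iter i h)

          -- What invariance of g under `σ′` becomes on an h above g: σ permutes the τ-orbit of h
          -- and need not fix h.
          Conjugate : M → Set
          Conjugate h = Any (λ i → fun σ h ≡ iter i h) (upTo p)

          conjugate? : Decidable Conjugate
          conjugate? h = any? (λ i → fun σ h ≟ iter i h) (upTo p)

          fixed⇒conjugate : ∀ g h → Over g h → σ′ g ≡ g → Conjugate h
          fixed⇒conjugate g h (h-irr , _ , eq) fix
            with norm≡⇒conjugate h-irr (fun-Irr σ h-irr) (trans (sym (σ-norm h)) (trans (cong (fun σ) eq) (trans (σι g) (trans (cong ι fix) (sym eq)))))
          ... | i , i<p , σh≡ = lose (∈-upTo⁺ i<p) σh≡

          conjugate⇒fixed : ∀ g h → Over g h → Conjugate h → σ′ g ≡ g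
          conjugate⇒fixed g h (_ , _ , eq) conj with satisfied conj
          ... | i , σh≡ = ι-injective (begin
            ι (σ′ g)  ≡⟨ σι g ⟨
            fun σ (ι g)  ≡⟨ cong (fun σ) eq ⟨
            fun σ (norm h)  ≡⟨ σ-norm h ⟩
            norm (fun σ h)  ≡⟨ cong norm σh≡ ⟩
            norm (iter i h)  ≡⟨ norm-iter i h ⟩
            norm h  ≡⟨ eq ⟩
            ι g  ∎)
            where open ≡-Reasoning

        -- For a moved h with σ h in its orbit, the index i with σ h = τ^i h is unique, so these h
        -- can be counted index by index. The summand p · `fixed₂` on the left supplies the τ-fixed
        -- h, which turns the count for each i into one of all irreducibles with σ h = τ^i h.
        fixed₂-recursion : ∀ m →
          + p * fixed σ′ m + + p * fixed₂ (fun τ) (fun σ) m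
            ≡ + p * fixed₂ (fun τ) (fun σ) (p ℕ.* m)
              + ∑ (upTo p) (λ i → ∑ (elements m) λ h → 𝟙 (Irr? h ×-dec (fun σ h ≟ iter i h)))
        fixed₂-recursion m = begin
          + p * fixed σ′ m + + p * D₂
            ≡⟨ cong (λ z → + p * z + + p * D₂) (∑-cong E λ g → trans (𝟙-× (Irr? g) (σ′ g ≟ g)) (ℤP.*-comm (𝟙 (Irr? g)) (𝟙 (σ′ g ≟ g)))) ⟩
          + p * ∑ E (λ g → 𝟙 (σ′ g ≟ g) * 𝟙 (Irr? g)) + + p * D₂
            ≡⟨ cong (_+ + p * D₂) (fibre-count (λ g → σ′ g ≟ g) (λ h → fun σ h ≟ h) conjugate?
                 (λ g fix → trans (σι g) (cong ι fix)) (λ g fix → ι-injective (trans (sym (σι g)) fix))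
                 fixed⇒conjugate conjugate⇒fixed m) ⟩
          + p * D₂′ + ∑ E (λ h → 𝟙 (Irr? h ×-dec ¬? (fun τ h ≟ h) ×-dec conjugate? h)) + + p * D₂
            ≡⟨ cong₂ (λ a b → + p * D₂′ + a + b) (trans (∑-cong E conj) (∑-swap E (upTo p) _)) constant ⟩
          + p * D₂′ + ∑ (upTo p) (λ i → ∑ E λ h → 𝟙 (moved? i h)) + ∑ (upTo p) (λ _ → D₂)
            ≡⟨ ℤP.+-assoc (+ p * D₂′) (∑ (upTo p) (λ i → ∑ E λ h → 𝟙 (moved? i h))) (∑ (upTo p) (λ _ → D₂)) ⟩
          + p * D₂′ + (∑ (upTo p) (λ i → ∑ E λ h → 𝟙 (moved? i h)) + ∑ (upTo p) (λ _ → D₂))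
            ≡⟨ +-congʳ (+ p * D₂′) (trans (sym (∑-+ (upTo p) _ _)) (∑-cong (upTo p) λ i → trans (sym (∑-+ E _ _)) (∑-cong E (split i)))) ⟩
          + p * D₂′ + ∑ (upTo p) (λ i → ∑ E λ h → 𝟙 (Irr? h ×-dec (fun σ h ≟ iter i h))) ∎
          where
          open ≡-Reasoning
          E = elements m
          D₂ = fixed₂ (fun τ) (fun σ) m
          D₂′ = fixed₂ (fun τ) (fun σ) (p ℕ.* m)
          moved? : ∀ i h → Dec (Irr h × fun τ h ≢ h × fun σ h ≡ iter i h)
          moved? i h = Irr? h ×-dec ¬? (fun τ h ≟ h) ×-dec (fun σ h ≟ iter i h)
          constant : + p * D₂ ≡ ∑ (upTo p) (λ _ → D₂)
          constant = sym (trans (∑-const (upTo p) D₂) (cong (λ n → + n * D₂) (ListP.length-upTo p)))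
          conj : ∀ h → 𝟙 (Irr? h ×-dec ¬? (fun τ h ≟ h) ×-dec conjugate? h) ≡ ∑ (upTo p) (λ i → 𝟙 (moved? i h))
          conj h = helper (Irr? h ×-dec ¬? (fun τ h ≟ h) ×-dec conjugate? h)
            where
            unique-index : ∀ {i j} → fun τ h ≢ h → i < p → j < p → iter i h ≡ iter j h → i ≡ j
            unique-index {i} {j} mv i<p j<p eq with ℕP.<-cmp i j
            ... | tri< i<j _ _ = ⊥-elim (iter-distinct mv i<j j<p eq)
            ... | tri≈ _ i≡j _ = i≡j
            ... | tri> _ _ j<i = ⊥-elim (iter-distinct mv j<i i<p (sym eq))
            helper : (d : Dec (Irr h × fun τ h ≢ h × Conjugate h)) → 𝟙 d ≡ ∑ (upTo p) (λ i → 𝟙 (moved? i h))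
            helper (no ¬c) = sym (∑-vanish (upTo p) λ i i∈ → 𝟙-no (moved? i h) λ { (a , b , c) → ¬c (a , b , lose i∈ c) })
            helper (yes (a , b , c)) with find c
            ... | i , i∈ , eq = sym (∑-𝟙-single ℕP._≟_ (λ i → moved? i h) i (upTo⁺ p) i∈ (a , b , eq)
              (λ { j j∈ (_ , _ , eq′) → unique-index b (∈-upTo⁻ j∈) (∈-upTo⁻ i∈) (trans (sym eq′) eq) }))
          split : ∀ i h → 𝟙 (moved? i h) + 𝟙 (Irr? h ×-dec (fun τ h ≟ h) ×-dec (fun σ h ≟ h)) ≡ 𝟙 (Irr? h ×-dec (fun σ h ≟ iter i h))
          split i h with Irr? h | fun τ h ≟ h
          ... | no _  | yes _   = refl
          ... | no _  | no _    = refl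
          ... | yes _ | no _    = ℤP.+-identityʳ (𝟙 (yes tt ×-dec (fun σ h ≟ iter i h)))
          -- For a τ-fixed h every `iter i h` is h, so it occurs for all p indices as soon as σ
          -- fixes it.
          ... | yes _ | yes inv = trans (ℤP.+-identityˡ (𝟙 (yes tt ×-dec (fun σ h ≟ h))))
                (𝟙-cong (yes tt ×-dec (fun σ h ≟ h)) (yes tt ×-dec (fun σ h ≟ iter i h))
                  (λ { (_ , eq) → tt , trans eq (sym (iter-fixed i inv)) }) (λ { (_ , eq) → tt , trans eq (iter-fixed i inv) }))

-- Polynomials

open FiniteSums
open DirichletConvolution
open FactorialMonoids
open PrimeOrderAutomorphisms

module PolynomialRing {q : ℕ} (F : FiniteField q) where
  open FiniteField F public
    renaming (_+_ to infixl 6 _+_; _*_ to infixl 7 _*_; -_ to infix 8 -_)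
  open Poly F public hiding (monic; C)
    renaming (_+ₚ_ to infixl 6 _+ₚ_; _*ₚ_ to infixl 7 _*ₚ_)

  scalarRing : CommutativeRing 0ℓ 0ℓ
  scalarRing = record { isCommutativeRing = isCommutativeRing }

  open IsCommutativeRing isCommutativeRing public
    using (+-assoc; +-comm; +-identityˡ; +-identityʳ; *-assoc; *-comm; *-identityˡ; *-identityʳ; distribˡ; distribʳ; zeroˡ; zeroʳ; -‿inverseˡ; -‿inverseʳ)
  module Scalar = RingProperties (CommutativeRing.ring scalarRing)

  -- ≈ₚ unfolds to a Π-type from which f and g cannot be inferred; the record keeps them.

  infix 4 _≋_
  record _≋_ (f g : Pol) : Set where
    constructor mk
    field at : f ≈ₚ g
  open _≋_ public

  ≋-refl : ∀ {f} → f ≋ f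
  ≋-refl = mk λ _ → refl

  ≋-sym : ∀ {f g} → f ≋ g → g ≋ f
  ≋-sym (mk eq) = mk λ i → sym (eq i)

  ≋-trans : ∀ {f g h} → f ≋ g → g ≋ h → f ≋ h
  ≋-trans (mk eq) (mk eq′) = mk λ i → trans (eq i) (eq′ i)

  ≋-isEquivalence : IsEquivalence _≋_
  ≋-isEquivalence = record { refl = ≋-refl ; sym = ≋-sym ; trans = ≋-trans }

  ≋-setoid : Setoid 0ℓ 0ℓ
  ≋-setoid = record { isEquivalence = ≋-isEquivalence }

  module ≋-Reasoning = SetoidReasoning ≋-setoid

  ≡⇒≋ : ∀ {f g} → f ≡ g → f ≋ g
  ≡⇒≋ refl = ≋-refl

  scale : Fin q → Pol → Pol
  scale c f = map (c *_) f

  negate : Pol → Pol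
  negate f = map -_ f

  coeff-+ : ∀ f g i → coeff (f +ₚ g) i ≡ coeff f i + coeff g i
  coeff-+ []      g       i       = sym (+-identityˡ _)
  coeff-+ (a ∷ f) []      i       = sym (+-identityʳ _)
  coeff-+ (a ∷ f) (b ∷ g) zero    = refl
  coeff-+ (a ∷ f) (b ∷ g) (suc i) = coeff-+ f g i

  coeff-scale : ∀ c f i → coeff (scale c f) i ≡ c * coeff f i
  coeff-scale c []      i       = sym (zeroʳ c)
  coeff-scale c (a ∷ f) zero    = refl
  coeff-scale c (a ∷ f) (suc i) = coeff-scale c f i

  coeff-negate : ∀ f i → coeff (negate f) i ≡ - coeff f i
  coeff-negate []      i       = sym Scalar.-0#≈0#
  coeff-negate (a ∷ f) zero    = refl
  coeff-negate (a ∷ f) (suc i) = coeff-negate f i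

  +ₚ-cong : ∀ {f f′ g g′} → f ≋ f′ → g ≋ g′ → f +ₚ g ≋ f′ +ₚ g′
  +ₚ-cong {f} {f′} {g} {g′} (mk p) (mk r) = mk λ i →
    trans (coeff-+ f g i) (trans (cong₂ _+_ (p i) (r i)) (sym (coeff-+ f′ g′ i)))

  +ₚ-assoc : ∀ f g h → (f +ₚ g) +ₚ h ≋ f +ₚ (g +ₚ h)
  +ₚ-assoc f g h = mk λ i → begin
    coeff ((f +ₚ g) +ₚ h) i  ≡⟨ trans (coeff-+ (f +ₚ g) h i) (cong (_+ coeff h i) (coeff-+ f g i)) ⟩
    (coeff f i + coeff g i) + coeff h i  ≡⟨ +-assoc _ _ _ ⟩
    coeff f i + (coeff g i + coeff h i)  ≡⟨ trans (coeff-+ f (g +ₚ h) i) (cong (coeff f i +_) (coeff-+ g h i)) ⟨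
    coeff (f +ₚ (g +ₚ h)) i  ∎
    where open ≡-Reasoning

  +ₚ-comm : ∀ f g → f +ₚ g ≋ g +ₚ f
  +ₚ-comm f g = mk λ i → trans (coeff-+ f g i) (trans (+-comm _ _) (sym (coeff-+ g f i)))

  +ₚ-identityʳ : ∀ f → f +ₚ [] ≋ f
  +ₚ-identityʳ f = mk λ i → trans (coeff-+ f [] i) (+-identityʳ _)

  negate-cong : ∀ {f g} → f ≋ g → negate f ≋ negate g
  negate-cong {f} {g} (mk p) = mk λ i → trans (coeff-negate f i) (trans (cong -_ (p i)) (sym (coeff-negate g i)))

  +ₚ-inverseʳ : ∀ f → f +ₚ negate f ≋ []
  +ₚ-inverseʳ f = mk λ i → trans (coeff-+ f (negate f) i) (trans (cong (coeff f i +_) (coeff-negate f i)) (-‿inverseʳ _))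

  +ₚ-commutativeMonoid : CommutativeMonoid 0ℓ 0ℓ
  +ₚ-commutativeMonoid = record
    { Carrier = Pol ; _≈_ = _≋_ ; _∙_ = _+ₚ_ ; ε = []
    ; isCommutativeMonoid = record
      { isMonoid = record
        { isSemigroup = record
          { isMagma = record { isEquivalence = ≋-isEquivalence ; ∙-cong = +ₚ-cong }
          ; assoc = +ₚ-assoc }
        ; identity = (λ _ → ≋-refl) , +ₚ-identityʳ }
      ; comm = +ₚ-comm } }

  open CommutativeSemigroupProperties (CommutativeMonoid.commutativeSemigroup +ₚ-commutativeMonoid)
    using () renaming (interchange to +ₚ-medial; x∙yz≈y∙xz to +ₚ-swap)

  ∷-cong : ∀ {a b f g} → a ≡ b → f ≋ g → a ∷ f ≋ b ∷ g
  ∷-cong p (mk r) = mk λ { zero → p ; (suc i) → r i }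

  ∷-≋[] : ∀ {a f} → a ≡ 0# → f ≋ [] → a ∷ f ≋ []
  ∷-≋[] p (mk r) = mk λ { zero → p ; (suc i) → r i }

  scale-cong : ∀ {c d f g} → c ≡ d → f ≋ g → scale c f ≋ scale d g
  scale-cong {c} {f = f} {g} refl (mk p) = mk λ i →
    trans (coeff-scale c f i) (trans (cong (c *_) (p i)) (sym (coeff-scale c g i)))

  scale-+ : ∀ c f g → scale c (f +ₚ g) ≋ scale c f +ₚ scale c g
  scale-+ c f g = mk λ i → begin
    coeff (scale c (f +ₚ g)) i  ≡⟨ trans (coeff-scale c (f +ₚ g) i) (cong (c *_) (coeff-+ f g i)) ⟩
    c * (coeff f i + coeff g i)  ≡⟨ distribˡ c _ _ ⟩
    c * coeff f i + c * coeff g i  ≡⟨ cong₂ _+_ (coeff-scale c f i) (coeff-scale c g i) ⟨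
    coeff (scale c f) i + coeff (scale c g) i ≡⟨ coeff-+ (scale c f) (scale c g) i ⟨
    coeff (scale c f +ₚ scale c g) i  ∎
    where open ≡-Reasoning

  scale-+ˡ : ∀ c d f → scale (c + d) f ≋ scale c f +ₚ scale d f
  scale-+ˡ c d f = mk λ i → begin
    coeff (scale (c + d) f) i  ≡⟨ coeff-scale (c + d) f i ⟩
    (c + d) * coeff f i  ≡⟨ distribʳ _ c d ⟩
    c * coeff f i + d * coeff f i  ≡⟨ cong₂ _+_ (coeff-scale c f i) (coeff-scale d f i) ⟨
    coeff (scale c f) i + coeff (scale d f) i ≡⟨ coeff-+ (scale c f) (scale d f) i ⟨
    coeff (scale c f +ₚ scale d f) i  ∎
    where open ≡-Reasoning

  scale-scale : ∀ c d f → scale c (scale d f) ≋ scale (c * d) f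
  scale-scale c d f = mk λ i → begin
    coeff (scale c (scale d f)) i  ≡⟨ trans (coeff-scale c (scale d f) i) (cong (c *_) (coeff-scale d f i)) ⟩
    c * (d * coeff f i)  ≡⟨ *-assoc c d _ ⟨
    (c * d) * coeff f i  ≡⟨ coeff-scale (c * d) f i ⟨
    coeff (scale (c * d) f) i  ∎
    where open ≡-Reasoning

  scale-0 : ∀ f → scale 0# f ≋ []
  scale-0 f = mk λ i → trans (coeff-scale 0# f i) (zeroˡ _)

  scale-1 : ∀ f → scale 1# f ≋ f
  scale-1 f = mk λ i → trans (coeff-scale 1# f i) (*-identityˡ _)

  scale-∷0 : ∀ c f → scale c (0# ∷ f) ≋ 0# ∷ scale c f
  scale-∷0 c f = ∷-cong (zeroʳ c) ≋-refl

  *ₚ-zeroʳ : ∀ f → f *ₚ [] ≋ []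
  *ₚ-zeroʳ []      = ≋-refl
  *ₚ-zeroʳ (a ∷ f) = ∷-≋[] refl (*ₚ-zeroʳ f)

  *ₚ-congʳ : ∀ f {g g′} → g ≋ g′ → f *ₚ g ≋ f *ₚ g′
  *ₚ-congʳ []      p = ≋-refl
  *ₚ-congʳ (a ∷ f) p = +ₚ-cong (scale-cong refl p) (∷-cong refl (*ₚ-congʳ f p))

  *ₚ-∷ʳ : ∀ f b g → f *ₚ (b ∷ g) ≋ scale b f +ₚ (0# ∷ (f *ₚ g))
  *ₚ-∷ʳ []      b g = ≋-sym (∷-≋[] refl ≋-refl)
  *ₚ-∷ʳ (a ∷ f) b g = ∷-cong (cong (_+ 0#) (*-comm a b)) (begin
    scale a g +ₚ (f *ₚ (b ∷ g))  ≈⟨ +ₚ-cong ≋-refl (*ₚ-∷ʳ f b g) ⟩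
    scale a g +ₚ (scale b f +ₚ (0# ∷ (f *ₚ g)))  ≈⟨ +ₚ-swap (scale a g) (scale b f) (0# ∷ (f *ₚ g)) ⟩
    scale b f +ₚ (scale a g +ₚ (0# ∷ (f *ₚ g)))  ∎)
    where open ≋-Reasoning

  *ₚ-comm : ∀ f g → f *ₚ g ≋ g *ₚ f
  *ₚ-comm []      g = ≋-sym (*ₚ-zeroʳ g)
  *ₚ-comm (a ∷ f) g = ≋-trans (+ₚ-cong ≋-refl (∷-cong refl (*ₚ-comm f g))) (≋-sym (*ₚ-∷ʳ g a f))

  *ₚ-cong : ∀ {f f′ g g′} → f ≋ f′ → g ≋ g′ → f *ₚ g ≋ f′ *ₚ g′
  *ₚ-cong {f} {f′} {g} {g′} p r = begin
    f *ₚ g  ≈⟨ *ₚ-congʳ f r ⟩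
    f *ₚ g′  ≈⟨ *ₚ-comm f g′ ⟩
    g′ *ₚ f  ≈⟨ *ₚ-congʳ g′ p ⟩
    g′ *ₚ f′  ≈⟨ *ₚ-comm g′ f′ ⟩
    f′ *ₚ g′  ∎
    where open ≋-Reasoning

  *ₚ-distribʳ : ∀ h f g → (f +ₚ g) *ₚ h ≋ (f *ₚ h) +ₚ (g *ₚ h)
  *ₚ-distribʳ h []      g       = ≋-refl
  *ₚ-distribʳ h (a ∷ f) []      = ≋-sym (+ₚ-identityʳ _)
  *ₚ-distribʳ h (a ∷ f) (b ∷ g) = begin
    scale (a + b) h +ₚ (0# ∷ ((f +ₚ g) *ₚ h))
      ≈⟨ +ₚ-cong (scale-+ˡ a b h) (∷-cong (sym (+-identityʳ 0#)) (*ₚ-distribʳ h f g)) ⟩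
    (scale a h +ₚ scale b h) +ₚ ((0# ∷ (f *ₚ h)) +ₚ (0# ∷ (g *ₚ h)))
      ≈⟨ +ₚ-medial (scale a h) (scale b h) _ _ ⟩
    (scale a h +ₚ (0# ∷ (f *ₚ h))) +ₚ (scale b h +ₚ (0# ∷ (g *ₚ h))) ∎
    where open ≋-Reasoning

  *ₚ-distribˡ : ∀ h f g → h *ₚ (f +ₚ g) ≋ (h *ₚ f) +ₚ (h *ₚ g)
  *ₚ-distribˡ h f g = ≋-trans (*ₚ-comm h (f +ₚ g)) (≋-trans (*ₚ-distribʳ h f g) (+ₚ-cong (*ₚ-comm f h) (*ₚ-comm g h)))

  scale-*ₚ : ∀ c f g → scale c f *ₚ g ≋ scale c (f *ₚ g)
  scale-*ₚ c []      g = ≋-refl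
  scale-*ₚ c (a ∷ f) g = begin
    scale (c * a) g +ₚ (0# ∷ (scale c f *ₚ g))  ≈⟨ +ₚ-cong (scale-scale c a g) (≋-trans (scale-∷0 c (f *ₚ g)) (∷-cong refl (≋-sym (scale-*ₚ c f g)))) ⟨
    scale c (scale a g) +ₚ scale c (0# ∷ (f *ₚ g))  ≈⟨ scale-+ c (scale a g) (0# ∷ (f *ₚ g)) ⟨
    scale c (scale a g +ₚ (0# ∷ (f *ₚ g)))  ∎
    where open ≋-Reasoning

  *ₚ-scale : ∀ c f g → f *ₚ scale c g ≋ scale c (f *ₚ g)
  *ₚ-scale c f g = ≋-trans (*ₚ-comm f (scale c g)) (≋-trans (scale-*ₚ c g f) (scale-cong refl (*ₚ-comm g f)))

  ∷0-*ₚ : ∀ f g → (0# ∷ f) *ₚ g ≋ 0# ∷ (f *ₚ g)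
  ∷0-*ₚ f g = +ₚ-cong (scale-0 g) ≋-refl

  *ₚ-assoc : ∀ f g h → (f *ₚ g) *ₚ h ≋ f *ₚ (g *ₚ h)
  *ₚ-assoc []      g h = ≋-refl
  *ₚ-assoc (a ∷ f) g h = begin
    (scale a g +ₚ (0# ∷ (f *ₚ g))) *ₚ h  ≈⟨ *ₚ-distribʳ h (scale a g) (0# ∷ (f *ₚ g)) ⟩
    (scale a g *ₚ h) +ₚ ((0# ∷ (f *ₚ g)) *ₚ h)  ≈⟨ +ₚ-cong (scale-*ₚ a g h) (∷0-*ₚ (f *ₚ g) h) ⟩
    scale a (g *ₚ h) +ₚ (0# ∷ ((f *ₚ g) *ₚ h))  ≈⟨ +ₚ-cong ≋-refl (∷-cong refl (*ₚ-assoc f g h)) ⟩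
    scale a (g *ₚ h) +ₚ (0# ∷ (f *ₚ (g *ₚ h)))  ∎
    where open ≋-Reasoning

  constant-*ₚ : ∀ a g → (a ∷ []) *ₚ g ≋ scale a g
  constant-*ₚ a g = ≋-trans (+ₚ-cong ≋-refl (∷-≋[] refl ≋-refl)) (+ₚ-identityʳ (scale a g))

  *ₚ-identityˡ : ∀ g → one *ₚ g ≋ g
  *ₚ-identityˡ g = ≋-trans (constant-*ₚ 1# g) (scale-1 g)

  polRing : CommutativeRing 0ℓ 0ℓ
  polRing = record
    { Carrier = Pol ; _≈_ = _≋_ ; _+_ = _+ₚ_ ; _*_ = _*ₚ_ ; -_ = negate ; 0# = [] ; 1# = one
    ; isCommutativeRing = record
      { isRing = record
        { +-isAbelianGroup = record
          { isGroup = record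
            { isMonoid = CommutativeMonoid.isMonoid +ₚ-commutativeMonoid
            ; inverse = (λ f → ≋-trans (+ₚ-comm (negate f) f) (+ₚ-inverseʳ f)) , +ₚ-inverseʳ
            ; ⁻¹-cong = negate-cong }
          ; comm = +ₚ-comm }
        ; *-cong = *ₚ-cong
        ; *-assoc = *ₚ-assoc
        ; *-identity = *ₚ-identityˡ , (λ g → ≋-trans (*ₚ-comm g one) (*ₚ-identityˡ g))
        ; distrib = *ₚ-distribˡ , *ₚ-distribʳ }
      ; *-comm = *ₚ-comm } }

  -- comp h f is f(h(x)).

  comp : Pol → Pol → Pol
  comp h []      = []
  comp h (a ∷ f) = (a ∷ []) +ₚ (h *ₚ comp h f)

  translate-comp : ∀ s f → translate s f ≡ comp (s ∷ 1# ∷ []) f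
  translate-comp s []      = refl
  translate-comp s (a ∷ f) = cong (λ g → (a ∷ []) +ₚ ((s ∷ 1# ∷ []) *ₚ g)) (translate-comp s f)

  comp-+ : ∀ h f g → comp h (f +ₚ g) ≋ comp h f +ₚ comp h g
  comp-+ h []      g       = ≋-refl
  comp-+ h (a ∷ f) []      = ≋-sym (+ₚ-identityʳ _)
  comp-+ h (a ∷ f) (b ∷ g) = begin
    ((a ∷ []) +ₚ (b ∷ [])) +ₚ (h *ₚ comp h (f +ₚ g))
      ≈⟨ +ₚ-cong ≋-refl (≋-trans (*ₚ-congʳ h (comp-+ h f g)) (*ₚ-distribˡ h (comp h f) (comp h g))) ⟩
    ((a ∷ []) +ₚ (b ∷ [])) +ₚ ((h *ₚ comp h f) +ₚ (h *ₚ comp h g))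
      ≈⟨ +ₚ-medial (a ∷ []) (b ∷ []) (h *ₚ comp h f) (h *ₚ comp h g) ⟩
    comp h (a ∷ f) +ₚ comp h (b ∷ g) ∎
    where open ≋-Reasoning

  comp-scale : ∀ h c f → comp h (scale c f) ≋ scale c (comp h f)
  comp-scale h c []      = ≋-refl
  comp-scale h c (a ∷ f) = begin
    ((c * a) ∷ []) +ₚ (h *ₚ comp h (scale c f))  ≈⟨ +ₚ-cong ≋-refl (≋-trans (*ₚ-congʳ h (comp-scale h c f)) (*ₚ-scale c h (comp h f))) ⟩
    scale c (a ∷ []) +ₚ scale c (h *ₚ comp h f)  ≈⟨ scale-+ c (a ∷ []) (h *ₚ comp h f) ⟨
    scale c (comp h (a ∷ f))  ∎
    where open ≋-Reasoning

  comp-∷0 : ∀ h f → comp h (0# ∷ f) ≋ h *ₚ comp h f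
  comp-∷0 h f = +ₚ-cong (∷-≋[] {f = []} refl ≋-refl) ≋-refl

  comp-constant : ∀ h a → comp h (a ∷ []) ≋ a ∷ []
  comp-constant h a = ≋-trans (+ₚ-cong ≋-refl (*ₚ-zeroʳ h)) (+ₚ-identityʳ (a ∷ []))

  comp-* : ∀ h f g → comp h (f *ₚ g) ≋ comp h f *ₚ comp h g
  comp-* h []      g = ≋-refl
  comp-* h (a ∷ f) g = begin
    comp h (scale a g +ₚ (0# ∷ (f *ₚ g)))  ≈⟨ comp-+ h (scale a g) (0# ∷ (f *ₚ g)) ⟩
    comp h (scale a g) +ₚ comp h (0# ∷ (f *ₚ g))  ≈⟨ +ₚ-cong (comp-scale h a g) (comp-∷0 h (f *ₚ g)) ⟩
    scale a (comp h g) +ₚ (h *ₚ comp h (f *ₚ g))  ≈⟨ +ₚ-cong (≋-sym (constant-*ₚ a (comp h g))) (≋-trans (*ₚ-congʳ h (comp-* h f g)) (≋-sym (*ₚ-assoc h (comp h f) (comp h g)))) ⟩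
    ((a ∷ []) *ₚ comp h g) +ₚ ((h *ₚ comp h f) *ₚ comp h g) ≈⟨ *ₚ-distribʳ (comp h g) (a ∷ []) (h *ₚ comp h f) ⟨
    comp h (a ∷ f) *ₚ comp h g  ∎
    where open ≋-Reasoning

  comp-≋[] : ∀ h f → f ≋ [] → comp h f ≋ []
  comp-≋[] h []      p      = ≋-refl
  comp-≋[] h (a ∷ f) (mk p) = begin
    (a ∷ []) +ₚ (h *ₚ comp h f)  ≈⟨ +ₚ-cong (∷-≋[] {f = []} (p 0) ≋-refl) (*ₚ-congʳ h (comp-≋[] h f (mk λ i → p (suc i)))) ⟩
    h *ₚ []  ≈⟨ *ₚ-zeroʳ h ⟩
    []  ∎
    where open ≋-Reasoning

  comp-cong : ∀ h {f g} → f ≋ g → comp h f ≋ comp h g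
  comp-cong h {[]}    {g}     p      = ≋-sym (comp-≋[] h g (≋-sym p))
  comp-cong h {a ∷ f} {[]}    p      = comp-≋[] h (a ∷ f) p
  comp-cong h {a ∷ f} {b ∷ g} (mk p) = +ₚ-cong (∷-cong (p 0) ≋-refl) (*ₚ-congʳ h (comp-cong h {f} {g} (mk λ i → p (suc i))))

  comp-congˡ : ∀ {h k} f → h ≋ k → comp h f ≋ comp k f
  comp-congˡ []      p = ≋-refl
  comp-congˡ (a ∷ f) p = +ₚ-cong ≋-refl (*ₚ-cong p (comp-congˡ f p))

  comp-comp : ∀ h k f → comp h (comp k f) ≋ comp (comp h k) f
  comp-comp h k []      = ≋-refl
  comp-comp h k (a ∷ f) = begin
    comp h ((a ∷ []) +ₚ (k *ₚ comp k f))  ≈⟨ comp-+ h (a ∷ []) (k *ₚ comp k f) ⟩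
    comp h (a ∷ []) +ₚ comp h (k *ₚ comp k f)  ≈⟨ +ₚ-cong (comp-constant h a) (comp-* h k (comp k f)) ⟩
    (a ∷ []) +ₚ (comp h k *ₚ comp h (comp k f))  ≈⟨ +ₚ-cong ≋-refl (*ₚ-congʳ (comp h k) (comp-comp h k f)) ⟩
    (a ∷ []) +ₚ (comp h k *ₚ comp (comp h k) f)  ∎
    where open ≋-Reasoning

  comp-linear : ∀ h s → comp h (s ∷ 1# ∷ []) ≋ (s ∷ []) +ₚ h
  comp-linear h s = +ₚ-cong ≋-refl (begin
    h *ₚ comp h one  ≈⟨ *ₚ-congʳ h (comp-constant h 1#) ⟩
    h *ₚ one  ≈⟨ *ₚ-comm h one ⟩
    one *ₚ h  ≈⟨ *ₚ-identityˡ h ⟩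
    h  ∎)
    where open ≋-Reasoning

  comp-identity : ∀ f → comp (0# ∷ 1# ∷ []) f ≋ f
  comp-identity []      = ≋-refl
  comp-identity (a ∷ f) = begin
    (a ∷ []) +ₚ ((0# ∷ one) *ₚ comp (0# ∷ one) f)  ≈⟨ +ₚ-cong (≋-refl {a ∷ []}) (≋-trans (∷0-*ₚ one (comp (0# ∷ one) f)) (∷-cong refl (≋-trans (*ₚ-identityˡ _) (comp-identity f)))) ⟩
    (a + 0#) ∷ f  ≈⟨ ∷-cong (+-identityʳ a) ≋-refl ⟩
    a ∷ f  ∎
    where open ≋-Reasoning

-- Enumeration of coefficient vectors

cartesianProductWith-length : {A B C : Set} (f : A → B → C) (xs : List A) (ys : List B) →
  length (cartesianProductWith f xs ys) ≡ length xs ℕ.* length ys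
cartesianProductWith-length f []       ys = refl
cartesianProductWith-length f (x ∷ xs) ys = trans (ListP.length-++ (map (f x) ys))
  (cong₂ ℕ._+_ (ListP.length-map (f x) ys) (cartesianProductWith-length f xs ys))

vectors : ∀ q n → List (Vec (Fin q) n)
vectors q zero    = [] ∷ []
vectors q (suc n) = cartesianProductWith _∷_ (allFin q) (vectors q n)

vectors-unique : ∀ q n → Unique (vectors q n)
vectors-unique q zero    = [] ∷ []
vectors-unique q (suc n) = cartesianProductWith⁺ _∷_ VecP.∷-injective (allFin⁺ q) (vectors-unique q n)

∈-vectors : ∀ {q n} (v : Vec (Fin q) n) → v ∈ vectors q n
∈-vectors []      = here refl
∈-vectors (x ∷ v) = ∈-cartesianProductWith⁺ _∷_ (∈-allFin x) (∈-vectors v)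

length-vectors : ∀ q n → length (vectors q n) ≡ q ^ n
length-vectors q zero    = refl
length-vectors q (suc n) = trans (cartesianProductWith-length _∷_ (allFin q) (vectors q n))
  (cong₂ ℕ._*_ (ListP.length-tabulate {n = q} (λ i → i)) (length-vectors q n))

-- In the monoid of monic polynomials, a list l stands for the monic polynomial of degree
-- length l whose lower coefficients are l.

module MonicPolynomials {q : ℕ} (F : FiniteField q) where
  open PolynomialRing F public
  module PolP = RingProperties (CommutativeRing.ring polRing)
  module PolGroup = AbelianGroupProperties (CommutativeRing.+-abelianGroup polRing)

  monic : Pol → Pol
  monic l = l ++ one

  +ₚ-length : ∀ f g → length (f +ₚ g) ≡ length f ⊔ length g
  +ₚ-length []      g       = refl
  +ₚ-length (a ∷ f) []      = refl
  +ₚ-length (a ∷ f) (b ∷ g) = cong suc (+ₚ-length f g)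

  coeff-≥ : ∀ f {i} → length f ≤ i → coeff f i ≡ 0#
  coeff-≥ []      _         = refl
  coeff-≥ (a ∷ f) (s≤s f≤i) = coeff-≥ f f≤i

  coeff-monic : ∀ l → coeff (monic l) (length l) ≡ 1#
  coeff-monic []      = refl
  coeff-monic (a ∷ l) = coeff-monic l

  coeff-scale-monic : ∀ c l → coeff (scale c (monic l)) (length l) ≡ c
  coeff-scale-monic c l = trans (coeff-scale c (monic l) (length l)) (trans (cong (c *_) (coeff-monic l)) (*-identityʳ c))

  scale-monic-small : ∀ {c u r} → scale c (monic u) ≋ r → length r ≤ length u → c ≡ 0#
  scale-monic-small {c} {u} {r} (mk p) r≤u = trans (sym (coeff-scale-monic c u)) (trans (p (length u)) (coeff-≥ r r≤u))

  monic≉[] : ∀ l → ¬ (monic l ≋ [])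
  monic≉[] l (mk p) = 0≢1 (trans (sym (p (length l))) (coeff-monic l))

  -- Different lengths would force 1 or c to be 0. The scalar is included so that a factor known
  -- only up to its leading coefficient can be identified.
  scale-monic-injective : ∀ {c} u v → scale c (monic u) ≋ monic v → c ≡ 1# × u ≡ v
  scale-monic-injective []      []      (mk p) = trans (sym (*-identityʳ _)) (p 0) , refl
  scale-monic-injective []      (b ∷ v) (mk p) = ⊥-elim (monic≉[] v (mk λ i → sym (p (suc i))))
  scale-monic-injective {c} (a ∷ u) [] (mk p) = ⊥-elim (0≢1 (trans (sym (zeroˡ a)) (trans (cong (_* a) (sym c≡0)) (p 0))))
    where
    c≡0 : c ≡ 0#
    c≡0 = scale-monic-small {c} {u} {[]} (mk λ i → p (suc i)) z≤n
  scale-monic-injective {c} (a ∷ u) (b ∷ v) (mk p) with scale-monic-injective u v (mk λ i → p (suc i))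
  ... | refl , refl = refl , cong (_∷ u) (trans (sym (*-identityˡ a)) (p 0))

  monic-injective : ∀ {u v} → monic u ≋ monic v → u ≡ v
  monic-injective {u} {v} p = proj₂ (scale-monic-injective u v (≋-trans (scale-1 (monic u)) p))

  inverse-* : ∀ {c} (c≢0 : c ≢ 0#) a → c * (proj₁ (inverse c c≢0) * a) ≡ a
  inverse-* {c} c≢0 a = trans (sym (*-assoc c _ a)) (trans (cong (_* a) (proj₂ (inverse c c≢0))) (*-identityˡ a))

  -- Trailing zeros make the length of a list a mere bound for the degree; this view recovers the
  -- degree and the leading coefficient. The strict inequality of lengths drives the descent in
  -- `cancel-small`.
  data NormalForm (f : Pol) : Set where
    null    : f ≋ [] → NormalForm f
    leading : ∀ c l → c ≢ 0# → f ≋ scale c (monic l) → length l < length f → NormalForm f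

  normalForm : ∀ f → NormalForm f
  normalForm [] = null ≋-refl
  normalForm (a ∷ f) with normalForm f
  ... | leading c l c≢0 p l<f = leading c (proj₁ (inverse c c≢0) * a ∷ l) c≢0 (∷-cong (sym (inverse-* c≢0 a)) p) (s≤s l<f)
  ... | null p with a FinP.≟ 0#
  ...   | yes a≡0 = null (∷-≋[] a≡0 p)
  ...   | no a≢0  = leading a [] a≢0 (∷-cong (sym (*-identityʳ a)) p) (s≤s z≤n)

  infixl 7 _⊗_

  -- The product of monic polynomials on lower coefficients, from a + x l times m. Keeping the
  -- leading 1 implicit makes the monoid laws hold up to `≡`.
  _⊗_ : Pol → Pol → Pol
  []      ⊗ m = m
  (a ∷ l) ⊗ m = scale a (monic m) +ₚ (0# ∷ (l ⊗ m))

  length-monic : ∀ l → length (monic l) ≡ suc (length l)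
  length-monic l = trans (ListP.length-++ l) (ℕP.+-comm (length l) 1)

  length-⊗ : ∀ l m → length (l ⊗ m) ≡ length l ℕ.+ length m
  length-⊗ []      m = refl
  length-⊗ (a ∷ l) m = begin
    length (scale a (monic m) +ₚ (0# ∷ (l ⊗ m)))  ≡⟨ +ₚ-length (scale a (monic m)) _ ⟩
    length (scale a (monic m)) ⊔ suc (length (l ⊗ m))  ≡⟨ cong₂ (λ x y → x ⊔ suc y) (trans (ListP.length-map _ (monic m)) (length-monic m)) (length-⊗ l m) ⟩
    suc (length m ⊔ (length l ℕ.+ length m))  ≡⟨ cong suc (ℕP.m≤n⇒m⊔n≡n (ℕP.m≤n+m (length m) (length l))) ⟩
    suc (length l ℕ.+ length m)  ∎
    where open ≡-Reasoning

  monic-+ : ∀ f l → length f ≤ length l → monic (f +ₚ l) ≡ f +ₚ monic l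
  monic-+ []      l       _         = refl
  monic-+ (a ∷ f) (b ∷ l) (s≤s f≤l) = cong (a + b ∷_) (monic-+ f l f≤l)

  monic-⊗ : ∀ l m → monic (l ⊗ m) ≋ monic l *ₚ monic m
  monic-⊗ []      m = ≋-sym (*ₚ-identityˡ (monic m))
  monic-⊗ (a ∷ l) m = begin
    monic (scale a (monic m) +ₚ (0# ∷ (l ⊗ m)))  ≡⟨ monic-+ (scale a (monic m)) (0# ∷ (l ⊗ m)) small ⟩
    scale a (monic m) +ₚ (0# ∷ monic (l ⊗ m))  ≈⟨ +ₚ-cong ≋-refl (∷-cong refl (monic-⊗ l m)) ⟩
    scale a (monic m) +ₚ (0# ∷ monic l *ₚ monic m) ∎
    where
    open ≋-Reasoning
    small : length (scale a (monic m)) ≤ suc (length (l ⊗ m))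
    small = subst₂ _≤_ (sym (trans (ListP.length-map _ (monic m)) (length-monic m))) (cong suc (sym (length-⊗ l m)))
              (s≤s (ℕP.m≤n+m (length m) (length l)))

  monic-*-scale : ∀ l c m → monic l *ₚ scale c (monic m) ≋ scale c (monic (l ⊗ m))
  monic-*-scale l c m = ≋-trans (*ₚ-scale c (monic l) (monic m)) (scale-cong refl (≋-sym (monic-⊗ l m)))

  monic-*-≋[] : ∀ l f → monic l *ₚ f ≋ [] → f ≋ []
  monic-*-≋[] l f p with normalForm f
  ... | null f≋[] = f≋[]
  ... | leading c m c≢0 f≋ _ = ⊥-elim (c≢0 (scale-monic-small {c} {l ⊗ m} {[]}
          (≋-trans (≋-sym (monic-*-scale l c m)) (≋-trans (*ₚ-congʳ (monic l) (≋-sym f≋)) p)) z≤n))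

  -‿≋[]⇒≋ : ∀ f g → f +ₚ negate g ≋ [] → f ≋ g
  -‿≋[]⇒≋ = PolGroup.x∙y⁻¹≈ε⇒x≈y

  monic-*-cancel : ∀ l f g → monic l *ₚ f ≋ monic l *ₚ g → f ≋ g
  monic-*-cancel l f g p = -‿≋[]⇒≋ f g (monic-*-≋[] l (f +ₚ negate g) (begin
    monic l *ₚ (f +ₚ negate g)  ≈⟨ *ₚ-distribˡ (monic l) f (negate g) ⟩
    monic l *ₚ f +ₚ monic l *ₚ negate g  ≈⟨ +ₚ-cong p (≋-sym (PolP.-‿distribʳ-* (monic l) g)) ⟩
    monic l *ₚ g +ₚ negate (monic l *ₚ g)  ≈⟨ +ₚ-inverseʳ (monic l *ₚ g) ⟩
    []  ∎))
    where open ≋-Reasoning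

  snoc-view : ∀ a (r : Pol) → ∃₂ λ r′ t → a ∷ r ≡ r′ ++ t ∷ [] × length r′ ≡ length r
  snoc-view a []      = [] , a , refl , refl
  snoc-view a (b ∷ r) with snoc-view b r
  ... | r′ , t , eq , len = a ∷ r′ , t , cong (a ∷_) eq , cong suc len

  eliminate-top : ∀ P r t → length r ≡ length P → r ++ t ∷ [] ≋ scale t (monic P) +ₚ (r +ₚ negate (scale t P))
  eliminate-top []      []      t _   = ∷-cong (sym (*-identityʳ t)) ≋-refl
  eliminate-top (b ∷ P) (a ∷ r) t len = ∷-cong (begin
    a  ≡⟨ +-identityˡ a ⟨
    0# + a  ≡⟨ cong (_+ a) (-‿inverseʳ (t * b)) ⟨
    t * b + - (t * b) + a  ≡⟨ +-assoc _ _ a ⟩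
    t * b + (- (t * b) + a)  ≡⟨ cong (t * b +_) (+-comm _ a) ⟩
    t * b + (a + - (t * b))  ∎) (eliminate-top P r t (ℕP.suc-injective len))
    where open ≡-Reasoning

  -- Long division in Horner form: the division of the tail f is multiplied by x and a is added. The
  -- remainder always has exactly `length P` coefficients, zeros included, so it overflows by a
  -- single one.
  divide : ∀ P f → ∃₂ λ k r → f ≋ monic P *ₚ k +ₚ r × length r ≡ length P
  divide P [] = [] , replicate (length P) 0# , ≋-sym (≋-trans (+ₚ-cong (*ₚ-zeroʳ (monic P)) (zeros (length P))) ≋-refl)
              , ListP.length-replicate (length P)
    where
    zeros : ∀ n → replicate n 0# ≋ []
    zeros zero    = ≋-refl
    zeros (suc n) = ∷-≋[] refl (zeros n)
  divide P (a ∷ f) with divide P f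
  ... | k , r , f≋ , len with snoc-view a r
  -- The surplus top coefficient t of `a ∷ r` becomes the lowest coefficient of the quotient, and t
  -- times the lower part of P is subtracted from the rest.
  ...   | r′ , t , eq , len′ = t ∷ k , r′ +ₚ negate (scale t P) , (begin
    a ∷ f  ≈⟨ ∷-cong (sym (+-identityˡ a)) f≋ ⟩
    (0# ∷ monic P *ₚ k) +ₚ (a ∷ r)  ≡⟨ cong ((0# ∷ monic P *ₚ k) +ₚ_) eq ⟩
    (0# ∷ monic P *ₚ k) +ₚ (r′ ++ t ∷ [])  ≈⟨ +ₚ-cong (≋-refl {0# ∷ monic P *ₚ k}) (eliminate-top P r′ t (trans len′ len)) ⟩
    (0# ∷ monic P *ₚ k) +ₚ (scale t (monic P) +ₚ r″)  ≈⟨ +ₚ-assoc (0# ∷ monic P *ₚ k) (scale t (monic P)) r″ ⟨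
    (0# ∷ monic P *ₚ k) +ₚ scale t (monic P) +ₚ r″  ≈⟨ +ₚ-cong (+ₚ-comm (0# ∷ monic P *ₚ k) (scale t (monic P))) ≋-refl ⟩
    scale t (monic P) +ₚ (0# ∷ monic P *ₚ k) +ₚ r″  ≈⟨ +ₚ-cong (*ₚ-∷ʳ (monic P) t k) ≋-refl ⟨
    monic P *ₚ (t ∷ k) +ₚ r″  ∎)
    , trans (+ₚ-length r′ _) (trans (cong₂ _⊔_ (trans len′ len) (trans (ListP.length-map _ (scale t P)) (ListP.length-map _ P))) (ℕP.⊔-idem (length P)))
    where
    open ≋-Reasoning
    r″ = r′ +ₚ negate (scale t P)

  -- Divisibility and Euclid's lemma

  infix 4 _∣ₚ_
  _∣ₚ_ : Pol → Pol → Set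
  f ∣ₚ g = ∃ λ k → f *ₚ k ≋ g

  ∣ₚ-resp : ∀ d {f g} → f ≋ g → d ∣ₚ f → d ∣ₚ g
  ∣ₚ-resp d p (k , eq) = k , ≋-trans eq p

  ∣ₚ-* : ∀ d f {g} → d ∣ₚ g → d ∣ₚ f *ₚ g
  ∣ₚ-* d f {g} (k , p) = f *ₚ k , (begin
    d *ₚ (f *ₚ k)  ≈⟨ *ₚ-assoc d f k ⟨
    d *ₚ f *ₚ k  ≈⟨ *ₚ-cong (*ₚ-comm d f) ≋-refl ⟩
    f *ₚ d *ₚ k  ≈⟨ *ₚ-assoc f d k ⟩
    f *ₚ (d *ₚ k)  ≈⟨ *ₚ-congʳ f p ⟩
    f *ₚ g  ∎)
    where open ≋-Reasoning

  ∣ₚ-+-cancel : ∀ d f {g} → d ∣ₚ f +ₚ g → d ∣ₚ f → d ∣ₚ g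
  ∣ₚ-+-cancel d f {g} (k , p) (l , r) = k +ₚ negate l , (begin
    d *ₚ (k +ₚ negate l)  ≈⟨ *ₚ-distribˡ d k (negate l) ⟩
    d *ₚ k +ₚ d *ₚ negate l  ≈⟨ +ₚ-cong p (≋-trans (≋-sym (PolP.-‿distribʳ-* d l)) (negate-cong r)) ⟩
    f +ₚ g +ₚ negate f  ≈⟨ +ₚ-cong (+ₚ-comm f g) ≋-refl ⟩
    g +ₚ f +ₚ negate f  ≈⟨ +ₚ-assoc g f (negate f) ⟩
    g +ₚ (f +ₚ negate f)  ≈⟨ +ₚ-cong ≋-refl (+ₚ-inverseʳ f) ⟩
    g +ₚ []  ≈⟨ +ₚ-identityʳ g ⟩
    g  ∎)
    where open ≋-Reasoning

  ∣ₚ-scale⁻ : ∀ d {c f} → c ≢ 0# → d ∣ₚ scale c f → d ∣ₚ f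
  ∣ₚ-scale⁻ d {c} {f} c≢0 (k , p) = scale c⁻¹ k , (begin
    d *ₚ scale c⁻¹ k  ≈⟨ *ₚ-scale c⁻¹ d k ⟩
    scale c⁻¹ (d *ₚ k)  ≈⟨ scale-cong refl p ⟩
    scale c⁻¹ (scale c f)  ≈⟨ scale-scale c⁻¹ c f ⟩
    scale (c⁻¹ * c) f  ≈⟨ scale-cong (trans (*-comm c⁻¹ c) (proj₂ (inverse c c≢0))) ≋-refl ⟩
    scale 1# f  ≈⟨ scale-1 f ⟩
    f  ∎)
    where
    open ≋-Reasoning
    c⁻¹ = proj₁ (inverse c c≢0)

  ∣ₚ⇒∣ : ∀ u v → monic u ∣ₚ monic v → ∃ λ w → u ⊗ w ≡ v
  ∣ₚ⇒∣ u v (k , p) with normalForm k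
  ... | null k≋[] = ⊥-elim (monic≉[] v (≋-trans (≋-sym p) (≋-trans (*ₚ-congʳ (monic u) k≋[]) (*ₚ-zeroʳ (monic u)))))
  ... | leading c w _ k≋ _ = w , proj₂ (scale-monic-injective (u ⊗ w) v
          (≋-trans (≋-sym (monic-*-scale u c w)) (≋-trans (*ₚ-congʳ (monic u) (≋-sym k≋)) p)))

  ∣⇒∣ₚ : ∀ u {v} → (∃ λ w → u ⊗ w ≡ v) → monic u ∣ₚ monic v
  ∣⇒∣ₚ u (w , refl) = monic w , ≋-sym (monic-⊗ u w)

  MonicIrreducible : Pol → Set
  MonicIrreducible x = length x ≢ 0 × (∀ y z → y ⊗ z ≡ x → length y ≡ 0 ⊎ length z ≡ 0)

  module _ {P : Pol} (P-irr : MonicIrreducible P) where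

    -- Dividing P by a leaves a nonzero remainder r of smaller degree, and P also divides r f.

    private
      cancel-small : ∀ n a f → length a ≤ n → length a < length P → monic P ∣ₚ monic a *ₚ f → monic P ∣ₚ f
      cancel-small n       []      f _   _   P∣af = ∣ₚ-resp (monic P) (*ₚ-identityˡ f) P∣af
      cancel-small (suc n) a@(_ ∷ _) f a≤n a<P P∣af with divide a (monic P)
      ... | k , r , P≋ , r-len with normalForm r
      ...   | null r≋[] with ∣ₚ⇒∣ a P (k , ≋-sym (≋-trans P≋ (≋-trans (+ₚ-cong (≋-refl {monic a *ₚ k}) r≋[]) (+ₚ-identityʳ (monic a *ₚ k)))))
      ...     | w , aw≡P with proj₂ P-irr a w aw≡P
      ...       | inj₂ w≡0 = ⊥-elim (ℕP.<⇒≢ a<P (begin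
        length a  ≡⟨ ℕP.+-identityʳ _ ⟨
        length a ℕ.+ 0  ≡⟨ cong (length a ℕ.+_) w≡0 ⟨
        length a ℕ.+ length w  ≡⟨ length-⊗ a w ⟨
        length (a ⊗ w)  ≡⟨ cong length aw≡P ⟩
        length P  ∎))
        where open ≡-Reasoning
      cancel-small (suc n) a@(_ ∷ _) f a≤n a<P P∣af | k , r , P≋ , r-len | leading c a′ c≢0 r≋ a′<r =
        cancel-small n a′ f (ℕP.≤-pred (ℕP.≤-trans a′<a a≤n)) (ℕP.<-trans a′<a a<P)
          (∣ₚ-scale⁻ (monic P) c≢0 (∣ₚ-resp (monic P) (≋-trans (*ₚ-cong r≋ ≋-refl) (scale-*ₚ c (monic a′) f)) P∣rf))
        where
        a′<a : length a′ < length a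
        a′<a = subst (length a′ <_) r-len a′<r
        P∣rf : monic P ∣ₚ r *ₚ f
        P∣rf = ∣ₚ-+-cancel (monic P) (k *ₚ (monic a *ₚ f)) (f , (begin
          monic P *ₚ f  ≈⟨ *ₚ-cong P≋ ≋-refl ⟩
          (monic a *ₚ k +ₚ r) *ₚ f  ≈⟨ *ₚ-distribʳ f (monic a *ₚ k) r ⟩
          monic a *ₚ k *ₚ f +ₚ r *ₚ f  ≈⟨ +ₚ-cong (≋-trans (*ₚ-cong (*ₚ-comm (monic a) k) ≋-refl) (*ₚ-assoc k (monic a) f)) ≋-refl ⟩
          k *ₚ (monic a *ₚ f) +ₚ r *ₚ f  ∎)) (∣ₚ-* (monic P) k P∣af)
          where open ≋-Reasoning

    -- y may be replaced by its remainder modulo P. A zero remainder means P ∣ y; otherwise its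
    -- monic normalisation has degree below that of P and can be cancelled by `cancel-small`.
    monic-euclid : ∀ y z → (∃ λ k → P ⊗ k ≡ y ⊗ z) → (∃ λ k → P ⊗ k ≡ y) ⊎ (∃ λ k → P ⊗ k ≡ z)
    monic-euclid y z P∣yz with divide P (monic y)
    ... | k , r , y≋ , r-len with normalForm r
    ...   | null r≋[] = inj₁ (∣ₚ⇒∣ P y (k , ≋-sym (≋-trans y≋ (≋-trans (+ₚ-cong (≋-refl {monic P *ₚ k}) r≋[]) (+ₚ-identityʳ (monic P *ₚ k))))))
    ...   | leading c a c≢0 r≋ a<r = inj₂ (∣ₚ⇒∣ P z (cancel-small (length a) a (monic z) ℕP.≤-refl (subst (length a <_) r-len a<r)
            (∣ₚ-scale⁻ (monic P) c≢0 (∣ₚ-resp (monic P) (≋-trans (*ₚ-cong r≋ ≋-refl) (scale-*ₚ c (monic a) (monic z))) P∣rz))))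
      where
      P∣rz : monic P ∣ₚ r *ₚ monic z
      P∣rz = ∣ₚ-+-cancel (monic P) (monic P *ₚ k *ₚ monic z)
        (∣ₚ-resp (monic P) (begin
          monic (y ⊗ z)  ≈⟨ monic-⊗ y z ⟩
          monic y *ₚ monic z  ≈⟨ *ₚ-cong y≋ ≋-refl ⟩
          (monic P *ₚ k +ₚ r) *ₚ monic z  ≈⟨ *ₚ-distribʳ (monic z) (monic P *ₚ k) r ⟩
          monic P *ₚ k *ₚ monic z +ₚ r *ₚ monic z  ∎) (∣⇒∣ₚ P P∣yz))
        (k *ₚ monic z , ≋-sym (*ₚ-assoc (monic P) k (monic z)))
        where open ≋-Reasoning

  ⊗-assoc : ∀ x y z → (x ⊗ y) ⊗ z ≡ x ⊗ (y ⊗ z)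
  ⊗-assoc x y z = monic-injective (begin
    monic (x ⊗ y ⊗ z)  ≈⟨ ≋-trans (monic-⊗ (x ⊗ y) z) (*ₚ-cong (monic-⊗ x y) ≋-refl) ⟩
    monic x *ₚ monic y *ₚ monic z  ≈⟨ *ₚ-assoc (monic x) (monic y) (monic z) ⟩
    monic x *ₚ (monic y *ₚ monic z)  ≈⟨ ≋-trans (monic-⊗ x (y ⊗ z)) (*ₚ-congʳ (monic x) (monic-⊗ y z)) ⟨
    monic (x ⊗ (y ⊗ z))  ∎)
    where open ≋-Reasoning

  ⊗-comm : ∀ x y → x ⊗ y ≡ y ⊗ x
  ⊗-comm x y = monic-injective (≋-trans (monic-⊗ x y) (≋-trans (*ₚ-comm (monic x) (monic y)) (≋-sym (monic-⊗ y x))))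

  ⊗-cancelˡ : ∀ x {y z} → x ⊗ y ≡ x ⊗ z → y ≡ z
  ⊗-cancelˡ x {y} {z} eq = monic-injective (monic-*-cancel x (monic y) (monic z)
    (≋-trans (≋-sym (monic-⊗ x y)) (≋-trans (≡⇒≋ (cong monic eq)) (monic-⊗ x z))))

  length≡0 : ∀ {l : Pol} → length l ≡ 0 → l ≡ []
  length≡0 {[]} _ = refl

  monicElements : ℕ → List Pol
  monicElements n = map toList (vectors q n)

  toList-injective : ∀ {n} {u v : Vec (Fin q) n} → toList u ≡ toList v → u ≡ v
  toList-injective {u = []}    {[]}    _  = refl
  toList-injective {u = a ∷ u} {b ∷ v} eq = cong₂ _∷_ (ListP.∷-injectiveˡ eq) (toList-injective (ListP.∷-injectiveʳ eq))

  monicMonoid : FactorialMonoid q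
  monicMonoid = record
    { M = Pol ; _·_ = _⊗_ ; ε = [] ; deg = length ; _≟_ = ListP.≡-dec FinP._≟_
    ; isCommutativeMonoid = record
      { isMonoid = record
        { isSemigroup = record
          { isMagma = record { isEquivalence = isEquivalence ; ∙-cong = cong₂ _⊗_ }
          ; assoc = ⊗-assoc }
        ; identity = (λ _ → refl) , (λ x → ⊗-comm x []) }
      ; comm = ⊗-comm }
    ; ·-cancelˡ = ⊗-cancelˡ
    ; deg-· = length-⊗
    ; deg≡0 = length≡0
    ; elements = monicElements
    ; elements-unique = λ n → map⁺ toList-injective (vectors-unique q n)
    ; ∈-elements⁺ = λ x → subst (_∈ monicElements (length x)) (VecP.toList∘fromList x) (∈-map⁺ toList (∈-vectors (Vec.fromList x)))
    ; ∈-elements⁻ = λ { {n} x∈ → length-toList-∈ n (∈-map⁻ toList x∈) }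
    ; length-elements = λ n → trans (ListP.length-map toList (vectors q n)) (length-vectors q n)
    ; euclid = λ y z P-irr → monic-euclid P-irr y z }
    where
    length-toList-∈ : ∀ n {x} → (∃ λ v → v ∈ vectors q n × x ≡ toList v) → length x ≡ n
    length-toList-∈ n (v , _ , refl) = VecP.length-toList v

-- Composition and translation of monic polynomials

module Translations {q : ℕ} (F : FiniteField q) where
  open MonicPolynomials F public
  open FactorialMonoid monicMonoid public
    using (∏; ∏-cong; ∏-suc; deg-∏; ∣-∏; Irr-∣-∏; ∏-∣; Irr-∣⇒≡; _∣_; ∣⇒deg≤; Irr; Irr?)

  -- Composition l(H) on lower coefficients. It is faithful for nonconstant H only: otherwise adding
  -- a would reach the leading coefficient.
  compose : Pol → Pol → Pol
  compose H []      = []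
  compose H (a ∷ l) = (a ∷ []) +ₚ H ⊗ compose H l

  length-H⊗ : ∀ H m → 0 < length H → 0 < length (H ⊗ m)
  length-H⊗ H m 0<H = subst (0 <_) (sym (length-⊗ H m)) (ℕP.<-≤-trans 0<H (ℕP.m≤m+n (length H) (length m)))

  length-compose : ∀ H l → 0 < length H → length (compose H l) ≡ length H ℕ.* length l
  length-compose H []      0<H = sym (ℕP.*-zeroʳ (length H))
  length-compose H (a ∷ l) 0<H = begin
    length ((a ∷ []) +ₚ H ⊗ compose H l)  ≡⟨ +ₚ-length (a ∷ []) (H ⊗ compose H l) ⟩
    1 ⊔ length (H ⊗ compose H l)  ≡⟨ ℕP.m≤n⇒m⊔n≡n (length-H⊗ H (compose H l) 0<H) ⟩
    length (H ⊗ compose H l)  ≡⟨ length-⊗ H (compose H l) ⟩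
    length H ℕ.+ length (compose H l)  ≡⟨ cong (length H ℕ.+_) (length-compose H l 0<H) ⟩
    length H ℕ.+ length H ℕ.* length l  ≡⟨ ℕP.*-suc (length H) (length l) ⟨
    length H ℕ.* suc (length l)  ∎
    where open ≡-Reasoning

  monic-compose : ∀ H l → 0 < length H → monic (compose H l) ≋ comp (monic H) (monic l)
  monic-compose H []      0<H = ≋-sym (comp-constant (monic H) 1#)
  monic-compose H (a ∷ l) 0<H = begin
    monic ((a ∷ []) +ₚ H ⊗ compose H l)  ≡⟨ monic-+ (a ∷ []) (H ⊗ compose H l) (length-H⊗ H (compose H l) 0<H) ⟩
    (a ∷ []) +ₚ monic (H ⊗ compose H l)  ≈⟨ +ₚ-cong (≋-refl {a ∷ []}) (≋-trans (monic-⊗ H (compose H l)) (*ₚ-congʳ (monic H) (monic-compose H l 0<H))) ⟩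
    (a ∷ []) +ₚ monic H *ₚ comp (monic H) (monic l)  ∎
    where open ≋-Reasoning

  compose-⊗ : ∀ H x y → 0 < length H → compose H (x ⊗ y) ≡ compose H x ⊗ compose H y
  compose-⊗ H x y 0<H = monic-injective (begin
    monic (compose H (x ⊗ y))  ≈⟨ monic-compose H (x ⊗ y) 0<H ⟩
    comp (monic H) (monic (x ⊗ y))  ≈⟨ comp-cong (monic H) (monic-⊗ x y) ⟩
    comp (monic H) (monic x *ₚ monic y)  ≈⟨ comp-* (monic H) (monic x) (monic y) ⟩
    comp (monic H) (monic x) *ₚ comp (monic H) (monic y)  ≈⟨ *ₚ-cong (monic-compose H x 0<H) (monic-compose H y 0<H) ⟨
    monic (compose H x) *ₚ monic (compose H y)  ≈⟨ monic-⊗ (compose H x) (compose H y) ⟨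
    monic (compose H x ⊗ compose H y)  ∎)
    where open ≋-Reasoning

  -- The leading coefficient of f is also that of f(H), so it cannot vanish in f(H) alone.
  comp-monic-≋[] : ∀ H f → 0 < length H → comp (monic H) f ≋ [] → f ≋ []
  comp-monic-≋[] H f 0<H p with normalForm f
  ... | null f≋[] = f≋[]
  ... | leading c l c≢0 f≋ _ = ⊥-elim (c≢0 (scale-monic-small {c} {compose H l} {[]} (begin
    scale c (monic (compose H l))  ≈⟨ scale-cong refl (monic-compose H l 0<H) ⟩
    scale c (comp (monic H) (monic l))  ≈⟨ comp-scale (monic H) c (monic l) ⟨
    comp (monic H) (scale c (monic l))  ≈⟨ comp-cong (monic H) f≋ ⟨
    comp (monic H) f  ≈⟨ p ⟩
    []  ∎) z≤n))
    where open ≋-Reasoning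

  comp-negate : ∀ h f → comp h (negate f) ≋ negate (comp h f)
  comp-negate h f = PolGroup.inverseʳ-unique (comp h f) (comp h (negate f))
    (≋-trans (≋-sym (comp-+ h f (negate f))) (comp-≋[] h (f +ₚ negate f) (+ₚ-inverseʳ f)))

  compose-injective : ∀ H {x y} → 0 < length H → compose H x ≡ compose H y → x ≡ y
  compose-injective H {x} {y} 0<H eq = monic-injective (-‿≋[]⇒≋ (monic x) (monic y)
    (comp-monic-≋[] H (monic x +ₚ negate (monic y)) 0<H (begin
      comp (monic H) (monic x +ₚ negate (monic y))  ≈⟨ comp-+ (monic H) (monic x) (negate (monic y)) ⟩
      comp (monic H) (monic x) +ₚ comp (monic H) (negate (monic y))  ≈⟨ +ₚ-cong (≋-trans (≋-sym (monic-compose H x 0<H)) (≋-trans (≡⇒≋ (cong monic eq)) (monic-compose H y 0<H))) (comp-negate (monic H) (monic y)) ⟩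
      comp (monic H) (monic y) +ₚ negate (comp (monic H) (monic y))  ≈⟨ +ₚ-inverseʳ (comp (monic H) (monic y)) ⟩
      []  ∎)))
    where open ≋-Reasoning

  X+_ : Fin q → Pol
  X+ c = c ∷ 1# ∷ []

  shift : Fin q → Pol → Pol
  shift c = compose (c ∷ [])

  monic-shift : ∀ c l → monic (shift c l) ≋ comp (X+ c) (monic l)
  monic-shift c l = monic-compose (c ∷ []) l (s≤s z≤n)

  length-shift : ∀ c l → length (shift c l) ≡ length l
  length-shift c l = trans (length-compose (c ∷ []) l (s≤s z≤n)) (ℕP.*-identityˡ (length l))

  comp-X+-X+ : ∀ c d f → comp (X+ c) (comp (X+ d) f) ≋ comp (X+ (c + d)) f
  comp-X+-X+ c d f = ≋-trans (comp-comp (X+ c) (X+ d) f) (comp-congˡ f (≋-trans (comp-linear (X+ c) d) (∷-cong (+-comm d c) ≋-refl)))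

  comp-X+-comm : ∀ c d f → comp (X+ c) (comp (X+ d) f) ≋ comp (X+ d) (comp (X+ c) f)
  comp-X+-comm c d f = ≋-trans (comp-X+-X+ c d f) (≋-trans (≡⇒≋ (cong (λ e → comp (X+ e) f) (+-comm c d))) (≋-sym (comp-X+-X+ d c f)))

  shift-shift : ∀ c d l → shift c (shift d l) ≡ shift (c + d) l
  shift-shift c d l = monic-injective (begin
    monic (shift c (shift d l))  ≈⟨ ≋-trans (monic-shift c (shift d l)) (comp-cong (X+ c) (monic-shift d l)) ⟩
    comp (X+ c) (comp (X+ d) (monic l))  ≈⟨ comp-X+-X+ c d (monic l) ⟩
    comp (X+ (c + d)) (monic l)  ≈⟨ monic-shift (c + d) l ⟨
    monic (shift (c + d) l)  ∎)
    where open ≋-Reasoning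

  shift-0 : ∀ l → shift 0# l ≡ l
  shift-0 l = monic-injective (≋-trans (monic-shift 0# l) (comp-identity (monic l)))

  shift-linear : ∀ c d → shift c (d ∷ []) ≡ d + c ∷ []
  shift-linear c d = monic-injective (≋-trans (monic-shift c (d ∷ [])) (comp-linear (X+ c) d))

  shift-inverse : ∀ c l → shift (- c) (shift c l) ≡ l
  shift-inverse c l = trans (shift-shift (- c) c l) (trans (cong (λ e → shift e l) (-‿inverseˡ c)) (shift-0 l))

  shiftAut : Fin q → Automorphism monicMonoid
  shiftAut c = record
    { fun = shift c ; inv = shift (- c)
    ; fun-· = λ x y → compose-⊗ (c ∷ []) x y (s≤s z≤n) ; fun-deg = length-shift c
    ; inv-· = λ x y → compose-⊗ (- c ∷ []) x y (s≤s z≤n) ; inv-deg = length-shift (- c)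
    ; inv-fun = shift-inverse c }

  linear-Irr : ∀ c → Irr (c ∷ [])
  linear-Irr c = (λ ()) , split
    where
    split : ∀ y z → y ⊗ z ≡ c ∷ [] → length y ≡ 0 ⊎ length z ≡ 0
    split []          z           eq = inj₁ refl
    split (_ ∷ _)     []          eq = inj₂ refl
    split y@(_ ∷ y′) z@(_ ∷ z′) eq with trans (sym (length-⊗ y z)) (cong length eq)
    ... | len with trans (sym (ℕP.+-suc (length y′) (length z′))) (ℕP.suc-injective len)
    ...   | ()

  -- The list `c ∷ []` stands for x + c, whence the root -c. The remainder on division by x + c is a
  -- constant, and evaluation at -c shows it to be 0.
  root⇒linear-factor : ∀ c l → comp (- c ∷ []) (monic l) ≋ [] → (c ∷ []) ∣ l
  root⇒linear-factor c l root with divide (c ∷ []) (monic l)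
  ... | k , e ∷ [] , l≋ , _ = ∣ₚ⇒∣ (c ∷ []) l (k , (begin
    X+ c *ₚ k  ≈⟨ +ₚ-identityʳ (X+ c *ₚ k) ⟨
    X+ c *ₚ k +ₚ []  ≈⟨ +ₚ-cong (≋-refl {X+ c *ₚ k}) remainder ⟨
    X+ c *ₚ k +ₚ (e ∷ [])  ≈⟨ l≋ ⟨
    monic l  ∎))
    where
    open ≋-Reasoning
    ev = comp (- c ∷ [])
    remainder : e ∷ [] ≋ []
    remainder = begin
      e ∷ []  ≈⟨ comp-constant (- c ∷ []) e ⟨
      ev (e ∷ [])  ≈⟨ +ₚ-cong (*ₚ-cong {g = ev k} (≋-trans (comp-linear (- c ∷ []) c) (∷-≋[] {f = []} (-‿inverseʳ c) ≋-refl)) ≋-refl) (≋-refl {ev (e ∷ [])}) ⟨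
      ev (X+ c) *ₚ ev k +ₚ ev (e ∷ [])  ≈⟨ +ₚ-cong (comp-* (- c ∷ []) (X+ c) k) ≋-refl ⟨
      ev (X+ c *ₚ k) +ₚ ev (e ∷ [])  ≈⟨ comp-+ (- c ∷ []) (X+ c *ₚ k) (e ∷ []) ⟨
      ev (X+ c *ₚ k +ₚ (e ∷ []))  ≈⟨ comp-cong (- c ∷ []) l≋ ⟨
      ev (monic l)  ≈⟨ root ⟩
      []  ∎

  -- A nonzero difference of the quotients would make P times it have degree at least deg P, too
  -- large for a difference of remainders. Through this lemma, invariance of a dividend passes to
  -- quotient and remainder.
  divide-unique : ∀ P {k k′ r r′} → monic P *ₚ k +ₚ r ≋ monic P *ₚ k′ +ₚ r′ →
                  length r ≤ length P → length r′ ≤ length P → k ≋ k′ × r ≋ r′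
  divide-unique P {k} {k′} {r} {r′} p r≤ r′≤ = k≋ , r≋
    where
    open ≋-Reasoning
    difference : monic P *ₚ (k +ₚ negate k′) ≋ r′ +ₚ negate r
    difference = begin
      monic P *ₚ (k +ₚ negate k′)  ≈⟨ PolP.x[y-z]≈xy-xz (monic P) k k′ ⟩
      monic P *ₚ k +ₚ negate (monic P *ₚ k′)  ≈⟨ +ₚ-cong (≋-sym (PolGroup.//-rightDividesʳ r (monic P *ₚ k))) ≋-refl ⟩
      monic P *ₚ k +ₚ r +ₚ negate r +ₚ negate (monic P *ₚ k′)  ≈⟨ +ₚ-cong (+ₚ-cong p ≋-refl) ≋-refl ⟩
      monic P *ₚ k′ +ₚ r′ +ₚ negate r +ₚ negate (monic P *ₚ k′)  ≈⟨ +ₚ-cong (+ₚ-assoc (monic P *ₚ k′) r′ (negate r)) ≋-refl ⟩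
      monic P *ₚ k′ +ₚ (r′ +ₚ negate r) +ₚ negate (monic P *ₚ k′)  ≈⟨ PolGroup.xyx⁻¹≈y (monic P *ₚ k′) (r′ +ₚ negate r) ⟩
      r′ +ₚ negate r  ∎
    small : length (r′ +ₚ negate r) ≤ length P
    small = subst (_≤ length P) (sym (+ₚ-length r′ (negate r))) (ℕP.⊔-lub r′≤ (subst (_≤ length P) (sym (ListP.length-map -_ r)) r≤))
    k≋ : k ≋ k′
    k≋ with normalForm (k +ₚ negate k′)
    ... | null eq = -‿≋[]⇒≋ k k′ eq
    ... | leading c l c≢0 eq _ = ⊥-elim (c≢0 (scale-monic-small {c} {P ⊗ l} {r′ +ₚ negate r}
            (≋-trans (≋-sym (monic-*-scale P c l)) (≋-trans (*ₚ-congʳ (monic P) (≋-sym eq)) difference))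
            (ℕP.≤-trans small (subst (length P ≤_) (sym (length-⊗ P l)) (ℕP.m≤m+n (length P) (length l))))))
    r≋ : r ≋ r′
    r≋ = PolGroup.∙-cancelˡ (monic P *ₚ k) r r′ (≋-trans p (+ₚ-cong (*ₚ-congʳ (monic P) (≋-sym k≋)) ≋-refl))

  -- The list computed by `comp` may carry trailing zeros and exceed r in length; `divide-unique`
  -- needs a short representative.
  comp-X+-length : ∀ c r → ∃ λ r′ → comp (X+ c) r ≋ r′ × length r′ ≤ length r
  comp-X+-length c r with normalForm r
  ... | null r≋[] = [] , comp-≋[] (X+ c) r r≋[] , z≤n
  ... | leading d l _ r≋ l<r = scale d (monic (shift c l)) , (begin
    comp (X+ c) r  ≈⟨ comp-cong (X+ c) r≋ ⟩
    comp (X+ c) (scale d (monic l))  ≈⟨ comp-scale (X+ c) d (monic l) ⟩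
    scale d (comp (X+ c) (monic l))  ≈⟨ scale-cong refl (monic-shift c l) ⟨
    scale d (monic (shift c l))  ∎)
    , subst (_≤ length r) (sym (trans (ListP.length-map (d *_) (monic (shift c l))) (trans (length-monic (shift c l)) (cong suc (length-shift c l))))) l<r
    where open ≋-Reasoning

  open SemiringMult (CommutativeRing.semiring scalarRing) public
    using (×-homo-+; ×-assocˡ; ×1-homo-*; ×-assoc-*) renaming (_×_ to infixr 8 _∙_)

  module ScalarGroup = AbelianGroupProperties (CommutativeRing.+-abelianGroup scalarRing)

  ∙-0 : ∀ n → n ∙ 0# ≡ 0#
  ∙-0 zero    = refl
  ∙-0 (suc n) = trans (+-identityˡ _) (∙-0 n)

  iterate-shift : ∀ a i l → iterate monicMonoid (shift a) i l ≡ shift (i ∙ a) l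
  iterate-shift a zero    l = sym (shift-0 l)
  iterate-shift a (suc i) l = trans (cong (shift a) (iterate-shift a i l)) (shift-shift a (i ∙ a) l)

  -- The polynomial L and invariance under translation by a

  module Linearized {p : ℕ} (p-prime : Prime p) {a : Fin q} (pa≡0 : p ∙ a ≡ 0#) (a≢0 : a ≢ 0#) where

    private
      0<p : 0 < p
      0<p = ℕ.>-nonZero⁻¹ p {{prime⇒nonZero p-prime}}

    multiple≢0 : ∀ {k} → 0 < k → k < p → k ∙ a ≢ 0#
    multiple≢0 {k} 0<k k<p ka≡0 with coprime-Bézout (prime⇒coprime p-prime {{ℕ.>-nonZero 0<k}} k<p)
    ... | Bézout.+- x y 1+yk≡xp = a≢0 (begin
      a  ≡⟨ +-identityʳ a ⟨
      a + 0#  ≡⟨ cong (a +_) (trans (sym (×-assocˡ a y k)) (trans (cong (y ∙_) ka≡0) (∙-0 y))) ⟨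
      (1 ℕ.+ y ℕ.* k) ∙ a  ≡⟨ cong (_∙ a) 1+yk≡xp ⟩
      (x ℕ.* p) ∙ a  ≡⟨ trans (sym (×-assocˡ a x p)) (trans (cong (x ∙_) pa≡0) (∙-0 x)) ⟩
      0#  ∎)
      where open ≡-Reasoning
    ... | Bézout.-+ x y 1+xp≡yk = a≢0 (begin
      a  ≡⟨ +-identityʳ a ⟨
      a + 0#  ≡⟨ cong (a +_) (trans (sym (×-assocˡ a x p)) (trans (cong (x ∙_) pa≡0) (∙-0 x))) ⟨
      (1 ℕ.+ x ℕ.* p) ∙ a  ≡⟨ cong (_∙ a) 1+xp≡yk ⟩
      (y ℕ.* k) ∙ a  ≡⟨ trans (sym (×-assocˡ a y k)) (trans (cong (y ∙_) ka≡0) (∙-0 y)) ⟩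
      0#  ∎)
      where open ≡-Reasoning

    multiples-distinct : ∀ {i j} → i < j → j < p → i ∙ a ≢ j ∙ a
    multiples-distinct {i} {j} i<j j<p eq = multiple≢0 (ℕP.m<n⇒0<n∸m i<j) (ℕP.≤-<-trans (ℕP.m∸n≤m j i) j<p)
      (ScalarGroup.∙-cancelˡ (i ∙ a) ((j ∸ i) ∙ a) 0# (begin
        i ∙ a + (j ∸ i) ∙ a  ≡⟨ ×-homo-+ a i (j ∸ i) ⟨
        (i ℕ.+ (j ∸ i)) ∙ a  ≡⟨ cong (_∙ a) (ℕP.m+[n∸m]≡n (ℕP.<⇒≤ i<j)) ⟩
        j ∙ a  ≡⟨ eq ⟨
        i ∙ a  ≡⟨ +-identityʳ (i ∙ a) ⟨
        i ∙ a + 0#  ∎))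
      where open ≡-Reasoning

    -- L = ∏_{i < p} (x + i a), the polynomial x^p − a^(p−1) x.

    L : Pol
    L = ∏ p (λ i → i ∙ a ∷ [])

    length-L : length L ≡ p
    length-L = trans (deg-∏ p _ 1 (λ _ → refl)) (ℕP.*-identityʳ p)

    0<L : 0 < length L
    0<L = subst (0 <_) (sym length-L) 0<p

    -- Translation moves the factor x + i a to x + (i + 1) a, and the last one wraps around because
    -- p a = 0. The extra factor x on both sides completes the cycle for `∏-suc` and is then
    -- cancelled.
    L-invariant : shift a L ≡ L
    L-invariant = ⊗-cancelˡ (0# ∷ []) (begin
      (0# ∷ []) ⊗ shift a L  ≡⟨ cong ((0# ∷ []) ⊗_) (Automorphism.fun-∏ (shiftAut a) p _) ⟩
      (0# ∷ []) ⊗ ∏ p (λ i → shift a (i ∙ a ∷ []))  ≡⟨ cong ((0# ∷ []) ⊗_) (∏-cong p (λ i → trans (shift-linear a (i ∙ a)) (cong (_∷ []) (+-comm (i ∙ a) a)))) ⟩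
      (0# ∷ []) ⊗ ∏ p (λ i → suc i ∙ a ∷ [])  ≡⟨ ∏-suc p (λ i → i ∙ a ∷ []) ⟩
      (p ∙ a ∷ []) ⊗ L  ≡⟨ cong (λ c → (c ∷ []) ⊗ L) pa≡0 ⟩
      (0# ∷ []) ⊗ L  ∎)
      where open ≡-Reasoning

    -- An invariant polynomial takes the same value at the p points − i a.

    invariant-small⇒constant : ∀ r → length r ≤ p → comp (X+ a) r ≋ r → ∃ λ e → r ≋ e ∷ []
    invariant-small⇒constant []      _   _   = 0# , ≋-sym (∷-≋[] refl ≋-refl)
    invariant-small⇒constant (e ∷ r) r<p inv = e , e∷r≋
      where
      open ≋-Reasoning
      ev : Fin q → Pol → Pol
      ev c = comp (c ∷ [])
      ev-shift : ∀ c → ev (c + a) (e ∷ r) ≋ ev c (e ∷ r)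
      ev-shift c = begin
        ev (c + a) (e ∷ r)  ≈⟨ comp-congˡ (e ∷ r) (≋-trans (comp-linear (c ∷ []) a) (∷-cong (+-comm a c) ≋-refl)) ⟨
        comp (ev c (X+ a)) (e ∷ r)  ≈⟨ comp-comp (c ∷ []) (X+ a) (e ∷ r) ⟨
        ev c (comp (X+ a) (e ∷ r))  ≈⟨ comp-cong (c ∷ []) inv ⟩
        ev c (e ∷ r)  ∎
      ev-0 : ev 0# (e ∷ r) ≋ e ∷ []
      ev-0 = begin
        (e ∷ []) +ₚ (0# ∷ []) *ₚ ev 0# r  ≈⟨ +ₚ-cong (≋-refl {e ∷ []}) (≋-trans (constant-*ₚ 0# (ev 0# r)) (scale-0 (ev 0# r))) ⟩
        (e ∷ []) +ₚ []  ∎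
      ev-multiple : ∀ i → ev (- (i ∙ a)) (e ∷ r) ≋ e ∷ []
      ev-multiple zero = ≋-trans (≡⇒≋ (cong (λ c → ev c (e ∷ r)) ScalarGroup.ε⁻¹≈ε)) ev-0
      ev-multiple (suc i) = begin
        ev (- (a + i ∙ a)) (e ∷ r)  ≈⟨ ev-shift (- (a + i ∙ a)) ⟨
        ev (- (a + i ∙ a) + a) (e ∷ r)  ≡⟨ cong (λ c → ev c (e ∷ r)) (trans (cong (_+ a) (ScalarGroup.⁻¹-anti-homo-∙ a (i ∙ a))) (trans (+-assoc _ _ a) (trans (cong (- (i ∙ a) +_) (-‿inverseˡ a)) (+-identityʳ _)))) ⟩
        ev (- (i ∙ a)) (e ∷ r)  ≈⟨ ev-multiple i ⟩
        e ∷ []  ∎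
      split : e ∷ r ≋ (e ∷ []) +ₚ (0# ∷ r)
      split = ∷-cong (sym (+-identityʳ e)) ≋-refl
      root : ∀ i → ev (- (i ∙ a)) (0# ∷ r) ≋ []
      root i = PolGroup.∙-cancelˡ (e ∷ []) (ev (- (i ∙ a)) (0# ∷ r)) [] (begin
        (e ∷ []) +ₚ ev (- (i ∙ a)) (0# ∷ r)  ≈⟨ +ₚ-cong (comp-constant (- (i ∙ a) ∷ []) e) (≋-refl {ev (- (i ∙ a)) (0# ∷ r)}) ⟨
        ev (- (i ∙ a)) (e ∷ []) +ₚ ev (- (i ∙ a)) (0# ∷ r)  ≈⟨ comp-+ (- (i ∙ a) ∷ []) (e ∷ []) (0# ∷ r) ⟨
        ev (- (i ∙ a)) ((e ∷ []) +ₚ (0# ∷ r))  ≈⟨ comp-cong (- (i ∙ a) ∷ []) split ⟨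
        ev (- (i ∙ a)) (e ∷ r)  ≈⟨ ev-multiple i ⟩
        (e ∷ []) +ₚ []  ∎)
      e∷r≋ : e ∷ r ≋ e ∷ []
      e∷r≋ with normalForm (0# ∷ r)
      ... | null eq = ≋-trans split (+ₚ-cong (≋-refl {e ∷ []}) eq)
      -- A nonzero nonconstant part would vanish at all p points -i a, so L would divide its monic
      -- normalisation l, whose degree is less than p.
      ... | leading c l c≢0 eq l<r = ⊥-elim (ℕP.<⇒≱ (ℕP.<-≤-trans l<r r<p)
              (subst (_≤ length l) length-L (∣⇒deg≤ {L} {l} (∏-∣ p _ l (λ i _ → linear-Irr (i ∙ a))
                (λ i<j j<p eq → multiples-distinct i<j j<p (ListP.∷-injectiveˡ eq))
                (λ i _ → root⇒linear-factor (i ∙ a) l (root-l i))))))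
        where
        root-l : ∀ i → ev (- (i ∙ a)) (monic l) ≋ []
        root-l i = begin
          ev (- (i ∙ a)) (monic l)  ≈⟨ scale-1 _ ⟨
          scale 1# (ev (- (i ∙ a)) (monic l))  ≈⟨ scale-cong (trans (*-comm _ c) (proj₂ (inverse c c≢0))) ≋-refl ⟨
          scale (c⁻¹ * c) (ev (- (i ∙ a)) (monic l))  ≈⟨ scale-scale c⁻¹ c _ ⟨
          scale c⁻¹ (scale c (ev (- (i ∙ a)) (monic l)))  ≈⟨ scale-cong refl (≋-trans (≋-sym (comp-scale (- (i ∙ a) ∷ []) c (monic l))) (≋-trans (comp-cong (- (i ∙ a) ∷ []) (≋-sym eq)) (root i))) ⟩
          []  ∎
          where c⁻¹ = proj₁ (inverse c c≢0)

    L-monic-invariant : comp (X+ a) (monic L) ≋ monic L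
    L-monic-invariant = ≋-trans (≋-sym (monic-shift a L)) (≡⇒≋ (cong monic L-invariant))

    -- Write l = L k + r. Translation yields another division of the same polynomial by L, so by
    -- uniqueness k and r are invariant. Then r is a constant e, and k is treated recursively: if k
    -- = g(L), then l = e + L g(L).
    invariant⇒compose : ∀ l → shift a l ≡ l → ∃ λ g → compose L g ≡ l
    invariant⇒compose l = go (length l) l ℕP.≤-refl
      where
      open ≋-Reasoning
      go : ∀ n l → length l ≤ n → shift a l ≡ l → ∃ λ g → compose L g ≡ l
      go n l l≤n inv with divide L (monic l)
      ... | k , r , l≋ , r-len with comp-X+-length a r
      ...   | r′ , r′≋ , r′≤ with divide-unique L {comp (X+ a) k} {k} {r′} {r} (begin
        monic L *ₚ comp (X+ a) k +ₚ r′  ≈⟨ +ₚ-cong (*ₚ-cong L-monic-invariant ≋-refl) r′≋ ⟨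
        comp (X+ a) (monic L) *ₚ comp (X+ a) k +ₚ comp (X+ a) r  ≈⟨ +ₚ-cong (comp-* (X+ a) (monic L) k) ≋-refl ⟨
        comp (X+ a) (monic L *ₚ k) +ₚ comp (X+ a) r  ≈⟨ comp-+ (X+ a) (monic L *ₚ k) r ⟨
        comp (X+ a) (monic L *ₚ k +ₚ r)  ≈⟨ comp-cong (X+ a) l≋ ⟨
        comp (X+ a) (monic l)  ≈⟨ monic-shift a l ⟨
        monic (shift a l)  ≡⟨ cong monic inv ⟩
        monic l  ≈⟨ l≋ ⟩
        monic L *ₚ k +ₚ r  ∎)
        (subst (length r′ ≤_) r-len r′≤) (ℕP.≤-reflexive r-len)
      ...     | k-inv , r′≋r with invariant-small⇒constant r (ℕP.≤-reflexive (trans r-len length-L)) (≋-trans r′≋ r′≋r)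
      ...       | e , r≋ with normalForm k
      -- Without quotient the monic polynomial is the constant e, hence 1, which the empty list
      -- represents.
      ...         | null k≋[] = [] , proj₂ (scale-monic-injective {e} [] l (begin
        e * 1# ∷ []  ≈⟨ ∷-cong (*-identityʳ e) ≋-refl ⟩
        e ∷ []  ≈⟨ +ₚ-cong (≋-trans (*ₚ-congʳ (monic L) k≋[]) (*ₚ-zeroʳ (monic L))) r≋ ⟨
        monic L *ₚ k +ₚ r  ≈⟨ l≋ ⟨
        monic l  ∎))
      -- The constant e is divided by c to fit inside a monic polynomial; the comparison with
      -- `monic l` then yields c = 1.
      ...         | leading c u c≢0 k≋ _ with scale-monic-injective ((c⁻¹e ∷ []) +ₚ L ⊗ u) l (begin
        scale c (monic ((c⁻¹e ∷ []) +ₚ L ⊗ u))  ≡⟨ cong (scale c) (monic-+ (c⁻¹e ∷ []) (L ⊗ u) (length-H⊗ L u 0<L)) ⟩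
        scale c ((c⁻¹e ∷ []) +ₚ monic (L ⊗ u))  ≈⟨ scale-+ c (c⁻¹e ∷ []) (monic (L ⊗ u)) ⟩
        (c * c⁻¹e ∷ []) +ₚ scale c (monic (L ⊗ u))  ≈⟨ +ₚ-cong (∷-cong {f = []} (inverse-* c≢0 e) ≋-refl) (≋-sym (monic-*-scale L c u)) ⟩
        (e ∷ []) +ₚ monic L *ₚ scale c (monic u)  ≈⟨ +ₚ-comm (e ∷ []) _ ⟩
        monic L *ₚ scale c (monic u) +ₚ (e ∷ [])  ≈⟨ +ₚ-cong (*ₚ-congʳ (monic L) k≋) r≋ ⟨
        monic L *ₚ k +ₚ r  ≈⟨ l≋ ⟨
        monic l  ∎)
        where c⁻¹e = proj₁ (inverse c c≢0) * e
      go zero l l≤0 inv | k , r , l≋ , r-len | r′ , r′≋ , r′≤ | k-inv , r′≋r | e , r≋ | leading c u c≢0 k≋ _ | refl , refl =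
        ⊥-elim (ℕP.<⇒≱ 0<l l≤0)
        where
        0<l : 0 < length ((proj₁ (inverse c c≢0) * e ∷ []) +ₚ L ⊗ u)
        0<l = subst (0 <_) (sym (+ₚ-length (proj₁ (inverse c c≢0) * e ∷ []) (L ⊗ u))) (ℕP.m≤m⊔n 1 (length (L ⊗ u)))
      go (suc n) l l≤n inv | k , r , l≋ , r-len | r′ , r′≋ , r′≤ | k-inv , r′≋r | e , r≋ | leading c u c≢0 k≋ _ | refl , refl
        with go n u u≤n (monic-injective (begin
          monic (shift a u)  ≈⟨ monic-shift a u ⟩
          comp (X+ a) (monic u)  ≈⟨ comp-cong (X+ a) k≋u ⟨
          comp (X+ a) k  ≈⟨ k-inv ⟩
          k  ≈⟨ k≋u ⟩
          monic u  ∎))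
        where
        k≋u : k ≋ monic u
        k≋u = ≋-trans k≋ (scale-1 (monic u))
        u≤n : length u ≤ n
        u≤n = ℕP.≤-pred (ℕP.≤-trans (subst (suc (length u) ≤_) (sym len) (ℕP.+-monoˡ-≤ (length u) 0<L)) l≤n)
          where
          len : length ((proj₁ (inverse c c≢0) * e ∷ []) +ₚ L ⊗ u) ≡ length L ℕ.+ length u
          len = trans (+ₚ-length (proj₁ (inverse c c≢0) * e ∷ []) (L ⊗ u)) (trans (ℕP.m≤n⇒m⊔n≡n (length-H⊗ L u 0<L)) (length-⊗ L u))
      ... | g , refl = proj₁ (inverse c c≢0) * e ∷ g , refl

    shiftPrimeOrder : PrimeOrder monicMonoid p
    shiftPrimeOrder = record
      { τ = shiftAut a
      ; prime = p-prime
      ; period = λ l → trans (iterate-shift a p l) (trans (cong (λ c → shift c l) pa≡0) (shift-0 l))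
      ; ι = compose L
      ; ι-· = λ x y → compose-⊗ L x y 0<L
      ; ι-injective = compose-injective L 0<L
      ; deg-ι = λ g → trans (length-compose L g 0<L) (cong (ℕ._* length g) length-L)
      ; τ-ι = λ g → monic-injective (begin
          monic (shift a (compose L g))  ≈⟨ ≋-trans (monic-shift a (compose L g)) (comp-cong (X+ a) (monic-compose L g 0<L)) ⟩
          comp (X+ a) (comp (monic L) (monic g))  ≈⟨ comp-comp (X+ a) (monic L) (monic g) ⟩
          comp (comp (X+ a) (monic L)) (monic g)  ≈⟨ comp-congˡ (monic g) L-monic-invariant ⟩
          comp (monic L) (monic g)  ≈⟨ monic-compose L g 0<L ⟨
          monic (compose L g)  ∎)
      ; descend = invariant⇒compose }
      where open ≋-Reasoning

    -- L(x + b) − L(x) is invariant of degree less than p, hence constant.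

    module _ (b : Fin q) where

      private
        open ≋-Reasoning
        D : Pol
        D = shift b L +ₚ negate L
        D≤p : length D ≤ p
        D≤p = ℕP.≤-reflexive (trans (+ₚ-length (shift b L) (negate L)) (trans (cong₂ _⊔_ (length-shift b L) (ListP.length-map -_ L)) (trans (ℕP.⊔-idem (length L)) length-L)))
        -- Subtracting lower coefficients cancels the leading 1s implicitly, which is why `D` has at
        -- most p coefficients.
        difference : ∀ u v → length u ≡ length v → u +ₚ negate v ≋ monic u +ₚ negate (monic v)
        difference []      []      _  = ≋-sym (∷-≋[] (-‿inverseʳ 1#) ≋-refl)
        difference (x ∷ u) (y ∷ v) eq = ∷-cong refl (difference u v (ℕP.suc-injective eq))
        D≋ : D ≋ comp (X+ b) (monic L) +ₚ negate (monic L)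
        D≋ = ≋-trans (difference (shift b L) L (length-shift b L)) (+ₚ-cong (monic-shift b L) ≋-refl)
        D-invariant : comp (X+ a) D ≋ D
        D-invariant = begin
          comp (X+ a) D  ≈⟨ comp-cong (X+ a) D≋ ⟩
          comp (X+ a) (comp (X+ b) (monic L) +ₚ negate (monic L))  ≈⟨ comp-+ (X+ a) (comp (X+ b) (monic L)) (negate (monic L)) ⟩
          comp (X+ a) (comp (X+ b) (monic L)) +ₚ comp (X+ a) (negate (monic L))  ≈⟨ +ₚ-cong (comp-X+-comm a b (monic L)) (comp-negate (X+ a) (monic L)) ⟩
          comp (X+ b) (comp (X+ a) (monic L)) +ₚ negate (comp (X+ a) (monic L))  ≈⟨ +ₚ-cong (comp-cong (X+ b) L-monic-invariant) (negate-cong L-monic-invariant) ⟩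
          comp (X+ b) (monic L) +ₚ negate (monic L)  ≈⟨ D≋ ⟨
          D  ∎
        D-constant : ∃ λ e → D ≋ e ∷ []
        D-constant = invariant-small⇒constant D D≤p D-invariant

      -- The value L(b): put x = 0 in L(x + b) = L(x) + e, where L(0) = 0.
      L-at : Fin q
      L-at = proj₁ D-constant

      L-shift : comp (X+ b) (monic L) ≋ (L-at ∷ []) +ₚ monic L
      L-shift = begin
        comp (X+ b) (monic L)  ≈⟨ PolGroup.//-rightDividesˡ (monic L) (comp (X+ b) (monic L)) ⟨
        comp (X+ b) (monic L) +ₚ negate (monic L) +ₚ monic L  ≈⟨ +ₚ-cong D≋ ≋-refl ⟨
        D +ₚ monic L  ≈⟨ +ₚ-cong (proj₂ D-constant) ≋-refl ⟩
        (L-at ∷ []) +ₚ monic L  ∎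

      -- From g(L(x + b)) = g(L(x) + L(b)): on the polynomials g, translation by b acts as
      -- translation by L(b).
      shift-compose : ∀ g → shift b (compose L g) ≡ compose L (shift L-at g)
      shift-compose g = monic-injective (begin
        monic (shift b (compose L g))  ≈⟨ ≋-trans (monic-shift b (compose L g)) (comp-cong (X+ b) (monic-compose L g 0<L)) ⟩
        comp (X+ b) (comp (monic L) (monic g))  ≈⟨ comp-comp (X+ b) (monic L) (monic g) ⟩
        comp (comp (X+ b) (monic L)) (monic g)  ≈⟨ comp-congˡ (monic g) (≋-trans L-shift (≋-sym (comp-linear (monic L) L-at))) ⟩
        comp (comp (monic L) (X+ L-at)) (monic g)  ≈⟨ comp-comp (monic L) (X+ L-at) (monic g) ⟨
        comp (monic L) (comp (X+ L-at) (monic g))  ≈⟨ comp-cong (monic L) (monic-shift L-at g) ⟨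
        comp (monic L) (monic (shift L-at g))  ≈⟨ monic-compose L (shift L-at g) 0<L ⟨
        monic (compose L (shift L-at g))  ∎)

      -- If L(b) were 0, L would be invariant under b. Its factor x would move to a factor x + b,
      -- which is one of the x + i a, contrary to the choice of b.
      L-at≢0 : (∀ i → i < p → b ≢ i ∙ a) → L-at ≢ 0#
      L-at≢0 b∉ eq = conclude (Irr-∣-∏ p (λ i → i ∙ a ∷ []) (linear-Irr b) (subst (b ∷ [] ∣_) L-fixed b∣))
        where
        L-fixed : shift b L ≡ L
        L-fixed = monic-injective (begin
          monic (shift b L)  ≈⟨ monic-shift b L ⟩
          comp (X+ b) (monic L)  ≈⟨ L-shift ⟩
          (L-at ∷ []) +ₚ monic L  ≈⟨ +ₚ-cong (∷-≋[] {f = []} eq ≋-refl) ≋-refl ⟩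
          monic L  ∎)
        b∣ : (b ∷ []) ∣ shift b L
        b∣ = subst (_∣ shift b L) {shift b (0# ∷ [])} {b ∷ []} (trans (shift-linear b 0#) (cong (_∷ []) (+-identityˡ b)))
               (Automorphism.fun-∣ (shiftAut b) {0# ∷ []} {L} (∣-∏ {p} {0} (λ i → i ∙ a ∷ []) 0<p))
        conclude : ∃ (λ i → i < p × (b ∷ []) ∣ (i ∙ a ∷ [])) → ⊥
        conclude (i , i<p , b∣i) = b∉ i i<p (ListP.∷-injectiveˡ (Irr-∣⇒≡ {b ∷ []} {i ∙ a ∷ []} (λ ()) (linear-Irr (i ∙ a)) b∣i))

-- Invariant irreducible polynomials

open import Data.Fin.Subset using (∣_∣)

module _ {A : Set} (_≟_ : DecidableEquality A) {xs ys : List A} (uxs : Unique xs) (uys : Unique ys) (xs⊆ys : ∀ {x} → x ∈ xs → x ∈ ys) where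
  open import Data.List.Membership.DecPropositional _≟_ using (_∈?_)

  private
    length-filter-∈ : length (filter (_∈? xs) ys) ≡ length xs
    length-filter-∈ = ℤP.+-injective (trans (length-filter-∑ (_∈? xs) ys)
      (∑-𝟙-enumerate _≟_ (_∈? xs) uys uxs (λ _ _ x∈ → x∈) (λ _ x∈ → xs⊆ys x∈ , x∈)))

  ⊆-outside : length xs < length ys → ∃ λ y → y ∈ ys × y ∉ xs
  ⊆-outside xs<ys with any? (λ y → ¬? (y ∈? xs)) ys
  ... | yes found = find found
  ... | no none   = ⊥-elim (ℕP.<⇒≢ xs<ys (trans (sym length-filter-∈) (cong length (ListP.filter-all (_∈? xs) (All.tabulate inside)))))
    where
    inside : ∀ {y} → y ∈ ys → y ∈ xs
    inside {y} y∈ with y ∈? xs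
    ... | yes y∈xs = y∈xs
    ... | no y∉xs  = ⊥-elim (none (lose y∈ y∉xs))

  ⊆-covers : length xs ≡ length ys → ∀ {y} → y ∈ ys → y ∈ xs
  ⊆-covers eq {y} y∈ with y ∈? xs
  ... | yes y∈xs = y∈xs
  ... | no y∉xs  = ⊥-elim (ℕP.<⇒≢ (ListP.filter-notAll (_∈? xs) ys (lose y∈ y∉xs)) (trans length-filter-∈ eq))

members : ∀ {n} → Subset n → List (Fin n)
members []          = []
members (true ∷ S)  = zero ∷ map suc (members S)
members (false ∷ S) = map suc (members S)

length-members : ∀ {n} (S : Subset n) → length (members S) ≡ ∣ S ∣
length-members []          = refl
length-members (true ∷ S)  = cong suc (trans (ListP.length-map suc (members S)) (length-members S))
length-members (false ∷ S) = trans (ListP.length-map suc (members S)) (length-members S)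

members-unique : ∀ {n} (S : Subset n) → Unique (members S)
members-unique []          = []
members-unique (true ∷ S)  = All.tabulate zero∉ ∷ map⁺ FinP.suc-injective (members-unique S)
  where
  zero∉ : ∀ {i} → i ∈ map suc (members S) → zero ≢ i
  zero∉ i∈ refl with ∈-map⁻ suc i∈
  ... | _ , _ , ()
members-unique (false ∷ S) = map⁺ FinP.suc-injective (members-unique S)

∈-members⁺ : ∀ {n} {S : Subset n} {i} → i ∈ₛ S → i ∈ members S
∈-members⁺ {S = true ∷ S}  here        = here refl
∈-members⁺ {S = true ∷ S}  (there i∈S) = there (∈-map⁺ suc (∈-members⁺ i∈S))
∈-members⁺ {S = false ∷ S} (there i∈S) = ∈-map⁺ suc (∈-members⁺ i∈S)

∈-members⁻ : ∀ {n} {S : Subset n} {i} → i ∈ members S → i ∈ₛ S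
∈-members⁻ {S = true ∷ S}  (here refl) = here
∈-members⁻ {S = true ∷ S}  (there i∈) with ∈-map⁻ suc i∈
... | _ , j∈ , refl = there (∈-members⁻ j∈)
∈-members⁻ {S = false ∷ S} i∈ with ∈-map⁻ suc i∈
... | _ , j∈ , refl = there (∈-members⁻ j∈)

HasSize-empty : {A : Set} {P : A → Set} → (∀ x → ¬ P x) → HasSize P 0
HasSize-empty none = [] , [] , (λ x → mk⇔ (λ ()) (λ Px → ⊥-elim (none x Px))) , refl

-- The characteristic, and irreducibility in the sense of the theorem

module _ {q : ℕ} (F : FiniteField q) where
  open Translations F

  private
    module ScalarSum = CommutativeMonoidSum (CommutativeRing.+-commutativeMonoid scalarRing)

  -- Translation by 1 permutes the field, so the sum of all elements does not change when q times 1
  -- is added to it.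
  q∙1≡0 : q ∙ 1# ≡ 0#
  q∙1≡0 = ScalarGroup.∙-cancelˡ (sum (λ x → x)) (q ∙ 1#) 0# (begin
    sum (λ x → x) + q ∙ 1#  ≡⟨ cong (sum (λ x → x) +_) (ScalarSum.sum-replicate q) ⟨
    sum (λ x → x) + sum (λ _ → 1#)  ≡⟨ ScalarSum.∑-distrib-+ (λ x → x) (λ _ → 1#) ⟨
    sum (λ x → x + 1#)  ≡⟨ ScalarSum.sum-permute (λ x → x) translation ⟨
    sum (λ x → x)  ≡⟨ +-identityʳ _ ⟨
    sum (λ x → x) + 0#  ∎)
    where
    open ≡-Reasoning
    sum : (Fin q → Fin q) → Fin q
    sum = ScalarSum.sum
    translation = permutation (_+ 1#) (_+ - 1#)
      (λ x → trans (+-assoc x (- 1#) 1#) (trans (cong (x +_) (-‿inverseˡ 1#)) (+-identityʳ x)))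
      (λ x → trans (+-assoc x 1# (- 1#)) (trans (cong (x +_) (-‿inverseʳ 1#)) (+-identityʳ x)))

  *-integral : ∀ x y → x * y ≡ 0# → x ≡ 0# ⊎ y ≡ 0#
  *-integral x y xy≡0 with x FinP.≟ 0#
  ... | yes x≡0 = inj₁ x≡0
  ... | no x≢0  = inj₂ (begin
    y  ≡⟨ inverse-* x≢0 y ⟨
    x * (x⁻¹ * y)  ≡⟨ *-assoc x x⁻¹ y ⟨
    x * x⁻¹ * y  ≡⟨ cong (_* y) (*-comm x x⁻¹) ⟩
    x⁻¹ * x * y  ≡⟨ *-assoc x⁻¹ x y ⟩
    x⁻¹ * (x * y)  ≡⟨ trans (cong (x⁻¹ *_) xy≡0) (zeroʳ x⁻¹) ⟩
    0#  ∎)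
    where
    open ≡-Reasoning
    x⁻¹ = proj₁ (inverse x x≢0)

  p^k∙1≡0⇒p∙1≡0 : ∀ p k → (p ^ k) ∙ 1# ≡ 0# → p ∙ 1# ≡ 0#
  p^k∙1≡0⇒p∙1≡0 p zero    eq = ⊥-elim (0≢1 (trans (sym eq) (+-identityʳ 1#)))
  p^k∙1≡0⇒p∙1≡0 p (suc k) eq with *-integral (p ∙ 1#) ((p ^ k) ∙ 1#) (trans (sym (×1-homo-* p (p ^ k))) eq)
  ... | inj₁ p≡0  = p≡0
  ... | inj₂ pk≡0 = p^k∙1≡0⇒p∙1≡0 p k pk≡0

  characteristic : ∀ p k → q ≡ p ^ k → ∀ x → p ∙ x ≡ 0#
  characteristic p k q≡p^k x = begin
    p ∙ x  ≡⟨ cong (p ∙_) (*-identityˡ x) ⟨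
    p ∙ (1# * x)  ≡⟨ ×-assoc-* p 1# x ⟨
    (p ∙ 1#) * x  ≡⟨ cong (_* x) (p^k∙1≡0⇒p∙1≡0 p k (subst (λ n → n ∙ 1# ≡ 0#) q≡p^k q∙1≡0)) ⟩
    0# * x  ≡⟨ zeroˡ x ⟩
    0#  ∎
    where open ≡-Reasoning

  unit⇒constant : ∀ y → IsUnit (monic y) → length y ≡ 0
  unit⇒constant y (u , p) with ∣ₚ⇒∣ y [] (u , mk p)
  ... | w , yw≡[] = ℕP.m+n≡0⇒m≡0 (length y) (trans (sym (length-⊗ y w)) (cong length yw≡[]))

  constant⇒unit : ∀ {c g} → c ≢ 0# → g ≋ scale c one → IsUnit g
  constant⇒unit {c} {g} c≢0 g≋ = c⁻¹ ∷ [] , at (begin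
    g *ₚ (c⁻¹ ∷ [])  ≈⟨ *ₚ-cong g≋ (≋-refl {c⁻¹ ∷ []}) ⟩
    scale c one *ₚ (c⁻¹ ∷ [])  ≈⟨ scale-*ₚ c one (c⁻¹ ∷ []) ⟩
    scale c (one *ₚ (c⁻¹ ∷ [])) ≈⟨ scale-cong refl (*ₚ-identityˡ (c⁻¹ ∷ [])) ⟩
    c * c⁻¹ ∷ []  ≡⟨ cong (_∷ []) (proj₂ (inverse c c≢0)) ⟩
    one  ∎)
    where
    open ≋-Reasoning
    c⁻¹ = proj₁ (inverse c c≢0)

  Irreducible⇒Irr : ∀ l → Irreducible (monic l) → Irr l
  Irreducible⇒Irr l (_ , ¬unit , factor) = l≢0 , split
    where
    l≢0 : length l ≢ 0
    l≢0 eq with length≡0 {l} eq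
    ... | refl = ¬unit (one , at (*ₚ-identityˡ one))
    split : ∀ y z → y ⊗ z ≡ l → length y ≡ 0 ⊎ length z ≡ 0
    split y z refl with factor (monic y) (monic z) (at (≋-sym (monic-⊗ y z)))
    ... | inj₁ unit = inj₁ (unit⇒constant y unit)
    ... | inj₂ unit = inj₂ (unit⇒constant z unit)

  -- Arbitrary factors g and h are scalar multiples of monic ones, whose product is then `monic l`.
  -- One of these has degree 0, so g or h is a nonzero constant and thus a unit.
  Irr⇒Irreducible : ∀ l → Irr l → Irreducible (monic l)
  Irr⇒Irreducible l (l≢0 , split) = (λ eq → monic≉[] l (mk eq)) , (λ unit → l≢0 (unit⇒constant l unit)) , factor
    where
    factor : ∀ g h → (g *ₚ h) ≈ₚ monic l → IsUnit g ⊎ IsUnit h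
    factor g h eq with normalForm g | normalForm h
    ... | null g≋[] | _ = ⊥-elim (monic≉[] l (≋-trans (≋-sym (mk eq)) (*ₚ-cong {g = h} g≋[] ≋-refl)))
    ... | leading _ _ _ _ _ | null h≋[] = ⊥-elim (monic≉[] l (≋-trans (≋-sym (mk eq)) (≋-trans (*ₚ-congʳ g h≋[]) (*ₚ-zeroʳ g))))
    ... | leading c y c≢0 g≋ _ | leading d z d≢0 h≋ _
      with split y z (proj₂ (scale-monic-injective {c * d} (y ⊗ z) l (begin
        scale (c * d) (monic (y ⊗ z))  ≈⟨ scale-scale c d (monic (y ⊗ z)) ⟨
        scale c (scale d (monic (y ⊗ z)))  ≈⟨ scale-cong refl (monic-*-scale y d z) ⟨
        scale c (monic y *ₚ scale d (monic z))  ≈⟨ scale-*ₚ c (monic y) (scale d (monic z)) ⟨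
        scale c (monic y) *ₚ scale d (monic z)  ≈⟨ *ₚ-cong g≋ h≋ ⟨
        g *ₚ h  ≈⟨ mk eq ⟩
        monic l  ∎)))
      where open ≋-Reasoning
    ...   | inj₁ y≡0 = inj₁ (constant⇒unit c≢0 (subst (λ y → g ≋ scale c (monic y)) (length≡0 {y} y≡0) g≋))
    ...   | inj₂ z≡0 = inj₂ (constant⇒unit d≢0 (subst (λ z → h ≋ scale d (monic z)) (length≡0 {z} z≡0) h≋))

  translate⇒shift : ∀ s l → translate s (monic l) ≈ₚ monic l → shift s l ≡ l
  translate⇒shift s l eq = monic-injective (begin
    monic (shift s l)  ≈⟨ monic-shift s l ⟩
    comp (X+ s) (monic l)  ≡⟨ translate-comp s (monic l) ⟨
    translate s (monic l)  ≈⟨ mk eq ⟩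
    monic l  ∎)
    where open ≋-Reasoning

  shift⇒translate : ∀ s l → shift s l ≡ l → translate s (monic l) ≈ₚ monic l
  shift⇒translate s l eq = at (begin
    translate s (monic l)  ≡⟨ translate-comp s (monic l) ⟩
    comp (X+ s) (monic l)  ≈⟨ monic-shift s l ⟨
    monic (shift s l)  ≡⟨ cong monic eq ⟩
    monic l  ∎)
    where open ≋-Reasoning

open import Data.Integer using (+_)
open import Data.Nat.Divisibility using (_∣_; divides; _∣?_)

-- Counting irreducibles invariant under one or two translations

module _ {q : ℕ} (F : FiniteField q) where
  open Translations F hiding (_∣_)

  module _ {p : ℕ} (p-prime : Prime p) (char : ∀ x → p ∙ x ≡ 0#) where
    open FactorialMonoid monicMonoid using (I; I-⋆-𝟏; _≟_; elements; ∈-elements⁻; ∈-elements⁺)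

    private
      instance
        p-nonZero : ℕ.NonZero p
        p-nonZero = prime⇒nonZero p-prime

      1<p : 1 < p
      1<p = ℕ.nonTrivial⇒n>1 p {{prime⇒nonTrivial p-prime}}

      module Lin {a} (a≢0 : a ≢ 0#) = Linearized p-prime (char a) a≢0
      module Ord {a} (a≢0 : a ≢ 0#) = PrimeOrder (Lin.shiftPrimeOrder a≢0)

      D : Fin q → ℕ → ℤ
      D a = fixed monicMonoid (shift a)

    shift-fixed⇒p∣deg : ∀ {a l} → a ≢ 0# → shift a l ≡ l → p ∣ length l
    shift-fixed⇒p∣deg {a} {l} a≢0 eq with Lin.invariant⇒compose a≢0 l eq
    ... | g , refl = divides (length g) (trans (PrimeOrder.deg-ι (Lin.shiftPrimeOrder a≢0) g) (ℕP.*-comm p (length g)))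

    D-∤ : ∀ {a} → a ≢ 0# → ∀ m → ¬ (p ∣ m) → D a m ≡ 0ℤ
    D-∤ {a} a≢0 m p∤m = ∑-vanish (elements m) λ h h∈ → 𝟙-no (Irr? h ×-dec (shift a h ≟ h))
      λ { (_ , eq) → p∤m (subst (p ∣_) (∈-elements⁻ h∈) (shift-fixed⇒p∣deg a≢0 eq)) }

    quotient-< : ∀ e m → 0 < m → m ≡ e ℕ.* p → e < m
    quotient-< e m 0<m m≡ = subst (e <_) (sym m≡) (ℕP.m<m*n e p {{ℕ.≢-nonZero λ { refl → ℕP.<⇒≢ 0<m (sym m≡) }}} 1<p)

    -- `fixed-recursion` determines D(p e) from D(e) and I(e), and I(e) does not involve the
    -- translation; at arguments prime to p both counts are 0.
    D-independent : ∀ {a b} → a ≢ 0# → b ≢ 0# → ∀ m → 0 < m → D a m ≡ D b m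
    D-independent {a} {b} a≢0 b≢0 = <-rec (λ m → 0 < m → D a m ≡ D b m) step
      where
      step : ∀ m → (∀ {e} → e < m → 0 < e → D a e ≡ D b e) → 0 < m → D a m ≡ D b m
      step m rec 0<m with p ∣? m
      ... | no p∤m = trans (D-∤ a≢0 m p∤m) (sym (D-∤ b≢0 m p∤m))
      ... | yes (divides e m≡) = subst (λ n → D a n ≡ D b n) (trans (ℕP.*-comm p e) (sym m≡))
        (ℤP.*-cancelˡ-≡ (+ p) (D a (p ℕ.* e)) (D b (p ℕ.* e))
          (+-cancelʳ (I e) (+ p ℤ.* D a (p ℕ.* e)) (+ p ℤ.* D b (p ℕ.* e)) (begin
            + p ℤ.* D a (p ℕ.* e) ℤ.+ I e  ≡⟨ Ord.fixed-recursion a≢0 e ⟨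
            + p ℤ.* I e ℤ.+ D a e  ≡⟨ +-congʳ (+ p ℤ.* I e) (rec (quotient-< e m 0<m m≡) 0<e) ⟩
            + p ℤ.* I e ℤ.+ D b e  ≡⟨ Ord.fixed-recursion b≢0 e ⟩
            + p ℤ.* D b (p ℕ.* e) ℤ.+ I e  ∎)))
        where
        open ≡-Reasoning
        0<e : 0 < e
        0<e = ℕP.n≢0⇒n>0 λ { refl → ℕP.<⇒≢ 0<m (sym m≡) }

    module _ {a b : Fin q} (a≢0 : a ≢ 0#) (b∉ : ∀ i → i < p → b ≢ i ∙ a) where

      private
        D₂ : ℕ → ℤ
        D₂ = fixed₂ monicMonoid (shift a) (shift b)

        b-ia≢0 : ∀ i → i < p → b + - (i ∙ a) ≢ 0#
        b-ia≢0 i i<p eq = b∉ i i<p (ScalarGroup.x∙y⁻¹≈ε⇒x≈y b (i ∙ a) eq)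

        -- The condition h(x + b) = h(x + i a) is invariance under b - i a, which is nonzero, so
        -- `D-independent` gives the count.
        conjugate-count : ∀ m → 0 < m → ∀ i → i ∈ upTo p →
          ∑ (elements m) (λ h → 𝟙 (Irr? h ×-dec (shift b h ≟ Ord.iter a≢0 i h))) ≡ D a m
        conjugate-count m 0<m i i∈ = trans
          (∑-cong (elements m) λ h → 𝟙-cong (Irr? h ×-dec (shift b h ≟ Ord.iter a≢0 i h)) (Irr? h ×-dec (shift c h ≟ h))
            (λ { (h-irr , eq) → h-irr , trans (sym (shift-c h)) (trans (cong (shift (- (i ∙ a))) (trans eq (iterate-shift a i h))) (shift-inverse (i ∙ a) h)) })
            (λ { (h-irr , eq) → h-irr , trans (trans (cong (λ e → shift e h) b≡) (sym (shift-shift (i ∙ a) c h)))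
                                       (trans (cong (shift (i ∙ a)) eq) (sym (iterate-shift a i h))) }))
          (D-independent (b-ia≢0 i (∈-upTo⁻ i∈)) a≢0 m 0<m)
          where
          c = b + - (i ∙ a)
          b≡ : b ≡ i ∙ a + c
          b≡ = sym (trans (sym (+-assoc (i ∙ a) b (- (i ∙ a)))) (ScalarGroup.xyx⁻¹≈y (i ∙ a) b))
          shift-c : ∀ h → shift (- (i ∙ a)) (shift b h) ≡ shift c h
          shift-c h = trans (shift-shift (- (i ∙ a)) b h) (cong (λ e → shift e h) (+-comm (- (i ∙ a)) b))

        -- p · `D a m` occurs twice in `fixed₂-recursion`: for the g invariant under L(b) ≠ 0, and
        -- as the sum over the p translations b - i a. Cancelling it and then p leaves the claim.
        D₂-recursion : ∀ m → 0 < m → D₂ (p ℕ.* m) ≡ D₂ m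
        D₂-recursion m 0<m = ℤP.*-cancelˡ-≡ (+ p) (D₂ (p ℕ.* m)) (D₂ m)
          (+-cancelʳ (+ p ℤ.* D a m) (+ p ℤ.* D₂ (p ℕ.* m)) (+ p ℤ.* D₂ m) (begin
            + p ℤ.* D₂ (p ℕ.* m) ℤ.+ + p ℤ.* D a m
              ≡⟨ +-congʳ (+ p ℤ.* D₂ (p ℕ.* m)) conjugates ⟨
            + p ℤ.* D₂ (p ℕ.* m) ℤ.+ ∑ (upTo p) (λ i → ∑ (elements m) λ h → 𝟙 (Irr? h ×-dec (shift b h ≟ Ord.iter a≢0 i h)))
              ≡⟨ Ord.fixed₂-recursion a≢0 (shiftAut b) shift-comm (shift (Lin.L-at a≢0 b)) (Lin.shift-compose a≢0 b) m ⟨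
            + p ℤ.* D (Lin.L-at a≢0 b) m ℤ.+ + p ℤ.* D₂ m
              ≡⟨ cong (λ z → + p ℤ.* z ℤ.+ + p ℤ.* D₂ m) (D-independent (Lin.L-at≢0 a≢0 b b∉) a≢0 m 0<m) ⟩
            + p ℤ.* D a m ℤ.+ + p ℤ.* D₂ m
              ≡⟨ ℤP.+-comm (+ p ℤ.* D a m) (+ p ℤ.* D₂ m) ⟩
            + p ℤ.* D₂ m ℤ.+ + p ℤ.* D a m ∎))
          where
          open ≡-Reasoning
          conjugates : ∑ (upTo p) (λ i → ∑ (elements m) λ h → 𝟙 (Irr? h ×-dec (shift b h ≟ Ord.iter a≢0 i h))) ≡ + p ℤ.* D a m
          conjugates = trans (∑-cong-∈ (upTo p) (conjugate-count m 0<m))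
            (trans (∑-const (upTo p) (D a m)) (cong (λ n → + n ℤ.* D a m) (ListP.length-upTo p)))
          shift-comm : ∀ h → shift b (shift a h) ≡ shift a (shift b h)
          shift-comm h = trans (shift-shift b a h) (trans (cong (λ e → shift e h) (+-comm b a)) (sym (shift-shift a b h)))

        D₂-zero : ∀ m → 0 < m → D₂ m ≡ 0ℤ
        D₂-zero = <-rec (λ m → 0 < m → D₂ m ≡ 0ℤ) step
          where
          step : ∀ m → (∀ {e} → e < m → 0 < e → D₂ e ≡ 0ℤ) → 0 < m → D₂ m ≡ 0ℤ
          step m rec 0<m with p ∣? m
          ... | no p∤m = ∑-vanish (elements m) λ h h∈ → 𝟙-no (Irr? h ×-dec (shift a h ≟ h) ×-dec (shift b h ≟ h))
                λ { (_ , eq , _) → p∤m (subst (p ∣_) (∈-elements⁻ h∈) (shift-fixed⇒p∣deg a≢0 eq)) }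
          ... | yes (divides e m≡) = subst (λ n → D₂ n ≡ 0ℤ) (trans (ℕP.*-comm p e) (sym m≡))
                (trans (D₂-recursion e 0<e) (rec (quotient-< e m 0<m m≡) 0<e))
            where
            0<e : 0 < e
            0<e = ℕP.n≢0⇒n>0 λ { refl → ℕP.<⇒≢ 0<m (sym m≡) }

      no-doubly-invariant : ∀ h → Irr h → shift a h ≡ h → shift b h ≡ h → ⊥
      no-doubly-invariant h h-irr a-inv b-inv = absurd (filter R? (elements (length h)))
        (ℤP.+-injective (trans (length-filter-∑ R? (elements (length h))) (D₂-zero (length h) (ℕP.n≢0⇒n>0 (proj₁ h-irr)))))
        (∈-filter⁺ R? (∈-elements⁺ h) (h-irr , a-inv , b-inv))
        where
        R? : Decidable (λ h → Irr h × shift a h ≡ h × shift b h ≡ h)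
        R? h = Irr? h ×-dec (shift a h ≟ h) ×-dec (shift b h ≟ h)
        absurd : ∀ xs → length xs ≡ 0 → h ∉ xs
        absurd [] _ ()

    -- `fixed-recursion` multiplied by m is a recursion for U(m) = p m D(p m), of the form that
    -- `möbius-inversion` solves with c = p - 1 and Q(m) = q^m.
    D-formula : ∀ {a} → a ≢ 0# → ∀ m → 0 < m →
                + (p ℕ.* m) ℤ.* D a (p ℕ.* m) ≡ + (p ∸ 1) ℤ.* divisorSum p q m
    D-formula {a} a≢0 m 0<m = trans
      (möbius-inversion p-prime (+ (p ∸ 1)) (λ d → + d ℤ.* I d) (λ n → + (q ^ n)) U I-⋆-𝟏 U-recursion m 0<m)
      (cong (+ (p ∸ 1) ℤ.*_) (sym (divisorSum-⋆ p-prime q m 0<m)))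
      where
      open ≡-Reasoning
      U : ℕ → ℤ
      U m = + (p ℕ.* m) ℤ.* D a (p ℕ.* m)
      -- For m = p e the left side is U(e) = p e D(p e), which is m D(m); for p ∤ m both sides are
      -- 0.
      U-⋆-point : ∀ m → 0 < m → (U ⋆ point p) m ≡ + m ℤ.* D a m
      U-⋆-point m 0<m = trans (⋆-comm U (point p) m 0<m) (helper (p ∣? m))
        where
        helper : Dec (p ∣ m) → (point p ⋆ U) m ≡ + m ℤ.* D a m
        helper (no p∤m) = trans (point-⋆-∤ p m U p∤m) (sym (trans (cong (+ m ℤ.*_) (D-∤ a≢0 m p∤m)) (ℤP.*-zeroʳ (+ m))))
        helper (yes (divides e m≡)) = subst (λ n → (point p ⋆ U) n ≡ + n ℤ.* D a n) (trans (ℕP.*-comm p e) (sym m≡))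
          (point-⋆-multiple p e U (ℕ.>-nonZero⁻¹ p) (ℕP.n≢0⇒n>0 λ { refl → ℕP.<⇒≢ 0<m (sym m≡) }))
      -- Writing p as (p ∸ 1) + 1 replaces the truncated subtraction by a variable c, so that the
      -- rest is a ring identity.
      p≡ : + p ≡ + (p ∸ 1) ℤ.+ 1ℤ
      p≡ = cong +_ (sym (ℕP.m∸n+n≡m (ℕP.<⇒≤ 1<p)))
      expand : (c m i d d′ : ℤ) → (c ℤ.+ 1ℤ) ℤ.* i ℤ.+ d ≡ (c ℤ.+ 1ℤ) ℤ.* d′ ℤ.+ i →
               (c ℤ.+ 1ℤ) ℤ.* m ℤ.* d′ ≡ c ℤ.* (m ℤ.* i) ℤ.+ m ℤ.* d
      expand c m i d d′ eq = begin
        (c ℤ.+ 1ℤ) ℤ.* m ℤ.* d′  ≡⟨ regroup₁ c m i d′ ⟩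
        m ℤ.* ((c ℤ.+ 1ℤ) ℤ.* d′ ℤ.+ i) ℤ.- m ℤ.* i  ≡⟨ cong (λ z → m ℤ.* z ℤ.- m ℤ.* i) eq ⟨
        m ℤ.* ((c ℤ.+ 1ℤ) ℤ.* i ℤ.+ d) ℤ.- m ℤ.* i  ≡⟨ regroup₂ c m i d ⟩
        c ℤ.* (m ℤ.* i) ℤ.+ m ℤ.* d  ∎
        where
        regroup₁ : (c m i d′ : ℤ) → (c ℤ.+ 1ℤ) ℤ.* m ℤ.* d′ ≡ m ℤ.* ((c ℤ.+ 1ℤ) ℤ.* d′ ℤ.+ i) ℤ.- m ℤ.* i
        regroup₁ = solve-∀
        regroup₂ : (c m i d : ℤ) → m ℤ.* ((c ℤ.+ 1ℤ) ℤ.* i ℤ.+ d) ℤ.- m ℤ.* i ≡ c ℤ.* (m ℤ.* i) ℤ.+ m ℤ.* d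
        regroup₂ = solve-∀
      U-recursion : U ≐ (λ m → + (p ∸ 1) ℤ.* (+ m ℤ.* I m)) ⊕ U ⋆ point p
      U-recursion m 0<m = begin
        + (p ℕ.* m) ℤ.* D a (p ℕ.* m)  ≡⟨ cong (ℤ._* D a (p ℕ.* m)) (ℤP.pos-* p m) ⟩
        + p ℤ.* + m ℤ.* D a (p ℕ.* m)  ≡⟨ cong (λ z → z ℤ.* + m ℤ.* D a (p ℕ.* m)) p≡ ⟩
        (+ (p ∸ 1) ℤ.+ 1ℤ) ℤ.* + m ℤ.* D a (p ℕ.* m)  ≡⟨ expand (+ (p ∸ 1)) (+ m) (I m) (D a m) (D a (p ℕ.* m)) (subst (λ z → z ℤ.* I m ℤ.+ D a m ≡ z ℤ.* D a (p ℕ.* m) ℤ.+ I m) p≡ (Ord.fixed-recursion a≢0 m)) ⟩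
        + (p ∸ 1) ℤ.* (+ m ℤ.* I m) ℤ.+ + m ℤ.* D a m  ≡⟨ +-congʳ (+ (p ∸ 1) ℤ.* (+ m ℤ.* I m)) (U-⋆-point m 0<m) ⟨
        + (p ∸ 1) ℤ.* (+ m ℤ.* I m) ℤ.+ (U ⋆ point p) m  ∎

    -- From the counts to the sets C_S(n)

    module _ (S : Subset q) (S-subspace : IsSubspace S) where

      private
        0∈S : 0# ∈ₛ S
        0∈S = proj₁ S-subspace

        multiple∈S : ∀ {a} → a ∈ₛ S → ∀ i → i ∙ a ∈ₛ S
        multiple∈S a∈S zero    = 0∈S
        multiple∈S a∈S (suc i) = proj₁ (proj₂ S-subspace) _ _ a∈S (multiple∈S a∈S i)

        line : Fin q → List (Fin q)
        line a = applyUpTo (_∙ a) p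

        line-unique : ∀ {a} → a ≢ 0# → Unique (line a)
        line-unique {a} a≢0 = applyUpTo⁺₁ (_∙ a) p (Lin.multiples-distinct a≢0)

        length-line : ∀ a → length (line a) ≡ p
        length-line a = ListP.length-applyUpTo (_∙ a) p

        line⊆S : ∀ {a} → a ∈ₛ S → ∀ {x} → x ∈ line a → x ∈ members S
        line⊆S {a} a∈S x∈ with ∈-applyUpTo⁻ (_∙ a) x∈
        ... | i , _ , refl = ∈-members⁺ (multiple∈S a∈S i)

      nonzero-member : ∀ r → 0 < r → ∣ S ∣ ≡ p ^ r → ∃ λ a → a ∈ₛ S × a ≢ 0#
      nonzero-member r 0<r size with ⊆-outside FinP._≟_ {0# ∷ []} {members S} ([] ∷ []) (members-unique S)
          (λ { (here refl) → ∈-members⁺ 0∈S }) (subst (1 <_) (sym (trans (length-members S) size)) (ℕP.^-monoʳ-< p 1<p 0<r))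
      ... | a , a∈ , a∉ = a , ∈-members⁻ a∈ , (λ a≡0 → a∉ (here a≡0))

      -- The multiples of a fill only p of the p^r > p elements of S.
      independent-member : ∀ {a} → a ∈ₛ S → a ≢ 0# → ∀ r → 1 < r → ∣ S ∣ ≡ p ^ r → ∃ λ b → b ∈ₛ S × (∀ i → i < p → b ≢ i ∙ a)
      independent-member {a} a∈S a≢0 r 1<r size with ⊆-outside FinP._≟_ {line a} {members S} (line-unique a≢0) (members-unique S) (line⊆S a∈S)
          (subst₂ _<_ (trans (ℕP.^-identityʳ p) (sym (length-line a))) (sym (trans (length-members S) size)) (ℕP.^-monoʳ-< p 1<p 1<r))
      ... | b , b∈ , b∉ = b , ∈-members⁻ b∈ , (λ { i i<p refl → b∉ (∈-applyUpTo⁺ (_∙ a) i<p) })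

      member-multiple : ∀ {a} → a ∈ₛ S → a ≢ 0# → ∣ S ∣ ≡ p → ∀ {s} → s ∈ₛ S → ∃ λ i → s ≡ i ∙ a
      member-multiple {a} a∈S a≢0 size s∈S
        with ∈-applyUpTo⁻ (_∙ a) (⊆-covers FinP._≟_ {line a} {members S} (line-unique a≢0) (members-unique S) (line⊆S a∈S)
               (trans (length-line a) (sym (trans (length-members S) size))) (∈-members⁺ s∈S))
      ... | i , _ , s≡ = i , s≡

      C-empty-rank>1 : ∀ r → 1 < r → ∣ S ∣ ≡ p ^ r → ∀ n → HasSize (Poly.C F S n) 0
      C-empty-rank>1 r 1<r size n with nonzero-member r (ℕP.<-trans (s≤s z≤n) 1<r) size
      ... | a , a∈S , a≢0 with independent-member a∈S a≢0 r 1<r size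
      ...   | b , b∈S , b∉ = HasSize-empty λ { v (irr , inv) →
              no-doubly-invariant a≢0 b∉ (toList v) (Irreducible⇒Irr F (toList v) irr)
                (translate⇒shift F a (toList v) (inv a a∈S)) (translate⇒shift F b (toList v) (inv b b∈S)) }

      C-empty-∤ : ∀ r → 0 < r → ∣ S ∣ ≡ p ^ r → ∀ n → ¬ (p ∣ n) → HasSize (Poly.C F S n) 0
      C-empty-∤ r 0<r size n p∤n with nonzero-member r 0<r size
      ... | a , a∈S , a≢0 = HasSize-empty λ { v (irr , inv) →
            p∤n (subst (p ∣_) (VecP.length-toList v) (shift-fixed⇒p∣deg a≢0 (translate⇒shift F a (toList v) (inv a a∈S)))) }

      -- S has p elements, as many as the line spanned by a nonzero member a, so the two coincide.
      -- Invariance under a alone then gives invariance under S, and the number sought is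
      -- `D a (p * m)`.
      C-size-rank-1 : ∣ S ∣ ≡ p ^ 1 → ∀ m → 0 < m →
               ∃ λ N → HasSize (Poly.C F S (p ℕ.* m)) N × (+ (p ℕ.* m)) ℤ.* (+ N) ≡ (+ (p ∸ 1)) ℤ.* divisorSum p q m
      C-size-rank-1 size m 0<m with nonzero-member 1 (s≤s z≤n) size
      ... | a , a∈S , a≢0 = length members-C
          , (members-C , filter⁺ R? (vectors-unique q (p ℕ.* m)) , (λ v → mk⇔ (sound v) (complete v)) , refl)
          , trans (cong (+ (p ℕ.* m) ℤ.*_) size-C) (D-formula a≢0 m 0<m)
        where
        R? : Decidable (λ (v : Vec (Fin q) (p ℕ.* m)) → Irr (toList v) × shift a (toList v) ≡ toList v)
        R? v = Irr? (toList v) ×-dec (shift a (toList v) ≟ toList v)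
        members-C : List (Vec (Fin q) (p ℕ.* m))
        members-C = filter R? (vectors q (p ℕ.* m))
        size-C : + length members-C ≡ D a (p ℕ.* m)
        size-C = trans (length-filter-∑ R? (vectors q (p ℕ.* m))) (sym (∑-map (vectors q (p ℕ.* m)) toList _))
        shift-multiple : ∀ i l → shift a l ≡ l → shift (i ∙ a) l ≡ l
        shift-multiple i l eq = trans (sym (iterate-shift a i l)) (Ord.iter-fixed a≢0 i eq)
        sound : ∀ v → v ∈ members-C → Poly.C F S (p ℕ.* m) v
        sound v v∈ with ∈-filter⁻ R? {xs = vectors q (p ℕ.* m)} v∈
        ... | _ , irr , inv = Irr⇒Irreducible F (toList v) irr , invariant
          where
          invariant : TranslationInvariant S (monic (toList v))
          invariant s s∈S with member-multiple a∈S a≢0 (trans size (ℕP.^-identityʳ p)) s∈S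
          ... | i , refl = shift⇒translate F (i ∙ a) (toList v) (shift-multiple i (toList v) inv)
        complete : ∀ v → Poly.C F S (p ℕ.* m) v → v ∈ members-C
        complete v (irr , inv) = ∈-filter⁺ R? (∈-vectors v)
          (Irreducible⇒Irr F (toList v) irr , translate⇒shift F a (toList v) (inv a a∈S))

open import Data.Nat using (_*_)

theorem2p7 : (p k q : ℕ) → Prime p → q ≡ p ^ k → (F : FiniteField q)
    → (S : Subset q) → Poly.IsSubspace F S
    → (r : ℕ) → 0 < r → ∣ S ∣ ≡ p ^ r
    → ((1 < r → ∀ n → 0 < n → HasSize (Poly.C F S n) 0)
    × (r ≡ 1 → ∀ n → 0 < n → ¬ (p ∣ n) → HasSize (Poly.C F S n) 0)
    × (r ≡ 1 → ∀ m → 0 < m → ∃ λ N → HasSize (Poly.C F S (p * m)) N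
    × ((+ (p * m)) ℤ.* (+ N) ≡ (+ (p ∸ 1)) ℤ.* divisorSum p q m)))
theorem2p7 p k q p-prime q≡p^k F S S-subspace r 0<r size =
    (λ 1<r n _ → C-empty-rank>1 F p-prime char S S-subspace r 1<r size n)
  , (λ _ n _ p∤n → C-empty-∤ F p-prime char S S-subspace r 0<r size n p∤n)
  , (λ { refl m 0<m → C-size-rank-1 F p-prime char S S-subspace size m 0<m })
  where char = characteristic F p k q≡p^k
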